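{- Let $k \geq 2$ be an integer. There is no non-diregular $k$-geodetic digraph with minimum out-degree at least $2$ and order $M(2,k)+2$, where $M(2,k) = 1+2+2^2+\dots+2^k$.
   Context: A digraph is $k$-geodetic if for any two vertices $u,v$ there is at most one directed walk from $u$ to $v$ of length at most $k$. A digraph is diregular if there is $d$ with $d^-(u)=d^+(u)=d$ for all vertices $u$. A $k$-geodetic digraph with minimum out-degree $\geq d$ and order $M(d,k)+\epsilon$, where $M(d,k)=1+d+\dots+d^k$, is called a $(d,k,+\epsilon)$-digraph (a digraph with excess $\epsilon$); the claim says there are no non-diregular $(2,k,+2)$-digraphs. -}

module Defs where

open import Data.Nat using (ℕ; zero; suc; _+_; _*_; _^_; _≤_)
open import Data.Fin using (Fin)
open import Data.Bool using (Bool; true; false; if_then_else_)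
open import Data.List using (List; []; _∷_; map; allFin)
open import Data.Nat.ListAction using (sum)
open import Data.Product using (∃; _×_)
open import Relation.Binary.PropositionalEquality using (_≡_)

Digraph : ℕ → Set
Digraph n = Fin n → Fin n → Bool

module _ {n : ℕ} (G : Digraph n) where

  data Walk : ℕ → Fin n → Fin n → Set where
    nil  : ∀ {u} → Walk 0 u u
    cons : ∀ {l u w v} → G u w ≡ true → Walk l w v → Walk (suc l) u v

  -- the vertex sequence of a walk (determines the walk, as arcs are simple)
  vertices : ∀ {l u v} → Walk l u v → List (Fin n)
  vertices {u = u} nil = u ∷ []
  vertices {u = u} (cons _ p) = u ∷ vertices p

  Geodetic : ℕ → Set
  Geodetic k = ∀ {u v l l'} → l ≤ k → l' ≤ k →
               (p : Walk l u v) (q : Walk l' u v) → vertices p ≡ vertices q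

  outdeg : Fin n → ℕ
  outdeg u = sum (map (λ v → if G u v then 1 else 0) (allFin n))

  indeg : Fin n → ℕ
  indeg v = sum (map (λ u → if G u v then 1 else 0) (allFin n))

  Diregular : Set
  Diregular = ∃ λ d → ∀ u → indeg u ≡ d × outdeg u ≡ d

M : ℕ → ℕ → ℕ
M d zero = 1
M d (suc k) = M d k + d ^ suc k

{-# OPTIONS --safe #-}
-- Counting shows that all out-degrees are 2, so that every vertex u fails to reach exactly two
-- vertices, its outliers (u ↛ v). If A is the adjacency matrix, P the outlier matrix and J the
-- all-ones matrix, then I + A + … + A^k = J - P commutes with A; comparing entries relates the
-- outliers of u, those of its two children, and the in-degrees. Moreover, if u and y share a
-- child, then u misses y or the other child of y.
-- These two facts bound all in-degrees by 3. A vertex of in-degree 0 would leave a digraph of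
-- excess one on the other vertices, on which the outlier map preserves arcs, and this is quickly
-- contradictory. The set S of vertices of in-degree 1 has at most 4 elements, since it consists of
-- outliers of the two children of any vertex; there are as many vertices of in-degree 3.
-- If |S| = 4, then all outliers lie in S, which is again a local contradiction. If 1 ≤ |S| ≤ 3 and
-- k ≥ 3, then the in-tree of a vertex v of in-degree 3 is too large unless enough elements of S are
-- parents of v: this excludes |S| = 1, and for |S| = 2 and |S| = 3 it determines the arcs from S to
-- the vertices of in-degree 3 well enough for a local contradiction. If k = 2, there are 9
-- vertices, and an exhaustive search finds no digraph with a vertex of in-degree 1.
module Submission where

open import Defs
open import Data.Nat
open import Data.Nat.Properties
open import Data.Nat.Tactic.RingSolver using (solve-∀)
import Data.Nat.ListAction as ListAction
open import Data.Fin using (Fin; zero; suc)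
import Data.Fin.Properties as Fin
open import Data.Bool using (Bool; true; false; if_then_else_; T; not; _∨_)
open import Data.Bool.ListAction using (all)
open import Data.List
  using (List; []; _∷_; _++_; length; map; filter; concatMap; upTo; cartesianProduct; tabulate; allFin)
open import Data.List.Properties using (map-++; map-tabulate; ∷-injectiveʳ; ∷-injectiveˡ)
open import Data.List.Membership.Propositional using (_∈_; _∉_)
open import Data.List.Membership.Propositional.Properties
  using (∈-filter⁺; ∈-filter⁻; ∈-allFin; ∈-cartesianProduct⁺; ∈-upTo⁺)
import Data.List.Membership.DecPropositional as DecMembership
open import Data.List.Relation.Unary.Any using (here; there)
open import Data.List.Relation.Unary.All as All using (All; []; _∷_)
import Data.List.Relation.Unary.All.Properties as All
open import Data.List.Relation.Unary.AllPairs as AllPairs using (AllPairs; []; _∷_)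
import Data.List.Relation.Unary.AllPairs.Properties as AllPairs
open import Data.List.Relation.Unary.Unique.Propositional using (Unique)
import Data.List.Relation.Unary.Unique.Propositional.Properties as Unique
open import Data.List.Relation.Unary.Unique.DecPropositional _≟_ using (unique?)
open import Data.Product using (Σ; ∃-syntax; _×_; _,_; proj₁; proj₂)
open import Data.Sum using (_⊎_; inj₁; inj₂; [_,_]′)
open import Data.Empty using (⊥; ⊥-elim)
open import Function using (_∘_; case_of_)
open import Relation.Nullary
open import Relation.Nullary.Decidable using (_×-dec_; _⊎-dec_; ¬?; dec-true; dec-false; toWitness)
open import Relation.Binary.PropositionalEquality
open import Algebra.Properties.Semiring.Sum +-*-semiring
  using (sum; sum-cong-≗; ∑-distrib-+; ∑-comm; *-distribˡ-sum)

-- The recurring obstacle is that each vertex has only two outliers, while the matrix identity keeps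
-- demanding more: every vertex misses a parent of each vertex of in-degree 3, and missing two such
-- parents makes one of its children miss that vertex as well. The local contradictions play this
-- against `sibling`. The level count behind |S| = 1, 2, 3 is as follows. Put m + 1 = 2^(k-2). A
-- full in-tree of depth k at a vertex of in-degree 3 has 1 + 3 (2^k - 1) vertices, 4m + 1 more than
-- there are. An element of S saves 2m + 1 vertices as a parent of the root and at most m further
-- out. For m > 0 one element is too little, two must both be parents, and three need two parents,
-- or one parent and two vertices at distance 2. For k = 2 we have m = 0, and the count only asks
-- for one parent in S; hence the search. Walks are counted with values in ℕ, so that being geodetic
-- reads `R ≤ 1`, and the outlier matrix is added to `R` rather than subtracted from J.

open module FinMembership {n} = DecMembership (Fin._≟_ {n}) using (_∈?_)

-- Finite sums

δ : ∀ {n} → Fin n → Fin n → ℕ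
δ u v = if does (u Fin.≟ v) then 1 else 0

δ-refl : ∀ {n} (u : Fin n) → δ u u ≡ 1
δ-refl u rewrite dec-true (u Fin.≟ u) refl = refl

δ-≢ : ∀ {n} {u v : Fin n} → u ≢ v → δ u v ≡ 0
δ-≢ {u = u} {v} u≢v rewrite dec-false (u Fin.≟ v) u≢v = refl

δ-suc : ∀ {n} (u v : Fin n) → δ (suc u) (suc v) ≡ δ u v
δ-suc u v with u Fin.≟ v
... | yes _ = refl
... | no _  = refl

δ-positive : ∀ {n} {u v : Fin n} → 1 ≤ δ u v → u ≡ v
δ-positive {u = u} {v} p with u Fin.≟ v
... | yes e = e
... | no _ with () ← p

count : ∀ {n} → List (Fin n) → Fin n → ℕ
count []      v = 0
count (x ∷ l) v = δ x v + count l v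

module _ {n : ℕ} where

  count-∉ : ∀ {v} (l : List (Fin n)) → v ∉ l → count l v ≡ 0
  count-∉ []      _ = refl
  count-∉ (x ∷ l) v∉ = cong₂ _+_ (δ-≢ (v∉ ∘ here ∘ sym)) (count-∉ l (v∉ ∘ there))

  count-∈ : ∀ {v} (l : List (Fin n)) → v ∈ l → 1 ≤ count l v
  count-∈ {v} (x ∷ l) (here refl) = ≤-trans (≤-reflexive (sym (δ-refl v))) (m≤m+n _ _)
  count-∈ {v} (x ∷ l) (there v∈) = ≤-trans (count-∈ l v∈) (m≤n+m _ _)

  count≥1⇒∈ : ∀ {v} (l : List (Fin n)) → 1 ≤ count l v → v ∈ l
  count≥1⇒∈ {v} (x ∷ l) p with x Fin.≟ v
  ... | yes refl = here refl
  ... | no _ = there (count≥1⇒∈ l p)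

  count-unique : ∀ {l : List (Fin n)} v → Unique l → count l v ≤ 1
  count-unique v [] = z≤n
  count-unique {x ∷ l} v (x∉ ∷ u) with x Fin.≟ v
  ... | yes refl = ≤-reflexive (cong suc (count-∉ l λ x∈ → All.lookup x∉ x∈ refl))
  ... | no _ = count-unique v u

positive-+ : ∀ {a b} → 1 ≤ a + b → 1 ≤ a ⊎ 1 ≤ b
positive-+ {zero}  p = inj₂ p
positive-+ {suc a} p = inj₁ (s≤s z≤n)

sum-mono : ∀ {n} {f g : Fin n → ℕ} → (∀ i → f i ≤ g i) → sum f ≤ sum g
sum-mono {zero}  p = z≤n
sum-mono {suc n} p = +-mono-≤ (p zero) (sum-mono (p ∘ suc))

sum-term : ∀ {n} (f : Fin n → ℕ) i → f i ≤ sum f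
sum-term f zero    = m≤m+n _ _
sum-term f (suc i) = ≤-trans (sum-term (f ∘ suc) i) (m≤n+m _ _)

sum-const : ∀ n c → sum {n} (λ _ → c) ≡ n * c
sum-const zero    c = refl
sum-const (suc n) c = cong (c +_) (sum-const n c)

sum-δ : ∀ {n} (i : Fin n) (f : Fin n → ℕ) → sum (λ j → δ i j * f j) ≡ f i
sum-δ {suc n} zero f = begin
  f zero + 0 + sum {n} (λ _ → 0)  ≡⟨ cong₂ _+_ (+-identityʳ (f zero)) (trans (sum-const n 0) (*-zeroʳ n)) ⟩
  f zero + 0                      ≡⟨ +-identityʳ (f zero) ⟩
  f zero                          ∎
  where open ≡-Reasoning
sum-δ (suc i) f = trans (sum-cong-≗ λ j → cong (_* f (suc j)) (δ-suc i j)) (sum-δ i (f ∘ suc))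

sum-δ₁ : ∀ {n} (i : Fin n) → sum (δ i) ≡ 1
sum-δ₁ i = trans (sum-cong-≗ λ j → sym (*-identityʳ (δ i j))) (sum-δ i (λ _ → 1))

sum-count : ∀ {n} (l : List (Fin n)) → sum (count l) ≡ length l
sum-count {n} [] = trans (sum-const n 0) (*-zeroʳ n)
sum-count (x ∷ l) = trans (∑-distrib-+ (δ x) (count l)) (cong₂ _+_ (sum-δ₁ x) (sum-count l))

sum-≤-≡ : ∀ {n} {f g : Fin n → ℕ} → (∀ i → f i ≤ g i) → sum g ≤ sum f → ∀ i → f i ≡ g i
sum-≤-≡ {suc n} {f} {g} p q zero = ≤-antisym (p zero)
  (+-cancelʳ-≤ (sum (f ∘ suc)) _ _ (≤-trans (+-monoʳ-≤ (g zero) (sum-mono (p ∘ suc))) q))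
sum-≤-≡ {suc n} {f} {g} p q (suc i) = sum-≤-≡ (p ∘ suc)
  (+-cancelˡ-≤ (f zero) _ _ (≤-trans (+-monoˡ-≤ _ (p zero)) q)) i

-- Pigeonhole: each vertex adds at most one to the excess of `f` over `g`, so a list shorter than
-- the total excess cannot cover it. With `g` constantly 0 this supplies children, parents and
-- outliers; with `g` constantly 2, vertices of in-degree 3.
fresh : ∀ {n} (f g : Fin n → ℕ) (l : List (Fin n)) → (∀ v → f v ≤ suc (g v)) →
        sum g + length l < sum f → ∃[ v ] v ∉ l × g v < f v
fresh f g l f≤1+g lt with Fin.any? (λ v → ¬? (v ∈? l) ×-dec (g v <? f v))
... | yes found = found
... | no none = ⊥-elim (<-irrefl refl (<-≤-trans lt (begin
    sum f                       ≤⟨ sum-mono bound ⟩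
    sum (λ v → g v + count l v) ≡⟨ ∑-distrib-+ g (count l) ⟩
    sum g + sum (count l)       ≡⟨ cong (sum g +_) (sum-count l) ⟩
    sum g + length l            ∎)))
  where
  open ≤-Reasoning
  bound : ∀ v → f v ≤ g v + count l v
  bound v with v ∈? l
  ... | yes v∈ = ≤-trans (f≤1+g v) (≤-trans (≤-reflexive (+-comm 1 (g v))) (+-monoʳ-≤ (g v) (count-∈ l v∈)))
  ... | no v∉  = ≤-trans (≮⇒≥ λ gt → none (v , v∉ , gt)) (m≤m+n _ _)

fresh-positive : ∀ {n} (f : Fin n → ℕ) (l : List (Fin n)) → (∀ v → f v ≤ 1) →
                 length l < sum f → ∃[ v ] v ∉ l × 1 ≤ f v
fresh-positive {n} f l f≤1 lt = fresh f (λ _ → 0) l f≤1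
  (subst (λ z → z + length l < sum f) (sym (trans (sum-const n 0) (*-zeroʳ n))) lt)

count≤ : ∀ {n} {f : Fin n → ℕ} {l} → Unique l → All (λ v → 1 ≤ f v) l → ∀ v → count l v ≤ f v
count≤ {l = l} u all≥1 v with v ∈? l
... | yes v∈ = ≤-trans (count-unique v u) (All.lookup all≥1 v∈)
... | no v∉  = ≤-trans (≤-reflexive (count-∉ l v∉)) z≤n

unique-length : ∀ {n} {f : Fin n → ℕ} {l} → Unique l → All (λ v → 1 ≤ f v) l → length l ≤ sum f
unique-length {l = l} u all≥1 = ≤-trans (≤-reflexive (sym (sum-count l))) (sum-mono (count≤ u all≥1))

-- Walks

-- Children and outliers have the same shape, two distinct vertices attached to each vertex; both
-- are instances. The order of the two values is arbitrary, and `one-of` and `∑-values` hide it.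
module TwoValued {n : ℕ} (f g : Fin n → Fin n) (f≢g : ∀ u → f u ≢ g u) where

  _↠_ : Fin n → Fin n → Set
  u ↠ v = v ≡ f u ⊎ v ≡ g u

  ↠? : ∀ u v → Dec (u ↠ v)
  ↠? u v = (v Fin.≟ f u) ⊎-dec (v Fin.≟ g u)

  ⟦_,_⟧ : Fin n → Fin n → ℕ
  ⟦ u , v ⟧ = δ (f u) v + δ (g u) v

  ⟦⟧-yes : ∀ {u v} → u ↠ v → ⟦ u , v ⟧ ≡ 1
  ⟦⟧-yes {u} (inj₁ refl) = cong₂ _+_ (δ-refl (f u)) (δ-≢ (f≢g u ∘ sym))
  ⟦⟧-yes {u} (inj₂ refl) = cong₂ _+_ (δ-≢ (f≢g u)) (δ-refl (g u))

  ⟦⟧-no : ∀ {u v} → ¬ u ↠ v → ⟦ u , v ⟧ ≡ 0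
  ⟦⟧-no ¬uv = cong₂ _+_ (δ-≢ (¬uv ∘ inj₁ ∘ sym)) (δ-≢ (¬uv ∘ inj₂ ∘ sym))

  ⟦⟧≤1 : ∀ u v → ⟦ u , v ⟧ ≤ 1
  ⟦⟧≤1 u v with ↠? u v
  ... | yes p = ≤-reflexive (⟦⟧-yes p)
  ... | no ¬p = ≤-trans (≤-reflexive (⟦⟧-no ¬p)) z≤n

  ⟦⟧≥1 : ∀ {u v} → 1 ≤ ⟦ u , v ⟧ → u ↠ v
  ⟦⟧≥1 {u} {v} p with ↠? u v
  ... | yes q = q
  ... | no ¬q with () ← subst (1 ≤_) (⟦⟧-no ¬q) p

  ⟦⟧≡0 : ∀ {u v} → ⟦ u , v ⟧ ≡ 0 → ¬ u ↠ v
  ⟦⟧≡0 e p with () ← trans (sym (⟦⟧-yes p)) e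

  other : ∀ {u a} → u ↠ a → ∃[ b ] a ≢ b × u ↠ b
  other {u} (inj₁ refl) = g u , f≢g u , inj₂ refl
  other {u} (inj₂ refl) = f u , f≢g u ∘ sym , inj₁ refl

  one-of : ∀ {u a b x} → u ↠ a → u ↠ b → a ≢ b → u ↠ x → x ≡ a ⊎ x ≡ b
  one-of (inj₁ refl) (inj₁ refl) ne _ = ⊥-elim (ne refl)
  one-of (inj₂ refl) (inj₂ refl) ne _ = ⊥-elim (ne refl)
  one-of (inj₁ refl) (inj₂ refl) ne x = x
  one-of (inj₂ refl) (inj₁ refl) ne (inj₁ e) = inj₂ e
  one-of (inj₂ refl) (inj₁ refl) ne (inj₂ e) = inj₁ e

  the-other : ∀ {u a b x} → u ↠ a → u ↠ b → a ≢ b → u ↠ x → x ≢ a → x ≡ b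
  the-other a b ne x x≢a = [ (λ e → ⊥-elim (x≢a e)) , (λ e → e) ]′ (one-of a b ne x)

  ∑-values : ∀ {u a b} (F : Fin n → ℕ) → u ↠ a → u ↠ b → a ≢ b → F a + F b ≡ F (f u) + F (g u)
  ∑-values F (inj₁ refl) (inj₁ refl) ne = ⊥-elim (ne refl)
  ∑-values F (inj₂ refl) (inj₂ refl) ne = ⊥-elim (ne refl)
  ∑-values F (inj₁ refl) (inj₂ refl) ne = refl
  ∑-values F (inj₂ refl) (inj₁ refl) ne = +-comm (F _) _

module Walks {n : ℕ} (c₁ c₂ : Fin n → Fin n) where

  A : Fin n → Fin n → ℕ
  A u v = δ (c₁ u) v + δ (c₂ u) v

  -- W t u v counts the walks of length t, R j u v those of length at most j.
  W R : ℕ → Fin n → Fin n → ℕ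
  W zero    u v = δ u v
  W (suc t) u v = W t (c₁ u) v + W t (c₂ u) v
  R zero    u v = δ u v
  R (suc j) u v = δ u v + (R j (c₁ u) v + R j (c₂ u) v)

  R-suc : ∀ j u v → R (suc j) u v ≡ R j u v + W (suc j) u v
  R-suc zero    u v = refl
  R-suc (suc j) u v rewrite R-suc j (c₁ u) v | R-suc j (c₂ u) v =
    lemma (δ u v) (R j (c₁ u) v) _ (R j (c₂ u) v) _
    where
    lemma : ∀ d a b a′ b′ → d + (a + b + (a′ + b′)) ≡ d + (a + a′) + (b + b′)
    lemma = solve-∀

  R-mono : ∀ {i j} → i ≤′ j → ∀ u v → R i u v ≤ R j u v
  R-mono ≤′-refl u v = ≤-refl
  R-mono (≤′-step {j} i≤j) u v = ≤-trans (R-mono i≤j u v)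
    (≤-trans (m≤m+n (R j u v) (W (suc j) u v)) (≤-reflexive (sym (R-suc j u v))))

  W≤R : ∀ t u v → W t u v ≤ R t u v
  W≤R zero    u v = ≤-refl
  W≤R (suc t) u v = ≤-trans (m≤n+m (W (suc t) u v) (R t u v)) (≤-reflexive (sym (R-suc t u v)))

  W+W≤R : ∀ {s t j} → s < t → t ≤ j → ∀ u v → W s u v + W t u v ≤ R j u v
  W+W≤R {s} {suc t} {j} (s≤s s≤t) t<j u v = begin
    W s u v + W (suc t) u v  ≤⟨ +-monoˡ-≤ (W (suc t) u v) (≤-trans (W≤R s u v) (R-mono (≤⇒≤′ s≤t) u v)) ⟩
    R t u v + W (suc t) u v  ≡⟨ R-suc t u v ⟨
    R (suc t) u v            ≤⟨ R-mono (≤⇒≤′ t<j) u v ⟩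
    R j u v                  ∎
    where open ≤-Reasoning

  -- `R` splits off the first arc of a walk, this the last one. That both hold says that A commutes
  -- with I + A + ... + A^j, the source of the balance equation.
  R-right : ∀ j u v → R (suc j) u v ≡ δ u v + sum (λ w → R j u w * A w v)
  R-right zero u v = cong (δ u v +_) (sym (sum-δ u (λ w → A w v)))
  R-right (suc j) u v = cong (δ u v +_) (begin
    R (suc j) (c₁ u) v + R (suc j) (c₂ u) v
      ≡⟨ cong₂ _+_ (R-right j (c₁ u) v) (R-right j (c₂ u) v) ⟩
    δ (c₁ u) v + X + (δ (c₂ u) v + Y)
      ≡⟨ lemma (δ (c₁ u) v) X (δ (c₂ u) v) Y ⟩
    A u v + (X + Y)
      ≡⟨ cong₂ _+_ (sum-δ u (λ w → A w v)) (∑-distrib-+ x y) ⟨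
    sum (λ w → δ u w * A w v) + sum (λ w → x w + y w)
      ≡⟨ ∑-distrib-+ (λ w → δ u w * A w v) (λ w → x w + y w) ⟨
    sum (λ w → δ u w * A w v + (x w + y w))
      ≡⟨ sum-cong-≗ (λ w → distr (δ u w) (R j (c₁ u) w) (R j (c₂ u) w) (A w v)) ⟩
    sum (λ w → R (suc j) u w * A w v) ∎)
    where
    open ≡-Reasoning
    x y : Fin n → ℕ
    x w = R j (c₁ u) w * A w v
    y w = R j (c₂ u) w * A w v
    X = sum x
    Y = sum y
    lemma : ∀ a b c d → a + b + (c + d) ≡ a + c + (b + d)
    lemma = solve-∀
    distr : ∀ a b c d → a * d + (b * d + c * d) ≡ (a + (b + c)) * d
    distr = solve-∀

  sum-R : ∀ j u → suc (sum (R j u)) ≡ 2 ^ suc j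
  sum-R zero    u = cong suc (sum-δ₁ u)
  sum-R (suc j) u = begin
    suc (sum (R (suc j) u))
      ≡⟨ cong suc (∑-distrib-+ (δ u) _) ⟩
    suc (sum (δ u) + sum (λ v → R j (c₁ u) v + R j (c₂ u) v))
      ≡⟨ cong suc (cong₂ _+_ (sum-δ₁ u) (∑-distrib-+ (R j (c₁ u)) (R j (c₂ u)))) ⟩
    suc (suc (sum (R j (c₁ u)) + sum (R j (c₂ u))))
      ≡⟨ lemma (sum (R j (c₁ u))) (sum (R j (c₂ u))) ⟩
    suc (sum (R j (c₁ u))) + suc (sum (R j (c₂ u)))
      ≡⟨ cong₂ _+_ (sum-R j (c₁ u)) (trans (sum-R j (c₂ u)) (sym (+-identityʳ _))) ⟩
    2 ^ suc (suc j) ∎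
    where
    open ≡-Reasoning
    lemma : ∀ a b → suc (suc (a + b)) ≡ suc a + suc b
    lemma = solve-∀

  W-refl : ∀ u → 1 ≤ W 0 u u
  W-refl u = ≤-reflexive (sym (δ-refl u))

  R-refl : ∀ j u → 1 ≤ R j u u
  R-refl j u = ≤-trans (W-refl u) (R-mono (≤⇒≤′ (z≤n {j})) u u)

  W-snoc : ∀ t {u w v} → 1 ≤ A w v → W t u w ≤ W (suc t) u v
  W-snoc zero {u} {w} {v} p with u Fin.≟ w
  ... | yes refl = p
  ... | no _ = z≤n
  W-snoc (suc t) p = +-mono-≤ (W-snoc t p) (W-snoc t p)

  R-snoc : ∀ j {u w v} → 1 ≤ A w v → R j u w ≤ R (suc j) u v
  R-snoc j {u} {w} {v} p = begin
    R j u w            ≡⟨ *-identityʳ _ ⟨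
    R j u w * 1        ≤⟨ *-monoʳ-≤ (R j u w) p ⟩
    R j u w * A w v    ≤⟨ sum-term term w ⟩
    sum term           ≤⟨ m≤n+m (sum term) (δ u v) ⟩
    δ u v + sum term   ≡⟨ R-right j u v ⟨
    R (suc j) u v      ∎
    where
    open ≤-Reasoning
    term : Fin n → ℕ
    term w = R j u w * A w v

-- Outliers

-- Here k = 2 + i, which builds in k ≥ 2, and the order 2^(k+1) + 1 is M(2,k) + 2.
record BinaryGeodetic (n i : ℕ) : Set where
  field
    c₁ c₂    : Fin n → Fin n
    c₁≢c₂    : ∀ u → c₁ u ≢ c₂ u
    geodetic : ∀ u v → Walks.R c₁ c₂ (2 + i) u v ≤ 1
    order    : n ≡ suc (2 ^ (3 + i))

module Structure {n i : ℕ} (X : BinaryGeodetic n i) where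
  open BinaryGeodetic X
  open Walks c₁ c₂

  k : ℕ
  k = 2 + i

  module Arc = TwoValued c₁ c₂ c₁≢c₂
  open Arc public using () renaming (_↠_ to _⟶_; ↠? to ⟶?)

  defect : Fin n → Fin n → ℕ
  defect u v = 1 ∸ R k u v

  R+defect : ∀ u v → R k u v + defect u v ≡ 1
  R+defect u v = m+[n∸m]≡n (geodetic u v)

  sum-defect : ∀ u → sum (defect u) ≡ 2
  sum-defect u = +-cancelˡ-≡ (sum (R k u)) _ _ (begin
    sum (R k u) + sum (defect u)         ≡⟨ ∑-distrib-+ (R k u) (defect u) ⟨
    sum (λ v → R k u v + defect u v)     ≡⟨ sum-cong-≗ (R+defect u) ⟩
    sum {n} (λ _ → 1)                    ≡⟨ sum-const n 1 ⟩
    n * 1                                ≡⟨ *-identityʳ n ⟩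
    n                                    ≡⟨ order ⟩
    suc (2 ^ suc k)                      ≡⟨ cong suc (sum-R k u) ⟨
    2 + sum (R k u)                      ≡⟨ +-comm 2 _ ⟩
    sum (R k u) + 2                      ∎)
    where open ≡-Reasoning

  abstract
    outlier₁ : ∀ u → ∃[ a ] a ∉ [] × 1 ≤ defect u a
    outlier₁ u = fresh-positive (defect u) [] (λ v → m∸n≤m 1 (R k u v))
      (≤-trans (s≤s z≤n) (≤-reflexive (sym (sum-defect u))))

    outlier₂ : ∀ u → ∃[ b ] b ∉ proj₁ (outlier₁ u) ∷ [] × 1 ≤ defect u b
    outlier₂ u = fresh-positive (defect u) (proj₁ (outlier₁ u) ∷ []) (λ v → m∸n≤m 1 (R k u v))
      (≤-reflexive (sym (sum-defect u)))

  o₁ o₂ : Fin n → Fin n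
  o₁ u = proj₁ (outlier₁ u)
  o₂ u = proj₁ (outlier₂ u)

  o₁≢o₂ : ∀ u → o₁ u ≢ o₂ u
  o₁≢o₂ u e = proj₁ (proj₂ (outlier₂ u)) (here (sym e))

  -- u ↛ v says that v is one of the two vertices out of reach of u.
  module Out = TwoValued o₁ o₂ o₁≢o₂
  open Out public using () renaming (_↠_ to _↛_; ↠? to ↛?)

  P : Fin n → Fin n → ℕ
  P = Out.⟦_,_⟧

  P≡defect : ∀ u v → P u v ≡ defect u v
  P≡defect u v = trans (cong (δ (o₁ u) v +_) (sym (+-identityʳ _))) (sum-≤-≡
    (count≤ ((o₁≢o₂ u ∷ []) ∷ [] ∷ [])
            (proj₂ (proj₂ (outlier₁ u)) ∷ proj₂ (proj₂ (outlier₂ u)) ∷ []))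
    (≤-reflexive (trans (sum-defect u) (sym (sum-count (o₁ u ∷ o₂ u ∷ []))))) v)

  R+P : ∀ u v → R k u v + P u v ≡ 1
  R+P u v = trans (cong (R k u v +_) (P≡defect u v)) (R+defect u v)

  reached : ∀ {u v} → 1 ≤ R k u v → ¬ u ↛ v
  reached {u} {v} 1≤R = Out.⟦⟧≡0 (n≤0⇒n≡0 (+-cancelˡ-≤ 1 _ _
    (≤-trans (+-monoˡ-≤ (P u v) 1≤R) (≤-reflexive (R+P u v)))))

  R≡1 : ∀ {u v} → ¬ u ↛ v → R k u v ≡ 1
  R≡1 {u} {v} ¬uv = trans (sym (+-identityʳ _))
    (trans (cong (R k u v +_) (sym (Out.⟦⟧-no ¬uv))) (R+P u v))

  d : Fin n → ℕ
  d v = sum (λ u → A u v)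

  sum-d : sum d ≡ n * 2
  sum-d = begin
    sum (λ v → sum (λ u → A u v))  ≡⟨ ∑-comm (λ v u → A u v) ⟩
    sum (λ u → sum (A u))          ≡⟨ sum-cong-≗ (λ u → trans (∑-distrib-+ (δ (c₁ u)) (δ (c₂ u)))
                                                              (cong₂ _+_ (sum-δ₁ (c₁ u)) (sum-δ₁ (c₂ u)))) ⟩
    sum {n} (λ _ → 2)              ≡⟨ sum-const n 2 ⟩
    n * 2                          ∎
    where open ≡-Reasoning

  W-arc : ∀ {u v} → u ⟶ v → 1 ≤ A u v
  W-arc p = ≤-reflexive (sym (Arc.⟦⟧-yes p))

  W-cons : ∀ t {u w v} → u ⟶ w → 1 ≤ W t w v → 1 ≤ W (suc t) u v
  W-cons t (inj₁ refl) p = ≤-trans p (m≤m+n _ _)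
  W-cons t (inj₂ refl) p = ≤-trans p (m≤n+m _ _)

  clash : ∀ {s t u v} → s < t → t ≤ k → 1 ≤ W s u v → 1 ≤ W t u v → ⊥
  clash {u = u} {v} s<t t≤k p q = <-irrefl refl
    (≤-trans (+-mono-≤ p q) (≤-trans (W+W≤R s<t t≤k u v) (geodetic u v)))

  reached-in : ∀ {t u v} → t ≤ k → 1 ≤ W t u v → ¬ u ↛ v
  reached-in {t} {u} {v} t≤k p = reached (≤-trans p (≤-trans (W≤R t u v) (R-mono {t} {k} (≤⇒≤′ t≤k) u v)))

  ¬self-↛ : ∀ {u} → ¬ u ↛ u
  ¬self-↛ {u} = reached-in {0} z≤n (W-refl u)

  ¬⟶-↛ : ∀ {u v} → u ⟶ v → ¬ u ↛ v
  ¬⟶-↛ p = reached-in {1} (s≤s z≤n) (W-arc p)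

  no-loop : ∀ {u} → ¬ u ⟶ u
  no-loop {u} p = clash (s≤s z≤n) (s≤s z≤n) (W-refl u) (W-arc p)

  no-2-cycle : ∀ {u v} → u ⟶ v → ¬ v ⟶ u
  no-2-cycle {u} p q = clash (s≤s z≤n) (s≤s (s≤s z≤n)) (W-refl u) (W-cons 1 p (W-arc q))

  no-triangle : ∀ {u v w} → u ⟶ v → u ⟶ w → ¬ w ⟶ v
  no-triangle p q r = clash ≤-refl (s≤s (s≤s z≤n)) (W-arc p) (W-cons 1 q (W-arc r))

  no-diamond : ∀ {u a b v} → u ⟶ a → u ⟶ b → a ≢ b → a ⟶ v → ¬ b ⟶ v
  no-diamond {u} {a} {b} {v} ua ub a≢b av bv = <-irrefl refl (begin
    2                  ≤⟨ +-mono-≤ (W-arc av) (W-arc bv) ⟩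
    A a v + A b v      ≡⟨ Arc.∑-values (λ w → A w v) ua ub a≢b ⟩
    W 2 u v            ≤⟨ W≤R 2 u v ⟩
    R 2 u v            ≤⟨ R-mono {2} {k} (≤⇒≤′ (s≤s (s≤s z≤n))) u v ⟩
    R k u v            ≤⟨ geodetic u v ⟩
    1                  ∎)
    where open ≤-Reasoning

  R-step : ∀ j {u a b} v → u ⟶ a → u ⟶ b → a ≢ b → R (suc j) u v ≡ δ u v + (R j a v + R j b v)
  R-step j {u} v ua ub a≢b = cong (δ u v +_) (sym (Arc.∑-values (λ w → R j w v) ua ub a≢b))

  -- If u reached both y and y′, it would do so through its other child u′;
  -- as u already has the arc to c, y lies at distance exactly k - 1 from u′,
  -- and u′ has two short walks to y′, one of them through y.
  sibling : ∀ {u y c y′} → u ≢ y → u ⟶ c → y ⟶ c → y ⟶ y′ → c ≢ y′ → u ↛ y ⊎ u ↛ y′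
  sibling {u} {y} {c} {y′} u≢y uc yc yy′ c≢y′ with ↛? u y | ↛? u y′
  ... | yes p | _     = inj₁ p
  ... | no _  | yes q = inj₂ q
  ... | no p  | no q  = ⊥-elim (<-irrefl refl (begin
      2                          ≡⟨ cong₂ _+_ (sym Ru′y′) (sym Wu′y) ⟩
      R j u′ y′ + W j u′ y       ≤⟨ +-monoʳ-≤ (R j u′ y′) (W-snoc j (W-arc yy′)) ⟩
      R j u′ y′ + W k u′ y′      ≡⟨ R-suc j u′ y′ ⟨
      R k u′ y′                  ≤⟨ geodetic u′ y′ ⟩
      1                          ∎))
    where
    open ≤-Reasoning
    j : ℕ
    j = suc i
    u′ : Fin n
    u′ = proj₁ (Arc.other uc)
    c≢u′ : c ≢ u′
    c≢u′ = proj₁ (proj₂ (Arc.other uc))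
    uu′ : u ⟶ u′
    uu′ = proj₂ (proj₂ (Arc.other uc))
    u≢y′ : u ≢ y′
    u≢y′ refl = no-triangle yc yy′ uc
    left-zero : ∀ {d a b} → 1 ≤ b → d + (a + b) ≤ 1 → a ≡ 0
    left-zero {d} {a} {b} 1≤b le = n≤0⇒n≡0 (+-cancelʳ-≤ 1 a 0
      (≤-trans (+-monoʳ-≤ a 1≤b) (≤-trans (m≤n+m (a + b) d) le)))
    Rcy : R j c y ≡ 0
    Rcy = m+n≡0⇒m≡0 _ (n≤0⇒n≡0 (+-cancelˡ-≤ 1 _ _ (begin
      1 + (R j c y + R j y′ y)      ≡⟨ cong (_+ (R j c y + R j y′ y)) (δ-refl y) ⟨
      δ y y + (R j c y + R j y′ y)  ≡⟨ R-step j y yc yy′ c≢y′ ⟨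
      R k y y                       ≤⟨ geodetic y y ⟩
      1                             ∎)))
    Rcy′ : R j c y′ ≡ 0
    Rcy′ = left-zero {δ y y′} (R-refl j y′)
      (≤-trans (≤-reflexive (sym (R-step j y′ yc yy′ c≢y′))) (geodetic y y′))
    through-u′ : ∀ {v} → u ≢ v → R j c v ≡ 0 → ¬ u ↛ v → R j u′ v ≡ 1
    through-u′ {v} u≢v Rcv ¬uv = trans
      (sym (trans (R-step j v uc uu′ c≢u′) (cong₂ _+_ (δ-≢ u≢v) (cong (_+ R j u′ v) Rcv)))) (R≡1 ¬uv)
    Ru′y : R j u′ y ≡ 1
    Ru′y = through-u′ u≢y Rcy p
    Ru′y′ : R j u′ y′ ≡ 1
    Ru′y′ = through-u′ u≢y′ Rcy′ q
    Ru′c : R j u′ c ≡ 0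
    Ru′c = left-zero {δ u c} (R-refl j c) (begin
      δ u c + (R j u′ c + R j c c)  ≡⟨ R-step j c uu′ uc (c≢u′ ∘ sym) ⟨
      R k u c                       ≤⟨ geodetic u c ⟩
      1                             ∎)
    Wu′y : W j u′ y ≡ 1
    Wu′y = trans (sym (trans (R-suc i u′ y) (cong (_+ W j u′ y)
      (n≤0⇒n≡0 (≤-trans (R-snoc i (W-arc yc)) (≤-reflexive Ru′c)))))) Ru′y

-- The balance equation and the bound 3 on in-degrees

module Balance {n i : ℕ} (X : BinaryGeodetic n i) where
  open BinaryGeodetic X public
  open Walks c₁ c₂ public
  open Structure X public

  -- the (u , v) entry of A (J - P) = (J - P) A, without subtraction
  balance′ : ∀ u v → P (c₁ u) v + P (c₂ u) v + d v ≡ A (o₁ u) v + A (o₂ u) v + 2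
  balance′ u v = begin
    P (c₁ u) v + P (c₂ u) v + d v
      ≡⟨ cong (P (c₁ u) v + P (c₂ u) v +_) split ⟩
    P (c₁ u) v + P (c₂ u) v + (R k (c₁ u) v + R k (c₂ u) v + (A (o₁ u) v + A (o₂ u) v))
      ≡⟨ rearrange (P (c₁ u) v) (P (c₂ u) v) (R k (c₁ u) v) (R k (c₂ u) v) (A (o₁ u) v + A (o₂ u) v) ⟩
    (R k (c₁ u) v + P (c₁ u) v) + (R k (c₂ u) v + P (c₂ u) v) + (A (o₁ u) v + A (o₂ u) v)
      ≡⟨ cong (_+ (A (o₁ u) v + A (o₂ u) v)) (cong₂ _+_ (R+P (c₁ u) v) (R+P (c₂ u) v)) ⟩
    2 + (A (o₁ u) v + A (o₂ u) v)
      ≡⟨ +-comm 2 _ ⟩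
    A (o₁ u) v + A (o₂ u) v + 2 ∎
    where
    open ≡-Reasoning
    rearrange : ∀ p q r s a → p + q + (r + s + a) ≡ r + p + (s + q) + a
    rearrange = solve-∀
    distr : ∀ a b c → (a + b) * c ≡ a * c + b * c
    distr = solve-∀
    via : (Fin n → ℕ) → ℕ
    via f = sum (λ w → f w * A w v)
    via-+ : ∀ f g → via (λ w → f w + g w) ≡ via f + via g
    via-+ f g = trans (sum-cong-≗ λ w → distr (f w) (g w) (A w v)) (∑-distrib-+ (λ w → f w * A w v) _)
    split : d v ≡ R k (c₁ u) v + R k (c₂ u) v + (A (o₁ u) v + A (o₂ u) v)
    split = begin
      sum (λ w → A w v)
        ≡⟨ sum-cong-≗ (λ w → trans (sym (*-identityˡ (A w v))) (cong (_* A w v) (sym (R+P u w)))) ⟩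
      via (λ w → R k u w + P u w)
        ≡⟨ via-+ (R k u) (P u) ⟩
      via (R k u) + via (P u)
        ≡⟨ cong₂ _+_ (+-cancelˡ-≡ (δ u v) _ _ (sym (R-right k u v)))
                     (trans (via-+ (δ (o₁ u)) (δ (o₂ u)))
                            (cong₂ _+_ (sum-δ (o₁ u) λ w → A w v) (sum-δ (o₂ u) λ w → A w v))) ⟩
      R k (c₁ u) v + R k (c₂ u) v + (A (o₁ u) v + A (o₂ u) v) ∎

  balance : ∀ {u a b x y} v → u ⟶ a → u ⟶ b → a ≢ b → u ↛ x → u ↛ y → x ≢ y →
            P a v + P b v + d v ≡ A x v + A y v + 2
  balance {u} v ua ub a≢b ux uy x≢y = trans
    (cong (_+ d v) (Arc.∑-values (λ w → P w v) ua ub a≢b))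
    (trans (balance′ u v) (cong (_+ 2) (sym (Out.∑-values (λ w → A w v) ux uy x≢y))))

  Missing-child : Fin n → Fin n → Set
  Missing-child u v = ∃[ a ] u ⟶ a × a ↛ v

  Outlying-parent : Fin n → Fin n → Set
  Outlying-parent u v = ∃[ x ] u ↛ x × x ⟶ v

  missing : ∀ u v → 1 ≤ P (c₁ u) v + P (c₂ u) v → Missing-child u v
  missing u v p with positive-+ p
  ... | inj₁ q = c₁ u , inj₁ refl , Out.⟦⟧≥1 q
  ... | inj₂ q = c₂ u , inj₂ refl , Out.⟦⟧≥1 q

  outlying : ∀ u v → 1 ≤ A (o₁ u) v + A (o₂ u) v → Outlying-parent u v
  outlying u v p with positive-+ p
  ... | inj₁ q = o₁ u , inj₁ refl , Arc.⟦⟧≥1 q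
  ... | inj₂ q = o₂ u , inj₂ refl , Arc.⟦⟧≥1 q

  -- In `balance′`, an in-degree too small for the `A` terms forces a `P` term; in `outlying-if`,
  -- one too large for the `P` terms forces an `A` term. The subscripted lemmas below are the
  -- instances for in-degrees 1, 2 and 3.
  missing-if : ∀ u v → d v < A (o₁ u) v + A (o₂ u) v + 2 → Missing-child u v
  missing-if u v lt = missing u v (+-cancelʳ-≤ (d v) 1 _
    (≤-trans lt (≤-reflexive (sym (balance′ u v)))))

  outlying-if : ∀ u v → 2 < P (c₁ u) v + P (c₂ u) v + d v → Outlying-parent u v
  outlying-if u v lt = outlying u v (+-cancelʳ-≤ 2 1 _
    (≤-trans lt (≤-reflexive (balance′ u v))))

  abstract
    outlying₃ : ∀ u {v} → d v ≡ 3 → Outlying-parent u v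
    outlying₃ u {v} dv = outlying-if u v (≤-trans (≤-reflexive (sym dv)) (m≤n+m _ _))

  missing₁ : ∀ u {v} → d v ≡ 1 → Missing-child u v
  missing₁ u {v} dv = missing-if u v (≤-trans (≤-reflexive (cong suc dv)) (m≤n+m _ _))

  P-pair : ∀ {u a b v} → u ⟶ a → u ⟶ b → a ≢ b → a ↛ v → b ↛ v → P (c₁ u) v + P (c₂ u) v ≡ 2
  P-pair {v = v} ua ub a≢b av bv =
    trans (sym (Arc.∑-values (λ w → P w v) ua ub a≢b)) (cong₂ _+_ (Out.⟦⟧-yes av) (Out.⟦⟧-yes bv))

  A-pair : ∀ {u x y v} → u ↛ x → u ↛ y → x ≢ y → x ⟶ v → y ⟶ v → A (o₁ u) v + A (o₂ u) v ≡ 2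
  A-pair {v = v} ux uy x≢y xv yv =
    trans (sym (Out.∑-values (λ w → A w v) ux uy x≢y)) (cong₂ _+_ (Arc.⟦⟧-yes xv) (Arc.⟦⟧-yes yv))

  A-one : ∀ {u x v} → u ↛ x → x ⟶ v → 1 ≤ A (o₁ u) v + A (o₂ u) v
  A-one (inj₁ refl) xv = ≤-trans (W-arc xv) (m≤m+n _ _)
  A-one {u} {v = v} (inj₂ refl) xv = ≤-trans (W-arc xv) (m≤n+m _ (A (o₁ u) v))

  P-one : ∀ {u a v} → u ⟶ a → a ↛ v → 1 ≤ P (c₁ u) v + P (c₂ u) v
  P-one (inj₁ refl) av = ≤-trans (≤-reflexive (sym (Out.⟦⟧-yes av))) (m≤m+n _ _)
  P-one {u} {v = v} (inj₂ refl) av = ≤-trans (≤-reflexive (sym (Out.⟦⟧-yes av))) (m≤n+m _ (P (c₁ u) v))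

  missing₃ : ∀ {u x y v} → d v ≡ 3 → u ↛ x → u ↛ y → x ≢ y → x ⟶ v → y ⟶ v → Missing-child u v
  missing₃ {u} {v = v} dv ux uy x≢y xv yv = missing-if u v
    (≤-reflexive (trans (cong suc dv) (cong (_+ 2) (sym (A-pair ux uy x≢y xv yv)))))

  missed-by : ∀ {u a b v} → u ⟶ a → u ⟶ b → a ≢ b → Missing-child u v → a ↛ v ⊎ b ↛ v
  missed-by ua ub a≢b (c , uc , cv) with Arc.one-of ua ub a≢b uc
  ... | inj₁ refl = inj₁ cv
  ... | inj₂ refl = inj₂ cv

  missed-by-other : ∀ {u v b} → u ⟶ v → u ⟶ b → v ≢ b → Missing-child u v → b ↛ v
  missed-by-other uv ub v≢b m = [ ⊥-elim ∘ ¬self-↛ , (λ q → q) ]′ (missed-by uv ub v≢b m)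

  missing₂ : ∀ {u x v} → d v ≤ 2 → u ↛ x → x ⟶ v → Missing-child u v
  missing₂ {u} {v = v} dv ux xv = missing-if u v (≤-trans (s≤s dv) (+-monoˡ-≤ 2 (A-one ux xv)))

  outlying₂ : ∀ {u a v} → 2 ≤ d v → u ⟶ a → a ↛ v → Outlying-parent u v
  outlying₂ {u} {v = v} dv ua av = outlying-if u v (+-mono-≤ (P-one ua av) dv)

  outlying₁ : ∀ {u a b v} → d v ≡ 1 → u ⟶ a → u ⟶ b → a ≢ b → a ↛ v → b ↛ v → Outlying-parent u v
  outlying₁ {u} {v = v} dv ua ub a≢b av bv = outlying-if u v
    (≤-reflexive (sym (cong₂ _+_ (P-pair ua ub a≢b av bv) dv)))

  parents-≤ : ∀ {l v} → Unique l → All (_⟶ v) l → length l ≤ d v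
  parents-≤ u all = unique-length u (All.map W-arc all)

  abstract
    fresh-parent : ∀ l {v} → length l < d v → ∃[ y ] y ∉ l × y ⟶ v
    fresh-parent l {v} lt with fresh-positive (λ u → A u v) l (λ u → Arc.⟦⟧≤1 u v) lt
    ... | y , y∉ , p = y , y∉ , Arc.⟦⟧≥1 p

  parents-of-3 : ∀ {v x y z w} → d v ≡ 3 → x ≢ y → x ≢ z → y ≢ z →
                 x ⟶ v → y ⟶ v → z ⟶ v → w ⟶ v → w ≡ x ⊎ w ≡ y ⊎ w ≡ z
  parents-of-3 {v} {x} {y} {z} {w} dv x≢y x≢z y≢z xv yv zv wv
    with w Fin.≟ x | w Fin.≟ y | w Fin.≟ z
  ... | yes e | _ | _ = inj₁ e
  ... | _ | yes e | _ = inj₂ (inj₁ e)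
  ... | _ | _ | yes e = inj₂ (inj₂ e)
  ... | no w≢x | no w≢y | no w≢z = ⊥-elim (<-irrefl refl (subst (4 ≤_) dv (parents-≤
      ((w≢x ∷ w≢y ∷ w≢z ∷ []) ∷ (x≢y ∷ x≢z ∷ []) ∷ (y≢z ∷ []) ∷ [] ∷ []) (wv ∷ xv ∷ yv ∷ zv ∷ []))))

  outlying-of-3 : ∀ {v x y z} u → d v ≡ 3 → x ≢ y → x ≢ z → y ≢ z →
                  x ⟶ v → y ⟶ v → z ⟶ v → u ↛ x ⊎ u ↛ y ⊎ u ↛ z
  outlying-of-3 u dv x≢y x≢z y≢z xv yv zv with outlying₃ u dv
  ... | w , uw , wv with parents-of-3 dv x≢y x≢z y≢z xv yv zv wv
  ... | inj₁ refl        = inj₁ uw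
  ... | inj₂ (inj₁ refl) = inj₂ (inj₁ uw)
  ... | inj₂ (inj₂ refl) = inj₂ (inj₂ uw)

  -- In-degree 4 would make both outliers of every vertex parents of `v`. Take a parent x of `v` and
  -- a parent y that is neither x nor an outlier of x. By `sibling`, x misses the other child of y,
  -- which is then a parent of `v` and closes a triangle.
  d≤3 : ∀ v → d v ≤ 3
  d≤3 v with d v ≤? 3
  ... | yes p = p
  ... | no  p = ⊥-elim impossible
    where
    4≤d : 4 ≤ d v
    4≤d = ≰⇒> p
    both : ∀ u → 2 ≤ A (o₁ u) v + A (o₂ u) v
    both u = +-cancelʳ-≤ 2 2 _ (≤-trans 4≤d (≤-trans (m≤n+m _ _) (≤-reflexive (balance′ u v))))
    outlier-arc : ∀ {u x} → u ↛ x → x ⟶ v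
    outlier-arc {u} (inj₁ refl) = Arc.⟦⟧≥1 (+-cancelʳ-≤ 1 1 _
      (≤-trans (both u) (+-monoʳ-≤ (A (o₁ u) v) (Arc.⟦⟧≤1 (o₂ u) v))))
    outlier-arc {u} (inj₂ refl) = Arc.⟦⟧≥1 (+-cancelˡ-≤ 1 1 _
      (≤-trans (both u) (+-monoˡ-≤ (A (o₂ u) v) (Arc.⟦⟧≤1 (o₁ u) v))))
    impossible : ⊥
    impossible with fresh-parent [] (≤-trans (s≤s z≤n) 4≤d)
    ... | x , _ , xv with fresh-parent (x ∷ o₁ x ∷ o₂ x ∷ []) 4≤d
    ... | y , y∉ , yv with Arc.other yv
    ... | y′ , v≢y′ , yy′ with sibling (y∉ ∘ here ∘ sym) xv yv yy′ v≢y′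
    ... | inj₁ (inj₁ e) = y∉ (there (here e))
    ... | inj₁ (inj₂ e) = y∉ (there (there (here e)))
    ... | inj₂ xy′ = no-triangle yv yy′ (outlier-arc xy′)

  -- As the in-degrees are 2 on average, a deficit e at some vertices forces an excess at others.
  excess : ∀ (e : Fin n → ℕ) l → (∀ v → d v + e v ≤ 3) → length l < sum e →
           ∃[ v ] v ∉ l × 2 < d v + e v
  excess e l le lt = fresh (λ v → d v + e v) (λ _ → 2) l le (begin-strict
    sum {n} (λ _ → 2) + length l  ≡⟨ cong (_+ length l) (trans (sum-const n 2) (sym sum-d)) ⟩
    sum d + length l              <⟨ +-monoʳ-< (sum d) lt ⟩
    sum d + sum e                 ≡⟨ ∑-distrib-+ d e ⟨
    sum (λ v → d v + e v)         ∎)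
    where open ≤-Reasoning

-- Vertices of in-degree 0

-- A vertex s without in-neighbours is an outlier of every other vertex, so
-- away from s the digraph has excess one: every u ≢ s has a single further outlier o u.
module Source {n i : ℕ} (X : BinaryGeodetic n i)
              (s : Fin n) (ds : Balance.d X s ≡ 0) where
  open Balance X

  no-parent : ∀ {u} → ¬ u ⟶ s
  no-parent {u} us with () ← subst (1 ≤_) ds (≤-trans (W-arc us) (sum-term (λ w → A w s) u))

  ⟶≢s : ∀ {u v} → u ⟶ v → v ≢ s
  ⟶≢s uv refl = no-parent uv

  s-outlier : ∀ {u} → u ≢ s → u ↛ s
  s-outlier {u} u≢s with ↛? u s
  ... | yes p = p
  ... | no ¬p = case trans (sym (R≡1 ¬p)) unreached of λ ()
    where
    term : ∀ w → R (suc i) u w * A w s ≡ 0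
    term w = trans (cong (R (suc i) u w *_) (Arc.⟦⟧-no no-parent)) (*-zeroʳ (R (suc i) u w))
    unreached : R k u s ≡ 0
    unreached = trans (R-right (suc i) u s)
      (cong₂ _+_ (δ-≢ u≢s) (trans (sum-cong-≗ term) (trans (sum-const n 0) (*-zeroʳ n))))

  abstract
    second : ∀ u → ∃[ x ] (u ≢ s → x ≢ s × u ↛ x)
    second u with u Fin.≟ s
    -- `s` does not miss itself, so no outlier of `s` is singled out; the value here is a
    -- placeholder guarded by `u ≢ s`.
    ... | yes u≡s = u , λ u≢s → ⊥-elim (u≢s u≡s)
    ... | no u≢s with Out.other (s-outlier u≢s)
    ... | x , s≢x , ux = x , λ _ → s≢x ∘ sym , ux

  o : Fin n → Fin n
  o u = proj₁ (second u)

  o≢s : ∀ {u} → u ≢ s → o u ≢ s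
  o≢s {u} u≢s = proj₁ (proj₂ (second u) u≢s)

  ↛o : ∀ {u} → u ≢ s → u ↛ o u
  ↛o {u} u≢s = proj₂ (proj₂ (second u) u≢s)

  ↛⇒o : ∀ {u x} → u ≢ s → u ↛ x → x ≢ s → x ≡ o u
  ↛⇒o u≢s ux x≢s = Out.the-other (s-outlier u≢s) (↛o u≢s) (o≢s u≢s ∘ sym) ux x≢s

  o-irrefl : ∀ {u} → u ≢ s → o u ≢ u
  o-irrefl {u} u≢s e = ¬self-↛ (subst (u ↛_) e (↛o u≢s))

  o-sibling : ∀ {u y c y′} → u ≢ s → y ≢ s → u ≢ y → u ⟶ c → y ⟶ c → y ⟶ y′ → c ≢ y′ →
              o u ≡ y ⊎ o u ≡ y′
  o-sibling u≢s y≢s u≢y uc yc yy′ c≢y′ with sibling u≢y uc yc yy′ c≢y′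
  ... | inj₁ uy  = inj₁ (sym (↛⇒o u≢s uy y≢s))
  ... | inj₂ uy′ = inj₂ (sym (↛⇒o u≢s uy′ (⟶≢s yy′)))

  -- Otherwise v has three parents x, y, z ≢ s. One of them, say y, is missed by x, so y ≡ o x;
  -- but x also misses z or its other child z′, which are both different from y and s.
  s⟶excessive : ∀ {v} → d v ≡ 3 → s ⟶ v
  s⟶excessive {v} dv with ⟶? s v
  ... | yes p = p
  ... | no ¬sv = ⊥-elim impossible
    where
    parent≢s : ∀ {x} → x ⟶ v → x ≢ s
    parent≢s xv refl = ¬sv xv
    impossible : ⊥
    impossible with fresh-parent [] (subst (0 <_) (sym dv) (s≤s z≤n))
    ... | x , _ , xv with outlying₃ x dv
    ... | y , xy , yv with fresh-parent (x ∷ y ∷ []) (subst (2 <_) (sym dv) ≤-refl)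
    ... | z , z∉ , zv with Arc.other zv
    ... | z′ , v≢z′ , zz′
      with o-sibling (parent≢s xv) (parent≢s zv) (z∉ ∘ here ∘ sym) xv zv zz′ v≢z′
         | ↛⇒o (parent≢s xv) xy (parent≢s yv)
    ... | inj₁ ox≡z  | y≡ox = z∉ (there (here (trans (sym ox≡z) (sym y≡ox))))
    ... | inj₂ ox≡z′ | y≡ox = no-triangle zv (subst (z ⟶_) (trans (sym ox≡z′) (sym y≡ox)) zz′) yv

  deficit : List (Fin n)
  deficit = s ∷ s ∷ []

  -- The in-degree of `s` is two below average, each in-degree 3 one above. By `s⟶excessive` the
  -- latter occur only at the two children of `s`, so the totals leave no slack: without `s`, all
  -- in-degrees are 2.
  d+deficit : ∀ v → d v + count deficit v ≡ 2 + A s v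
  d+deficit = sum-≤-≡ bound (≤-reflexive (begin
    sum (λ v → 2 + A s v)              ≡⟨ ∑-distrib-+ (λ _ → 2) (A s) ⟩
    sum {n} (λ _ → 2) + sum (A s)      ≡⟨ cong₂ _+_ (trans (sum-const n 2) (sym sum-d)) sum-A ⟩
    sum d + 2                          ≡⟨ cong (sum d +_) (sum-count deficit) ⟨
    sum d + sum (count deficit)        ≡⟨ ∑-distrib-+ d (count deficit) ⟨
    sum (λ v → d v + count deficit v)  ∎))
    where
    open ≡-Reasoning
    sum-A : sum (A s) ≡ 2
    sum-A = trans (∑-distrib-+ (δ (c₁ s)) (δ (c₂ s))) (cong₂ _+_ (sum-δ₁ (c₁ s)) (sum-δ₁ (c₂ s)))
    bound : ∀ v → d v + count deficit v ≤ 2 + A s v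
    bound v with s Fin.≟ v
    ... | yes refl rewrite ds = m≤m+n 2 _
    ... | no _ with d v ≟ 3
    ...   | yes dv = ≤-trans (≤-reflexive (trans (+-identityʳ (d v)) dv)) (+-monoʳ-≤ 2 (W-arc (s⟶excessive dv)))
    ...   | no dv≢3 = ≤-trans (≤-reflexive (+-identityʳ (d v)))
                       (≤-trans (≤-pred (≤∧≢⇒< (d≤3 v) dv≢3)) (m≤m+n 2 _))

  d≡2+A : ∀ {v} → v ≢ s → d v ≡ 2 + A s v
  d≡2+A {v} v≢s = trans (sym (+-identityʳ (d v)))
    (trans (cong (d v +_) (sym (count-∉ deficit λ { (here e) → v≢s e ; (there (here e)) → v≢s e }))) (d+deficit v))

  -- As `u` misses `s`, the term `A s v` cancels against the same term in `d v`. What remains is the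
  -- balance equation for excess one: apart from `s`, the children of `u` miss exactly the children
  -- of `o u`. So `o` maps the children of `u` bijectively to those of `o u`.
  o-balance : ∀ {u a b v} → u ≢ s → v ≢ s → u ⟶ a → u ⟶ b → a ≢ b → P a v + P b v ≡ A (o u) v
  o-balance {u} {a} {b} {v} u≢s v≢s ua ub a≢b = +-cancelʳ-≡ (2 + A s v) _ _ (begin
    P a v + P b v + (2 + A s v)   ≡⟨ cong (P a v + P b v +_) (d≡2+A v≢s) ⟨
    P a v + P b v + d v           ≡⟨ balance v ua ub a≢b (s-outlier u≢s) (↛o u≢s) (o≢s u≢s ∘ sym) ⟩
    A s v + A (o u) v + 2         ≡⟨ lemma (A s v) (A (o u) v) ⟩
    A (o u) v + (2 + A s v)       ∎)
    where
    open ≡-Reasoning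
    lemma : ∀ x y → x + y + 2 ≡ y + (2 + x)
    lemma = solve-∀

  o-arc : ∀ {u a} → u ≢ s → u ⟶ a → o u ⟶ o a
  o-arc {u} {a} u≢s ua with Arc.other ua
  ... | b , a≢b , ub = Arc.⟦⟧≥1 (begin
      1                          ≡⟨ Out.⟦⟧-yes (↛o (⟶≢s ua)) ⟨
      P a (o a)                  ≤⟨ m≤m+n _ _ ⟩
      P a (o a) + P b (o a)      ≡⟨ o-balance u≢s (o≢s (⟶≢s ua)) ua ub a≢b ⟩
      A (o u) (o a)              ∎)
    where open ≤-Reasoning

  o-distinct : ∀ {u a b} → u ≢ s → u ⟶ a → u ⟶ b → a ≢ b → o a ≢ o b
  o-distinct {u} {a} {b} u≢s ua ub a≢b e = <-irrefl refl (begin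
      2                          ≡⟨ cong₂ _+_ (Out.⟦⟧-yes (↛o (⟶≢s ua)))
                                              (Out.⟦⟧-yes (subst (b ↛_) (sym e) (↛o (⟶≢s ub)))) ⟨
      P a (o a) + P b (o a)      ≡⟨ o-balance u≢s (o≢s (⟶≢s ua)) ua ub a≢b ⟩
      A (o u) (o a)              ≤⟨ Arc.⟦⟧≤1 (o u) (o a) ⟩
      1                          ∎)
    where open ≤-Reasoning

  abstract
    coparent : ∀ {u v} → v ≢ s → u ⟶ v → ∃[ y ] y ≢ s × u ≢ y × y ⟶ v
    coparent {u} {v} v≢s uv with ⟶? s v
    ... | yes sv with fresh-parent (s ∷ u ∷ []) (≤-reflexive (sym (trans (d≡2+A v≢s) (cong (2 +_) (Arc.⟦⟧-yes sv)))))
    ...   | y , y∉ , yv = y , y∉ ∘ here , y∉ ∘ there ∘ here ∘ sym , yv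
    coparent {u} {v} v≢s uv | no ¬sv with fresh-parent (u ∷ []) (≤-trans (m≤m+n 2 _) (≤-reflexive (sym (d≡2+A v≢s))))
    ...   | y , y∉ , yv = y , (λ { refl → ¬sv yv }) , y∉ ∘ here ∘ sym , yv

  coparent-unique : ∀ {u v y z} → v ≢ s → u ⟶ v → y ⟶ v → z ⟶ v → u ≢ s → y ≢ s → z ≢ s →
                    u ≢ y → u ≢ z → y ≡ z
  coparent-unique {u} {v} {y} {z} v≢s uv yv zv u≢s y≢s z≢s u≢y u≢z with y Fin.≟ z
  ... | yes e = e
  ... | no y≢z with ⟶? s v
  ...   | yes sv with s≤s (s≤s (s≤s ())) ← subst (4 ≤_) (trans (d≡2+A v≢s) (cong (2 +_) (Arc.⟦⟧-yes sv)))
             (parents-≤ (((u≢s ∘ sym) ∷ (y≢s ∘ sym) ∷ (z≢s ∘ sym) ∷ []) ∷ (u≢y ∷ u≢z ∷ []) ∷ (y≢z ∷ []) ∷ [] ∷ [])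
                        (sv ∷ uv ∷ yv ∷ zv ∷ []))
  ...   | no ¬sv with s≤s (s≤s ()) ← subst (3 ≤_) (trans (d≡2+A v≢s) (cong (2 +_) (Arc.⟦⟧-no ¬sv)))
             (parents-≤ ((u≢y ∷ u≢z ∷ []) ∷ (y≢z ∷ []) ∷ [] ∷ []) (uv ∷ yv ∷ zv ∷ []))

  -- Otherwise `o u₁` is `u₂`. Let w be another parent of a child b of `u₁`; by `o-sibling`, `u₂` is
  -- w or the other child of w. The former is a diamond below `u`; in the latter w is `u` or `o u`
  -- and forms a triangle with `u₁` and b.
  o-not-twin : ∀ {u u₁ u₂} → u ≢ s → u ⟶ u₁ → u ⟶ u₂ → u₁ ≢ u₂ → o u ⟶ u₁ → ¬ o u ⟶ u₂
  o-not-twin {u} {u₁} {u₂} u≢s uu₁ uu₂ u₁≢u₂ yu₁ yu₂ = contra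
    where
    ou₁≡u₂ : o u₁ ≡ u₂
    ou₁≡u₂ = Arc.the-other yu₁ yu₂ u₁≢u₂ (o-arc u≢s uu₁) (o-irrefl (⟶≢s uu₁))
    diamond : ∀ {b} → u₁ ⟶ b → ¬ u₂ ⟶ b
    diamond = no-diamond uu₁ uu₂ u₁≢u₂
    through : ∀ {b w} → u₁ ⟶ b → w ≢ s → w ⟶ b → ¬ w ⟶ u₂
    through {w = w} u₁b w≢s wb wu₂ with u Fin.≟ w
    ... | yes refl = no-triangle wb uu₁ u₁b
    ... | no u≢w with coparent-unique (⟶≢s uu₂) uu₂ yu₂ wu₂ u≢s (o≢s u≢s) w≢s (o-irrefl u≢s ∘ sym) u≢w
    ...   | refl = no-triangle wb yu₁ u₁b
    contra : ⊥
    contra with coparent (⟶≢s {u₁} (inj₁ refl)) (inj₁ refl)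
    ... | w , w≢s , u₁≢w , wb with Arc.other wb
    ... | b′ , b≢b′ , wb′ with o-sibling (⟶≢s uu₁) w≢s u₁≢w (inj₁ refl) wb wb′ b≢b′
    ... | inj₁ e = diamond (inj₁ refl) (subst (_⟶ _) (trans (sym e) ou₁≡u₂) wb)
    ... | inj₂ e = through (inj₁ refl) w≢s wb (subst (w ⟶_) (trans (sym e) ou₁≡u₂) wb′)

  -- Here `o` sends `u₁` to `u₂` and `u₂` to `y₁`, so `o z` is a parent of `u₂`, that is, `u` or
  -- `o u`. If it is `u`, then `o (o u)` is `u₁`, and `z` has a diamond to `y₁` through `u₁` and
  -- `o u`. If it is `o u`, then `o (o u)` is a child of `o u`, and by `o-sibling` it is `u` or
  -- `u₁`: a triangle, or `o u` is `z` and has a loop.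
  o-not-below-coparent : ∀ {u u₁ u₂ y₁ z} → u ≢ s → z ≢ s → u ≢ z → u ⟶ u₁ → u ⟶ u₂ → u₁ ≢ u₂ →
    o u ⟶ u₂ → o u ⟶ y₁ → u₂ ≢ y₁ → z ⟶ u₁ → u₁ ≢ o u → ¬ z ⟶ o u
  o-not-below-coparent {u} {u₁} {u₂} {y₁} {z} u≢s z≢s u≢z uu₁ uu₂ u₁≢u₂ yu₂ yy₁ u₂≢y₁ zu₁ u₁≢y zy =
    contra
    where
    y : Fin n
    y = o u
    y≢s : y ≢ s
    y≢s = o≢s u≢s
    u≢y : u ≢ y
    u≢y = o-irrefl u≢s ∘ sym
    ou₂≡y₁ : o u₂ ≡ y₁
    ou₂≡y₁ = Arc.the-other yu₂ yy₁ u₂≢y₁ (o-arc u≢s uu₂) (o-irrefl (⟶≢s uu₂))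
    ou₁≡u₂ : o u₁ ≡ u₂
    ou₁≡u₂ = Arc.the-other yy₁ yu₂ (u₂≢y₁ ∘ sym) (o-arc u≢s uu₁)
               (λ e → o-distinct u≢s uu₁ uu₂ u₁≢u₂ (trans e (sym ou₂≡y₁)))
    oz⟶u₂ : o z ⟶ u₂
    oz⟶u₂ = subst (o z ⟶_) ou₁≡u₂ (o-arc z≢s zu₁)
    oy≢u₂ : o y ≢ u₂
    oy≢u₂ e = o-distinct z≢s zu₁ zy u₁≢y (trans ou₁≡u₂ (sym e))
    oz⟶oy : o z ⟶ o y
    oz⟶oy = o-arc z≢s zy
    contra : ⊥
    contra with u Fin.≟ o z
    ... | yes u≡oz = no-diamond zu₁ zy u₁≢y (subst₂ _⟶_ oy≡u₁ ou₂≡y₁ (o-arc y≢s yu₂)) yy₁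
      where
      oy≡u₁ : o y ≡ u₁
      oy≡u₁ = Arc.the-other uu₂ uu₁ (u₁≢u₂ ∘ sym) (subst (_⟶ o y) (sym u≡oz) oz⟶oy) oy≢u₂
    ... | no u≢oz = [ (λ e → no-triangle yu₂ (subst (y ⟶_) e y⟶oy) uu₂)
                    , (λ e → no-loop (subst (_⟶ y) (sym (y≡z (subst (y ⟶_) e y⟶oy))) zy)) ]′
                    (o-sibling y≢s u≢s (u≢y ∘ sym) yu₂ uu₂ uu₁ (u₁≢u₂ ∘ sym))
      where
      y⟶oy : y ⟶ o y
      y⟶oy = subst (_⟶ o y)
        (sym (coparent-unique (⟶≢s uu₂) uu₂ yu₂ oz⟶u₂ u≢s y≢s (o≢s z≢s) u≢y u≢oz)) oz⟶oy
      y≡z : y ⟶ u₁ → y ≡ z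
      y≡z yu₁ = coparent-unique (⟶≢s uu₁) uu₁ yu₁ zu₁ u≢s y≢s z≢s u≢y u≢z

  -- With z the second parent of the other child of `u`, `o-sibling` makes `o u` either z or a child
  -- of z, the two cases excluded above.
  o-no-common-child : ∀ {u c} → u ≢ s → u ⟶ c → ¬ o u ⟶ c
  o-no-common-child u≢s uu₂ yu₂ with Arc.other uu₂ | Arc.other yu₂
  ... | u₁ , u₂≢u₁ , uu₁ | y₁ , u₂≢y₁ , yy₁ with coparent (⟶≢s uu₁) uu₁
  ... | z , z≢s , u≢z , zu₁ with Arc.other zu₁
  ... | z₂ , u₁≢z₂ , zz₂ with o-sibling u≢s z≢s u≢z uu₁ zu₁ zz₂ u₁≢z₂
  ... | inj₁ y≡z  = o-not-twin u≢s uu₁ uu₂ (u₂≢u₁ ∘ sym) (subst (_⟶ u₁) (sym y≡z) zu₁) yu₂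
  ... | inj₂ y≡z₂ = o-not-below-coparent u≢s z≢s u≢z uu₁ uu₂ (u₂≢u₁ ∘ sym) yu₂ yy₁ u₂≢y₁ zu₁
                      (u₁≢z₂ ∘ λ e → trans e y≡z₂) (subst (z ⟶_) (sym y≡z₂) zz₂)

  o-sibling′ : ∀ {u y c y′} → u ≢ s → y ≢ s → u ≢ y → u ⟶ c → y ⟶ c → y ⟶ y′ → c ≢ y′ → o u ≡ y′
  o-sibling′ u≢s y≢s u≢y uc yc yy′ c≢y′ with o-sibling u≢s y≢s u≢y uc yc yy′ c≢y′
  ... | inj₁ refl = ⊥-elim (o-no-common-child u≢s uc yc)
  ... | inj₂ e = e

  -- `c₁ s` supplies a vertex u other than `s`. Let y and z be the second parents of its two
  -- children. By `o-sibling′` the other children of y and z both equal `o u`, while `o y` and `o z`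
  -- are the children of u; both have an arc to `o (o u)`, a diamond.
  impossible : ⊥
  impossible with c₁ s | ⟶≢s {s} (inj₁ refl)
  ... | u | u≢s with coparent (⟶≢s {u} (inj₂ refl)) (inj₂ refl) | coparent (⟶≢s {u} (inj₁ refl)) (inj₁ refl)
  ... | y , y≢s , u≢y , yu₂ | z , z≢s , u≢z , zu₁ with Arc.other yu₂ | Arc.other zu₁
  ... | a , u₂≢a , ya | a′ , u₁≢a′ , za′
    with trans (sym (o-sibling′ u≢s y≢s u≢y (inj₂ refl) yu₂ ya u₂≢a))
               (o-sibling′ u≢s z≢s u≢z (inj₁ refl) zu₁ za′ u₁≢a′)
  ... | refl = no-diamond {u} (inj₁ refl) (inj₂ refl) (c₁≢c₂ u)
      (subst (_⟶ o a) (o-sibling′ y≢s u≢s (u≢y ∘ sym) yu₂ (inj₂ refl) (inj₁ refl) (c₁≢c₂ u ∘ sym)) (o-arc y≢s ya))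
      (subst (_⟶ o a) (o-sibling′ z≢s u≢s (u≢z ∘ sym) zu₁ (inj₁ refl) (inj₂ refl) (c₁≢c₂ u)) (o-arc z≢s za′))

-- Vertices of in-degree 1

module Deficient {n i : ℕ} (X : BinaryGeodetic n i) where
  open Balance X public

  1≤d : ∀ v → 1 ≤ d v
  1≤d v with d v in eq
  ... | zero  = ⊥-elim (Source.impossible X v eq)
  ... | suc _ = s≤s z≤n

  data In-degree (v : Fin n) : Set where
    one   : d v ≡ 1 → In-degree v
    two   : d v ≡ 2 → In-degree v
    three : d v ≡ 3 → In-degree v

  in-degree : ∀ v → In-degree v
  in-degree v with d v in eq | 1≤d v | d≤3 v
  ... | 1 | _ | _ = one eq
  ... | 2 | _ | _ = two eq
  ... | 3 | _ | _ = three eq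
  ... | suc (suc (suc (suc _))) | _ | s≤s (s≤s (s≤s ()))

  abstract
    S : List (Fin n)
    S = filter (λ v → d v ≟ 1) (allFin n)

    S-unique : Unique S
    S-unique = Unique.filter⁺ (λ v → d v ≟ 1) (Unique.allFin⁺ n)

    ∈S : ∀ {v} → d v ≡ 1 → v ∈ S
    ∈S dv = ∈-filter⁺ (λ v → d v ≟ 1) (∈-allFin _) dv

    S⇒d≡1 : ∀ {v} → v ∈ S → d v ≡ 1
    S⇒d≡1 v∈ = proj₂ (∈-filter⁻ (λ v → d v ≟ 1) {xs = allFin n} v∈)

  d+S : ∀ v → 2 ≤ d v + count S v
  d+S v with in-degree v
  ... | one dv   = ≤-trans (+-monoʳ-≤ 1 (count-∈ S (∈S dv))) (≤-reflexive (cong (_+ count S v) (sym dv)))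
  ... | two dv   = ≤-trans (≤-reflexive (sym dv)) (m≤m+n _ _)
  ... | three dv = ≤-trans (≤-trans (n≤1+n 2) (≤-reflexive (sym dv))) (m≤m+n _ _)

  -- The in-degrees in `S` fall short of the average by |S| in total, and a vertex of in-degree 3
  -- makes up for only one.
  excessive : ∀ l → length l < length S → ∃[ v ] v ∉ l × d v ≡ 3
  excessive l lt with excess (count S) l bound (subst (length l <_) (sym (sum-count S)) lt)
    where
    bound : ∀ v → d v + count S v ≤ 3
    bound v with v ∈? S
    ... | yes v∈ = +-mono-≤ (≤-trans (≤-reflexive (S⇒d≡1 v∈)) (n≤1+n 1)) (count-unique v S-unique)
    ... | no v∉  = ≤-trans (≤-reflexive (trans (cong (d v +_) (count-∉ S v∉)) (+-identityʳ (d v)))) (d≤3 v)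
  ... | v , v∉ , p with v ∈? S
  ...   | yes v∈ = ⊥-elim (<-irrefl refl (≤-trans p
                     (+-mono-≤ (≤-reflexive (S⇒d≡1 v∈)) (count-unique v S-unique))))
  ...   | no v∉S = v , v∉ , ≤-antisym (d≤3 v)
                     (≤-trans p (≤-reflexive (trans (cong (d v +_) (count-∉ S v∉S)) (+-identityʳ (d v)))))

  regular : length S ≡ 0 → ∀ v → d v ≡ 2
  regular S≡0 v = sym (sum-≤-≡ 2≤d (≤-reflexive (trans sum-d (sym (sum-const n 2)))) v)
    where
    2≤d : ∀ v → 2 ≤ d v
    2≤d v = ≤-trans (d+S v) (≤-reflexive (trans (cong (d v +_) (n≤0⇒n≡0 (≤-trans (sum-term (count S) v)
              (≤-reflexive (trans (sum-count S) S≡0))))) (+-identityʳ (d v))))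

  parent : ∀ v → ∃[ u ] u ⟶ v
  parent v with fresh-parent [] (1≤d v)
  ... | u , _ , uv = u , uv

  S-missing : ∀ u v → count S v ≤ P (c₁ u) v + P (c₂ u) v
  S-missing u = count≤ S-unique (All.tabulate λ v∈ → let (a , ua , av) = missing₁ u (S⇒d≡1 v∈) in P-one ua av)

  sum-P : ∀ u → sum (P u) ≡ 2
  sum-P u = trans (∑-distrib-+ (δ (o₁ u)) (δ (o₂ u))) (cong₂ _+_ (sum-δ₁ (o₁ u)) (sum-δ₁ (o₂ u)))

  sum-PP : ∀ u → sum (λ v → P (c₁ u) v + P (c₂ u) v) ≡ 4
  sum-PP u = trans (∑-distrib-+ (P (c₁ u)) (P (c₂ u))) (cong₂ _+_ (sum-P (c₁ u)) (sum-P (c₂ u)))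

  |S|≤4 : Fin n → length S ≤ 4
  |S|≤4 u = ≤-trans (≤-reflexive (sym (sum-count S)))
    (≤-trans (sum-mono (S-missing u)) (≤-reflexive (sum-PP u)))

  module Four (|S|≡4 : length S ≡ 4) where

    exactly-S : ∀ u v → count S v ≡ P (c₁ u) v + P (c₂ u) v
    exactly-S u = sum-≤-≡ (S-missing u)
      (≤-reflexive (trans (sum-PP u) (trans (sym |S|≡4) (sym (sum-count S)))))

    missing⇒1 : ∀ {u v} → Missing-child u v → d v ≡ 1
    missing⇒1 {u} {v} (a , ua , av) = S⇒d≡1 (count≥1⇒∈ S
      (≤-trans (P-one ua av) (≤-reflexive (sym (exactly-S u v)))))

    outlier⇒1 : ∀ {u x} → u ↛ x → d x ≡ 1
    outlier⇒1 {u} ux with parent u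
    ... | w , wu = missing⇒1 (u , wu , ux)

    -- By `balance′`, in-degree 2 would make v an outlier of a child of `u`, hence of in-degree 1;
    -- in-degree 1 would make both children of `u` miss v, against `exactly-S`.
    outlier-child⇒3 : ∀ {u x v} → u ↛ x → x ⟶ v → d v ≡ 3
    outlier-child⇒3 {u} {x} {v} ux xv with in-degree v
    ... | three dv = dv
    ... | two dv = case trans (sym dv) (missing⇒1 (missing₂ (≤-reflexive dv) ux xv)) of λ ()
    ... | one dv = ⊥-elim (<-irrefl refl (begin
      3                                  ≤⟨ +-monoˡ-≤ 2 (A-one ux xv) ⟩
      A (o₁ u) v + A (o₂ u) v + 2        ≡⟨ balance′ u v ⟨
      P (c₁ u) v + P (c₂ u) v + d v      ≡⟨ cong₂ _+_ (sym (exactly-S u v)) dv ⟩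
      count S v + 1                      ≤⟨ +-monoˡ-≤ 1 (count-unique v S-unique) ⟩
      2                                  ∎))
      where open ≤-Reasoning

    1≢3 : ∀ {v} → d v ≡ 1 → d v ≢ 3
    1≢3 e e′ = case trans (sym e) e′ of λ ()

    one-parent : ∀ {u v x y} → d v ≡ 3 → x ≢ y → u ↛ x → x ⟶ v → y ⟶ v → ¬ u ↛ y
    one-parent dv x≢y ux xv yv uy = 1≢3 (missing⇒1 (missing₃ dv ux uy x≢y xv yv)) dv

    -- Each of the three parents misses exactly one of the other two. The second child of the missed
    -- parent has in-degree 3 by `outlier-child⇒3`; that of the parent not missed is itself an
    -- outlier by `sibling`, so has in-degree 1. Going round `x`, `y`, `z`, some second child gets
    -- both in-degrees.
    no-parents : ∀ {v x x′ y y′ z z′} → d v ≡ 3 → x ≢ y → x ≢ z → y ≢ z → x ⟶ v → y ⟶ v → z ⟶ v →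
                 x ⟶ x′ → y ⟶ y′ → z ⟶ z′ → v ≢ x′ → v ≢ y′ → v ≢ z′ → ¬ x ↛ y
    no-parents {v} {x} {x′} {y} {y′} {z} {z′} dv x≢y x≢z y≢z xv yv zv xx′ yy′ zz′ v≢x′ v≢y′ v≢z′ xy =
      [ z↛x-case , [ z↛y-case , ¬self-↛ ]′ ]′ (outlying-of-3 z dv x≢y x≢z y≢z xv yv zv)
      where
      not-first : ∀ {u p q} → ¬ u ↛ p → u ↛ p ⊎ u ↛ q → u ↛ q
      not-first ¬p = [ ⊥-elim ∘ ¬p , (λ q → q) ]′
      dy′ : d y′ ≡ 3
      dy′ = outlier-child⇒3 xy yy′
      dz′ : d z′ ≡ 1
      dz′ = outlier⇒1 (not-first (one-parent dv y≢z xy yv zv) (sibling x≢z xv zv zz′ v≢z′))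
      y↛x : y ↛ x
      y↛x = [ (λ yx → yx) , [ ⊥-elim ∘ ¬self-↛ , (λ yz → ⊥-elim (1≢3 dz′ (outlier-child⇒3 yz zz′))) ]′ ]′
        (outlying-of-3 y dv x≢y x≢z y≢z xv yv zv)
      z↛x-case : ¬ z ↛ x
      z↛x-case zx = 1≢3 (outlier⇒1 (not-first (one-parent dv x≢y zx xv yv)
        (sibling (y≢z ∘ sym) zv yv yy′ v≢y′))) dy′
      z↛y-case : ¬ z ↛ y
      z↛y-case zy = 1≢3 (outlier⇒1 (not-first (one-parent dv (x≢y ∘ sym) zy yv xv)
        (sibling (x≢z ∘ sym) zv xv xx′ v≢x′))) (outlier-child⇒3 y↛x xx′)

    impossible : ⊥
    impossible with excessive [] (subst (0 <_) (sym |S|≡4) (s≤s z≤n))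
    ... | v , _ , dv with parent v
    ... | x , xv with outlying₃ x dv
    ... | y , xy , yv with fresh-parent (x ∷ y ∷ []) (subst (2 <_) (sym dv) ≤-refl)
    ... | z , z∉ , zv with Arc.other xv | Arc.other yv | Arc.other zv
    ... | x′ , v≢x′ , xx′ | y′ , v≢y′ , yy′ | z′ , v≢z′ , zz′ =
      no-parents dv (λ { refl → ¬self-↛ xy }) (z∉ ∘ here ∘ sym) (z∉ ∘ there ∘ here ∘ sym)
        xv yv zv xx′ yy′ zz′ v≢x′ v≢y′ v≢z′ xy

-- Level sums

Σ< : (ℕ → ℕ) → ℕ → ℕ
Σ< f zero    = 0
Σ< f (suc N) = f 0 + Σ< (f ∘ suc) N

Σ<-snoc : ∀ f N → Σ< f (suc N) ≡ Σ< f N + f N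
Σ<-snoc f zero    = +-comm (f 0) 0
Σ<-snoc f (suc N) = trans (cong (f 0 +_) (Σ<-snoc (f ∘ suc) N)) (sym (+-assoc (f 0) _ _))

weight : ∀ {n} → (Fin n → ℕ) → List (Fin n) → ℕ
weight f []      = 0
weight f (x ∷ l) = f x + weight f l

sum-*-count : ∀ {n} (f : Fin n → ℕ) l → sum (λ x → f x * count l x) ≡ weight f l
sum-*-count {n} f [] = trans (sum-cong-≗ λ x → *-zeroʳ (f x)) (trans (sum-const n 0) (*-zeroʳ n))
sum-*-count f (x ∷ l) = begin
  sum (λ y → f y * (δ x y + count l y))                      ≡⟨ sum-cong-≗ (λ y → lemma (f y) (δ x y) (count l y)) ⟩
  sum (λ y → δ x y * f y + f y * count l y)                  ≡⟨ ∑-distrib-+ (λ y → δ x y * f y) _ ⟩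
  sum (λ y → δ x y * f y) + sum (λ y → f y * count l y)      ≡⟨ cong₂ _+_ (sum-δ x f) (sum-*-count f l) ⟩
  f x + weight f l                                           ∎
  where
  open ≡-Reasoning
  lemma : ∀ a b c → a * (b + c) ≡ b * a + a * c
  lemma = solve-∀

weight-+ : ∀ {n} (f g : Fin n → ℕ) l → weight f l + weight g l ≡ weight (λ x → f x + g x) l
weight-+ f g [] = refl
weight-+ f g (x ∷ l) = trans (lemma (f x) (weight f l) (g x) (weight g l)) (cong (f x + g x +_) (weight-+ f g l))
  where
  lemma : ∀ a b c d → a + b + (c + d) ≡ a + c + (b + d)
  lemma = solve-∀

weight-cong : ∀ {n} {f g : Fin n → ℕ} → (∀ x → f x ≡ g x) → ∀ l → weight f l ≡ weight g l
weight-cong e [] = refl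
weight-cong e (x ∷ l) = cong₂ _+_ (e x) (weight-cong e l)

weight≤length : ∀ {n} {f : Fin n → ℕ} → (∀ x → f x ≤ 1) → ∀ l → weight f l ≤ length l
weight≤length f≤1 [] = z≤n
weight≤length f≤1 (x ∷ l) = +-mono-≤ (f≤1 x) (weight≤length f≤1 l)

-- A sequence which doubles up to losses p grows least when all losses occur at the start.
growth : ∀ (a p : ℕ → ℕ) → (∀ t → 2 * a t ≤ a (suc t) + p t) → ∀ N →
         a 0 * 2 ^ suc N + Σ< p N ≤ Σ< a (suc N) + a 0 + Σ< p N * 2 ^ N
growth a p doubling zero = ≤-reflexive (lemma (a 0))
  where
  lemma : ∀ a → a * 2 + 0 ≡ a + 0 + a + 0
  lemma = solve-∀
growth a p doubling (suc N) = +-cancelʳ-≤ (a 1) _ _ (begin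
  a 0 * (2 * (2 * K)) + (p 0 + Σp) + a 1
    ≡⟨ l₁ (a 0) K (p 0) Σp (a 1) ⟩
  2 * K * (2 * a 0) + (a 1 + p 0) + Σp
    ≤⟨ +-monoˡ-≤ Σp (spread (2 * a 0) (a 1 + p 0) (2 * K) (doubling 0) (≤-trans (m^n>0 2 N) (m≤m+n K _))) ⟩
  2 * a 0 + 2 * K * (a 1 + p 0) + Σp
    ≡⟨ l₂ (a 0) K (a 1) (p 0) Σp ⟩
  2 * a 0 + 2 * K * p 0 + (a 1 * (2 * K) + Σp)
    ≤⟨ +-monoʳ-≤ (2 * a 0 + 2 * K * p 0) (growth (a ∘ suc) (p ∘ suc) (doubling ∘ suc) N) ⟩
  2 * a 0 + 2 * K * p 0 + (Σ< (a ∘ suc) (suc N) + a 1 + Σp * K)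
    ≤⟨ m≤m+n _ (Σp * K) ⟩
  2 * a 0 + 2 * K * p 0 + (Σ< (a ∘ suc) (suc N) + a 1 + Σp * K) + Σp * K
    ≡⟨ l₃ (a 0) K (p 0) (Σ< (a ∘ suc) (suc N)) (a 1) Σp ⟩
  a 0 + Σ< (a ∘ suc) (suc N) + a 0 + (p 0 + Σp) * (2 * K) + a 1 ∎)
  where
  open ≤-Reasoning
  K = 2 ^ N
  Σp = Σ< (p ∘ suc) N
  l₁ : ∀ a K p s b → a * (2 * (2 * K)) + (p + s) + b ≡ 2 * K * (2 * a) + (b + p) + s
  l₁ = solve-∀
  l₂ : ∀ a K b p s → 2 * a + 2 * K * (b + p) + s ≡ 2 * a + 2 * K * p + (b * (2 * K) + s)
  l₂ = solve-∀
  l₃ : ∀ a K p t b s → 2 * a + 2 * K * p + (t + b + s * K) + s * K ≡ a + t + a + (p + s) * (2 * K) + b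
  l₃ = solve-∀
  spread : ∀ x y q → x ≤ y → 1 ≤ q → q * x + y ≤ x + q * y
  spread x y (suc q) x≤y _ = begin
    suc q * x + y        ≡⟨ l (q * x) x y ⟩
    x + y + q * x        ≤⟨ +-monoʳ-≤ (x + y) (*-monoʳ-≤ q x≤y) ⟩
    x + y + q * y        ≡⟨ l′ x y (q * y) ⟩
    x + suc q * y        ∎
    where
    l : ∀ z x y → x + z + y ≡ x + y + z
    l = solve-∀
    l′ : ∀ x y z → x + y + z ≡ x + (y + z)
    l′ = solve-∀

-- Solving growth for p₁: here 2 ^ i = suc m, the levels 0 and 1 have 1 and 3 vertices, and level 2
-- has a₂ ≥ 6 - p₁ vertices.
bound₂ : ∀ m a₂ L P₂ p₁ E c → a₂ * (2 * suc m) + P₂ ≤ L + a₂ + P₂ * suc m → 6 ≤ a₂ + p₁ →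
         p₁ + P₂ ≤ E → 4 + L + c ≤ 1 + 8 * suc m → 4 * m + 1 + c ≤ E * m + p₁ * suc m
bound₂ m a₂ L P₂ p₁ E c grow a₂+p₁ losses total = +-cancelˡ-≤ (8 * m + 9) _ _ (begin
  8 * m + 9 + (4 * m + 1 + c)                            ≡⟨ l₁ m c ⟩
  6 * (2 * m + 1) + (4 + c)                              ≤⟨ +-monoˡ-≤ (4 + c) (*-monoˡ-≤ (2 * m + 1) a₂+p₁) ⟩
  (a₂ + p₁) * (2 * m + 1) + (4 + c)                      ≡⟨ l₂ a₂ p₁ m c ⟩
  a₂ * (2 * m + 1) + (p₁ * (2 * m + 1) + 4 + c)          ≤⟨ +-monoˡ-≤ _ grow′ ⟩
  L + P₂ * m + (p₁ * (2 * m + 1) + 4 + c)                ≡⟨ l₃ L P₂ m p₁ c ⟩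
  4 + L + c + ((p₁ + P₂) * m + p₁ * suc m)               ≤⟨ +-mono-≤ total (+-monoˡ-≤ (p₁ * suc m) (*-monoˡ-≤ m losses)) ⟩
  1 + 8 * suc m + (E * m + p₁ * suc m)                   ≡⟨ cong (_+ (E * m + p₁ * suc m)) (l₄ m) ⟩
  8 * m + 9 + (E * m + p₁ * suc m)                       ∎)
  where
  open ≤-Reasoning
  l₁ : ∀ m c → 8 * m + 9 + (4 * m + 1 + c) ≡ 6 * (2 * m + 1) + (4 + c)
  l₁ = solve-∀
  l₂ : ∀ a p m c → (a + p) * (2 * m + 1) + (4 + c) ≡ a * (2 * m + 1) + (p * (2 * m + 1) + 4 + c)
  l₂ = solve-∀
  l₃ : ∀ L P m p c → L + P * m + (p * (2 * m + 1) + 4 + c) ≡ 4 + L + c + ((p + P) * m + p * suc m)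
  l₃ = solve-∀
  l₄ : ∀ m → 1 + 8 * suc m ≡ 8 * m + 9
  l₄ = solve-∀
  l₅ : ∀ a m P → a * (2 * m + 1) + (a + P) ≡ a * (2 * suc m) + P
  l₅ = solve-∀
  l₆ : ∀ L a P m → L + a + P * suc m ≡ L + P * m + (a + P)
  l₆ = solve-∀
  grow′ : a₂ * (2 * m + 1) ≤ L + P₂ * m
  grow′ = +-cancelʳ-≤ (a₂ + P₂) _ _ (≤-trans (≤-reflexive (l₅ a₂ m P₂)) (≤-trans grow (≤-reflexive (l₆ L a₂ P₂ m))))

-- The same from level 3 on, with p₁ = 1 and 2 ^ i = 2 * suc h.
bound₃ : ∀ h a₂ a₃ L P₃ p₂ → a₃ * (2 * suc h) + P₃ ≤ L + a₃ + P₃ * suc h → 5 ≤ a₂ → 2 * a₂ ≤ a₃ + p₂ →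
         p₂ + P₃ ≤ 2 → 4 + (a₂ + L) ≤ 1 + 16 * suc h → 2 ≤ p₂
bound₃ h a₂ a₃ L P₃ p₂ grow 5≤a₂ doubling losses total with 2 ≤? p₂
... | yes p = p
... | no ¬p = ⊥-elim (<-irrefl refl (+-cancelˡ-≤ (19 * h + 14) 1 0 (begin
  19 * h + 14 + 1                                     ≤⟨ m≤m+n _ h ⟩
  19 * h + 14 + 1 + h                                 ≡⟨ l₁ h ⟩
  2 * 5 * (2 * h + 1) + 5                             ≤⟨ +-mono-≤ (*-monoˡ-≤ (2 * h + 1) (≤-trans (*-monoʳ-≤ 2 5≤a₂) doubling)) 5≤a₂ ⟩
  (a₃ + p₂) * (2 * h + 1) + a₂                        ≡⟨ l₂ a₃ p₂ h a₂ ⟩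
  a₃ * (2 * h + 1) + (p₂ * (2 * h + 1) + a₂)          ≤⟨ +-monoˡ-≤ _ grow′ ⟩
  L + P₃ * h + (p₂ * (2 * h + 1) + a₂)                ≡⟨ l₃ L P₃ h p₂ a₂ ⟩
  a₂ + L + ((p₂ + P₃) * h + p₂ * suc h)               ≤⟨ +-mono-≤ total′ (+-mono-≤ (*-monoˡ-≤ h losses) (*-monoˡ-≤ (suc h) (≤-pred (≰⇒> ¬p)))) ⟩
  16 * h + 13 + (2 * h + 1 * suc h)                   ≡⟨ l₄ h ⟩
  19 * h + 14 + 0                                     ∎)))
  where
  open ≤-Reasoning
  l₁ : ∀ h → 19 * h + 14 + 1 + h ≡ 2 * 5 * (2 * h + 1) + 5
  l₁ = solve-∀
  l₂ : ∀ a p m c → (a + p) * (2 * m + 1) + c ≡ a * (2 * m + 1) + (p * (2 * m + 1) + c)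
  l₂ = solve-∀
  l₃ : ∀ L P m p c → L + P * m + (p * (2 * m + 1) + c) ≡ c + L + ((p + P) * m + p * suc m)
  l₃ = solve-∀
  l₄ : ∀ h → 16 * h + 13 + (2 * h + 1 * suc h) ≡ 19 * h + 14 + 0
  l₄ = solve-∀
  l₅ : ∀ a m P → a * (2 * m + 1) + (a + P) ≡ a * (2 * suc m) + P
  l₅ = solve-∀
  l₆ : ∀ L a P m → L + a + P * suc m ≡ L + P * m + (a + P)
  l₆ = solve-∀
  l₇ : ∀ h → 1 + 16 * suc h ≡ 4 + (16 * h + 13)
  l₇ = solve-∀
  total′ : a₂ + L ≤ 16 * h + 13
  total′ = +-cancelˡ-≤ 4 _ _ (≤-trans total (≤-reflexive (l₇ h)))
  grow′ : a₃ * (2 * h + 1) ≤ L + P₃ * h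
  grow′ = +-cancelʳ-≤ (a₃ + P₃) _ _ (≤-trans (≤-reflexive (l₅ a₃ h P₃)) (≤-trans grow (≤-reflexive (l₆ L a₃ P₃ h))))

module Levels {n i : ℕ} (X : BinaryGeodetic n i) where
  open Deficient X

  -- a v t vertices (with multiplicity) have a walk of length t to v, and p v t of them lie in S.
  a p : Fin n → ℕ → ℕ
  a v t = sum (λ x → W t x v)
  p v t = weight (λ x → W t x v) S

  a-suc : ∀ v t → a v (suc t) ≡ sum (λ x → W t x v * d x)
  a-suc v t = begin
    sum (λ z → W t (c₁ z) v + W t (c₂ z) v)        ≡⟨ sum-cong-≗ expand ⟩
    sum (λ z → sum (λ x → W t x v * A z x))        ≡⟨ ∑-comm (λ z x → W t x v * A z x) ⟩
    sum (λ x → sum (λ z → W t x v * A z x))        ≡⟨ sum-cong-≗ (λ x → *-distribˡ-sum (W t x v) (λ z → A z x)) ⟨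
    sum (λ x → W t x v * d x)                      ∎
    where
    open ≡-Reasoning
    distr : ∀ a b c → c * (a + b) ≡ a * c + b * c
    distr = solve-∀
    expand : ∀ z → W t (c₁ z) v + W t (c₂ z) v ≡ sum (λ x → W t x v * A z x)
    expand z = sym (trans (sum-cong-≗ λ x → distr (δ (c₁ z) x) (δ (c₂ z) x) (W t x v))
      (trans (∑-distrib-+ (λ x → δ (c₁ z) x * W t x v) _)
             (cong₂ _+_ (sum-δ (c₁ z) λ x → W t x v) (sum-δ (c₂ z) λ x → W t x v))))

  -- Every vertex on level t has at least two parents, except those in `S`, which have one; `p v t`
  -- counts that loss.
  doubling : ∀ v t → 2 * a v t ≤ a v (suc t) + p v t
  doubling v t = begin
    2 * sum (λ x → W t x v)                                     ≡⟨ *-distribˡ-sum 2 (λ x → W t x v) ⟩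
    sum (λ x → 2 * W t x v)                                     ≤⟨ sum-mono term ⟩
    sum (λ x → W t x v * d x + W t x v * count S x)             ≡⟨ ∑-distrib-+ (λ x → W t x v * d x) _ ⟩
    sum (λ x → W t x v * d x) + sum (λ x → W t x v * count S x) ≡⟨ cong₂ _+_ (sym (a-suc v t)) (sum-*-count _ S) ⟩
    a v (suc t) + p v t                                         ∎
    where
    open ≤-Reasoning
    term : ∀ x → 2 * W t x v ≤ W t x v * d x + W t x v * count S x
    term x = ≤-trans (≤-reflexive (*-comm 2 (W t x v)))
      (≤-trans (*-monoʳ-≤ (W t x v) (d+S x)) (≤-reflexive (*-distribˡ-+ (W t x v) (d x) (count S x))))

  Σa : ∀ v j → Σ< (a v) (suc j) ≡ sum (λ x → R j x v)
  Σa v zero = +-identityʳ _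
  Σa v (suc j) = trans (Σ<-snoc (a v) (suc j)) (trans (cong (_+ a v (suc j)) (Σa v j))
    (trans (sym (∑-distrib-+ (λ x → R j x v) (λ x → W (suc j) x v)))
           (sum-cong-≗ λ x → sym (R-suc j x v))))

  Σp : ∀ v j → Σ< (p v) (suc j) ≡ weight (λ x → R j x v) S
  Σp v zero = +-identityʳ _
  Σp v (suc j) = trans (Σ<-snoc (p v) (suc j)) (trans (cong (_+ p v (suc j)) (Σp v j))
    (trans (weight-+ (λ x → R j x v) (λ x → W (suc j) x v) S)
           (weight-cong (λ x → sym (R-suc j x v)) S)))

  -- An element of `S` has at most one short walk to `v`, so it is charged on one level only.
  Σp≤ : ∀ v → Σ< (p v) (suc k) ≤ length S
  Σp≤ v = ≤-trans (≤-reflexive (Σp v k)) (weight≤length (λ x → geodetic x v) S)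

  Σa≤ : ∀ v {l} → Unique l → All (_↛ v) l → Σ< (a v) (suc k) + length l ≤ n
  Σa≤ v {l} u all = begin
    Σ< (a v) (suc k) + length l                   ≡⟨ cong (_+ length l) (Σa v k) ⟩
    sum (λ x → R k x v) + length l                ≤⟨ +-monoʳ-≤ _ (unique-length u (All.map (λ q → ≤-reflexive (sym (Out.⟦⟧-yes q))) all)) ⟩
    sum (λ x → R k x v) + sum (λ x → P x v)       ≡⟨ ∑-distrib-+ (λ x → R k x v) (λ x → P x v) ⟨
    sum (λ x → R k x v + P x v)                   ≡⟨ sum-cong-≗ (λ x → R+P x v) ⟩
    sum {n} (λ _ → 1)                             ≡⟨ trans (sum-const n 1) (*-identityʳ n) ⟩
    n                                             ∎
    where open ≤-Reasoning

  a₀ : ∀ v → a v 0 ≡ 1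
  a₀ v = trans (sum-cong-≗ δ-sym) (sum-δ₁ v)
    where
    δ-sym : ∀ x → δ x v ≡ δ v x
    δ-sym x with x Fin.≟ v
    ... | yes refl = sym (δ-refl x)
    ... | no x≢v = sym (δ-≢ (x≢v ∘ sym))

  m : ℕ
  m = pred (2 ^ i)

  2^i : 2 ^ i ≡ suc m
  2^i = sym (suc-pred (2 ^ i) {{m^n≢0 2 i}})

  n≡ : n ≡ 1 + 8 * suc m
  n≡ = trans order (cong suc (trans (lemma (2 ^ i)) (cong (8 *_) 2^i)))
    where
    lemma : ∀ x → 2 * (2 * (2 * x)) ≡ 8 * x
    lemma = solve-∀

  S-parents : Fin n → ℕ
  S-parents v = weight (λ x → A x v) S

  -- The full in-tree has 4m + 1 vertices too many, and room for the vertices of `l`, which lie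
  -- outside it, must be saved as well. Elements of `S` save `m` each at most, and a parent of `v`
  -- in `S` saves `suc m` more.
  S-parents-bound : ∀ {v l} → d v ≡ 3 → Unique l → All (_↛ v) l →
                    4 * m + 1 + length l ≤ length S * m + S-parents v * suc m
  S-parents-bound {v} {l} dv u all = bound₂ m (a v 2) L P₂ (p v 1) (length S) (length l)
    (subst (λ q → a v 2 * (2 * q) + P₂ ≤ L + a v 2 + P₂ * q) 2^i (growth (λ t → a v (2 + t)) (λ t → p v (2 + t)) (λ t → doubling v (2 + t)) i))
    (subst (λ q → 2 * q ≤ a v 2 + p v 1) dv (doubling v 1))
    (≤-trans (≤-trans (+-monoʳ-≤ (p v 1) (≤-trans (m≤m+n P₂ _) (≤-reflexive (sym (Σ<-snoc (λ t → p v (2 + t)) i))))) (m≤n+m _ (p v 0))) (Σp≤ v))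
    (≤-trans (≤-reflexive (cong (_+ length l) (sym (cong₂ _+_ (a₀ v) (cong (_+ L) dv))))) (≤-trans (Σa≤ v u all) (≤-reflexive n≡)))
    where
    L P₂ : ℕ
    L = Σ< (λ t → a v (2 + t)) (suc i)
    P₂ = Σ< (λ t → p v (2 + t)) i

-- k ≥ 3 with one or two vertices of in-degree 1

module Large {n i : ℕ} (X : BinaryGeodetic n (suc i)) where
  open Deficient X
  open Levels X

  -- This is where k ≥ 3 enters.
  1≤m : 1 ≤ m
  1≤m = ≤-pred (≤-trans (*-monoʳ-≤ 2 (m^n>0 2 i)) (≤-reflexive 2^i))

  not-one : length S ≢ 1
  not-one |S|≡1 with excessive [] (subst (0 <_) (sym |S|≡1) (s≤s z≤n))
  ... | v , _ , dv = <-irrefl refl (≤-trans (+-mono-≤ 1≤m 1≤m) (+-cancelˡ-≤ (2 * m + 1) _ _ (begin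
    2 * m + 1 + (m + m)                       ≡⟨ l₁ m ⟩
    4 * m + 1 + 0                             ≤⟨ S-parents-bound {l = []} dv [] [] ⟩
    length S * m + S-parents v * suc m        ≤⟨ +-mono-≤ (≤-reflexive (cong (_* m) |S|≡1))
                                                   (*-monoˡ-≤ (suc m) (≤-trans (weight≤length (λ x → Arc.⟦⟧≤1 x v) S) (≤-reflexive |S|≡1))) ⟩
    1 * m + 1 * suc m                         ≡⟨ l₂ m ⟩
    2 * m + 1 + 0                             ≤⟨ +-monoʳ-≤ (2 * m + 1) z≤n ⟩
    2 * m + 1 + 1                             ∎)))
    where
    open ≤-Reasoning
    l₁ : ∀ m → 2 * m + 1 + (m + m) ≡ 4 * m + 1 + 0
    l₁ = solve-∀
    l₂ : ∀ m → 1 * m + 1 * suc m ≡ 2 * m + 1 + 0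
    l₂ = solve-∀

  -- The poles s₁ and s₂ have the same children v and w; let z₁ and z₂ be the third parents of v and w.
  record Config₂ (v w s₁ s₂ : Fin n) : Set where
    field
      s₁≢s₂ : s₁ ≢ s₂
      v≢w   : v ≢ w
      ds₁   : d s₁ ≡ 1
      ds₂   : d s₂ ≡ 1
      dv    : d v ≡ 3
      dw    : d w ≡ 3
      s₁v   : s₁ ⟶ v
      s₁w   : s₁ ⟶ w
      s₂v   : s₂ ⟶ v
      s₂w   : s₂ ⟶ w
      ↛v    : ∀ {x y} → x ↛ v → y ↛ v → x ≡ y
      ↛w    : ∀ {x y} → x ↛ w → y ↛ w → x ≡ y
      ones   : ∀ {x} → d x ≡ 1 → x ≡ s₁ ⊎ x ≡ s₂
      threes : ∀ {x} → d x ≡ 3 → x ≡ v ⊎ x ≡ w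

  flip : ∀ {a} {B C : Set a} → B ⊎ C → C ⊎ B
  flip = [ inj₂ , inj₁ ]′

  mirror : ∀ {v w s₁ s₂} → Config₂ v w s₁ s₂ → Config₂ w v s₁ s₂
  mirror C = record
    { s₁≢s₂ = s₁≢s₂ ; v≢w = v≢w ∘ sym ; ds₁ = ds₁ ; ds₂ = ds₂ ; dv = dw ; dw = dv
    ; s₁v = s₁w ; s₁w = s₁v ; s₂v = s₂w ; s₂w = s₂v ; ↛v = ↛w ; ↛w = ↛v
    ; ones = ones ; threes = flip ∘ threes }
    where open Config₂ C

  module _ {v w s₁ s₂ : Fin n} (C : Config₂ v w s₁ s₂) where
    open Config₂ C

    Pole : Fin n → Set
    Pole s = s ≡ s₁ ⊎ s ≡ s₂

    pole-v : ∀ {s} → Pole s → s ⟶ v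
    pole-v (inj₁ refl) = s₁v
    pole-v (inj₂ refl) = s₂v

    pole-w : ∀ {s} → Pole s → s ⟶ w
    pole-w (inj₁ refl) = s₁w
    pole-w (inj₂ refl) = s₂w

    pole-d : ∀ {s} → Pole s → d s ≡ 1
    pole-d (inj₁ refl) = ds₁
    pole-d (inj₂ refl) = ds₂

    pole-children : ∀ {s x} → Pole s → s ⟶ x → x ≡ v ⊎ x ≡ w
    pole-children p sx = Arc.one-of (pole-v p) (pole-w p) v≢w sx

    ¬w⟶v : ¬ w ⟶ v
    ¬w⟶v = no-triangle s₁v s₁w

    ¬v⟶w : ¬ v ⟶ w
    ¬v⟶w = no-triangle s₁w s₁v

    ¬v⟶pole : ∀ {s} → Pole s → ¬ v ⟶ s
    ¬v⟶pole p = no-2-cycle (pole-v p)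

    ¬w⟶pole : ∀ {s} → Pole s → ¬ w ⟶ s
    ¬w⟶pole p = no-2-cycle (pole-w p)

    ¬pole-arc : ∀ {s t} → Pole s → Pole t → ¬ s ⟶ t
    ¬pole-arc p q st with pole-children p st
    ... | inj₁ refl = no-loop (pole-v q)
    ... | inj₂ refl = no-loop (pole-w q)

    degree-2 : ∀ {x} → ¬ Pole x → x ≢ v → x ≢ w → d x ≡ 2
    degree-2 {x} ¬p x≢v x≢w with in-degree x
    ... | one dx = ⊥-elim (¬p (ones dx))
    ... | two dx = dx
    ... | three dx = ⊥-elim ([ x≢v , x≢w ]′ (threes dx))

    s₁↛s₂ : s₁ ↛ s₂
    s₁↛s₂ = [ (λ p → p) , ⊥-elim ∘ ¬⟶-↛ s₁w ]′ (sibling s₁≢s₂ s₁v s₂v s₂w v≢w)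

    missing-s₁ : ∀ {x} → Missing-child s₁ x → v ↛ x ⊎ w ↛ x
    missing-s₁ = missed-by s₁v s₁w v≢w

    -- `s₁` misses both `s₂` and x, two parents of `v`, so `missing₃` makes a child of `s₁` miss
    -- `v`, and that child is not `v` itself.
    w↛v : ∀ {x} → s₁ ↛ x → x ⟶ v → ¬ Pole x → w ↛ v
    w↛v s₁x xv ¬p = missed-by-other s₁v s₁w v≢w (missing₃ dv s₁↛s₂ s₁x (λ e → ¬p (inj₂ (sym e))) s₂v xv)

    -- As `w` and `s` are the only outliers of `v`, `sibling` leaves few choices for `y` and its
    -- other child; all but an arc from `y` to `s` close a loop, a triangle or a diamond.
    escape : ∀ {s y} → Pole s → v ↛ w → v ↛ s →
             (y ⟶ w → y ⟶ v) → ∀ {x} → v ⟶ x → y ≢ v → y ⟶ x → y ⟶ s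
    escape {s} {y} p vw vs up {x} vx y≢v yx with Arc.other yx
    ... | y′ , x≢y′ , yy′ with sibling (y≢v ∘ sym) vx yx yy′ x≢y′
    ... | inj₁ vy with Out.one-of vw vs (λ { refl → no-loop (pole-w p) }) vy
    ...   | inj₁ refl = ⊥-elim (no-diamond s₁v s₁w v≢w vx yx)
    ...   | inj₂ refl with pole-children p yx
    ...     | inj₁ refl = ⊥-elim (no-loop vx)
    ...     | inj₂ refl = ⊥-elim (¬v⟶w vx)
    escape {s} {y} p vw vs up {x} vx y≢v yx | y′ , x≢y′ , yy′ | inj₂ vy′
      with Out.one-of vw vs (λ { refl → no-loop (pole-w p) }) vy′
    ...   | inj₁ refl = ⊥-elim (no-triangle yx (up yy′) vx)
    ...   | inj₂ refl = yy′

    child-of-v : ∀ {x} → v ⟶ x → d x ≡ 2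
    child-of-v vx = degree-2 (λ p → ¬v⟶pole p vx) (λ { refl → no-loop vx }) (λ { refl → ¬v⟶w vx })

    one-parent : ∀ {s x y} → Pole s → x ⟶ s → y ⟶ s → x ≡ y
    one-parent {s} {x} {y} p xs ys with x Fin.≟ y
    ... | yes e = e
    ... | no x≢y = ⊥-elim (<-irrefl refl (subst (2 ≤_) (pole-d p)
                     (parents-≤ ((x≢y ∷ []) ∷ [] ∷ []) (xs ∷ ys ∷ []))))

    -- The second parents of both children of v are parents of s, which has only one.
    no-common-parent′ : ∀ {s z} → Pole s → z ⟶ v → z ⟶ w → ¬ Pole z → v ↛ w → ¬ v ↛ s
    no-common-parent′ {s} {z} p zv zw ¬pz vw vs
      with fresh-parent (v ∷ []) (subst (1 <_) (sym (child-of-v (inj₁ refl))) ≤-refl)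
         | fresh-parent (v ∷ []) (subst (1 <_) (sym (child-of-v (inj₂ refl))) ≤-refl)
    ... | y₁ , y₁∉ , y₁x₁ | y₂ , y₂∉ , y₂x₂ with reach-s y₁∉ (inj₁ refl) y₁x₁ | reach-s y₂∉ (inj₂ refl) y₂x₂
      where
      up : ∀ {y} → y ⟶ w → y ⟶ v
      up yw with parents-of-3 dw s₁≢s₂ (¬pz ∘ inj₁ ∘ sym) (¬pz ∘ inj₂ ∘ sym) s₁w s₂w zw yw
      ... | inj₁ refl = s₁v
      ... | inj₂ (inj₁ refl) = s₂v
      ... | inj₂ (inj₂ refl) = zv
      reach-s : ∀ {x y} → y ∉ v ∷ [] → v ⟶ x → y ⟶ x → y ⟶ s
      reach-s y∉ vx yx = escape p vw vs up vx (y∉ ∘ here) yx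
    ... | y₁s | y₂s with one-parent p y₁s y₂s
    ... | refl = ¬v⟶pole p (Arc.one-of y₁x₁ y₂x₂ (c₁≢c₂ v) y₁s)

  -- `s₁` would miss `z`, whence `v` and `w` miss each other. One of them also misses the pole `s₁`,
  -- and `no-common-parent′` applies up to exchanging `v` and `w`.
  no-common-parent : ∀ {v w s₁ s₂ z} → Config₂ v w s₁ s₂ → ¬ (z ≡ s₁ ⊎ z ≡ s₂) → z ⟶ v → ¬ z ⟶ w
  no-common-parent {v} {w} {s₁} {s₂} {z} C ¬pz zv zw = choose
    (missing-s₁ C (missing₁ s₁ ds₁)) (missing-s₁ C (missing₁ s₁ ds₂))
    where
    open Config₂ C
    s₁z : s₁ ↛ z
    s₁z = [ (λ p → p) , ⊥-elim ∘ ¬⟶-↛ s₁w ]′ (sibling (¬pz ∘ inj₁ ∘ sym) s₁v zv zw v≢w)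
    wv : w ↛ v
    wv = w↛v C s₁z zv ¬pz
    vw : v ↛ w
    vw = w↛v (mirror C) s₁z zw ¬pz
    choose : v ↛ s₁ ⊎ w ↛ s₁ → v ↛ s₂ ⊎ w ↛ s₂ → ⊥
    choose (inj₁ vs₁) _ = no-common-parent′ C (inj₁ refl) zv zw ¬pz vw vs₁
    choose (inj₂ _) (inj₁ vs₂) = no-common-parent′ C (inj₂ refl) zv zw ¬pz vw vs₂
    choose (inj₂ ws₁) (inj₂ _) = no-common-parent′ (mirror C) (inj₁ refl) zw zv ¬pz wv ws₁

  -- As only `w` misses `v`, `z₂` misses both poles, so its child `z₁` misses `w`. Some child of
  -- `s₁` misses `p`; it is `v`, since `w` misses only `v` and a parent of `v`. Hence an outlier of
  -- `z₁` is a parent of `p`. But these outliers are `w`, which gives a diamond, and a pole, whose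
  -- children are `v` and `w`.
  no-nested-parents : ∀ {v w s₁ s₂ z₁ z₂ p} → Config₂ v w s₁ s₂ →
    ¬ (z₁ ≡ s₁ ⊎ z₁ ≡ s₂) → ¬ (z₂ ≡ s₁ ⊎ z₂ ≡ s₂) → z₁ ⟶ v → z₂ ⟶ w → z₁ ⟶ p → v ≢ p →
    s₁ ↛ z₁ → ¬ z₂ ⟶ z₁
  no-nested-parents {v} {w} {s₁} {s₂} {z₁} {z₂} {p} C ¬p₁ ¬p₂ z₁v z₂w z₁p v≢p s₁z₁ z₂z₁ = contra
    where
    open Config₂ C
    wv : w ↛ v
    wv = w↛v C s₁z₁ z₁v ¬p₁
    w≢z₁ : w ≢ z₁
    w≢z₁ refl = ¬w⟶v C z₁v
    s≢z₁ : ∀ {s} → Pole C s → s ≢ z₁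
    s≢z₁ ps refl = ¬p₁ ps
    z₂s : ∀ {s} → Pole C s → z₂ ↛ s
    z₂s {s} ps = [ (λ q → q) , (λ z₂v → ⊥-elim (no-loop (subst (_⟶ w) (↛v z₂v wv) z₂w))) ]′
      (sibling (λ { refl → ¬p₂ ps }) z₂w (pole-w C ps) (pole-v C ps) (v≢w ∘ sym))
    z₁w : z₁ ↛ w
    z₁w = missed-by-other z₂w z₂z₁ w≢z₁ (missing₃ dw (z₂s (inj₁ refl)) (z₂s (inj₂ refl)) s₁≢s₂ s₁w s₂w)
    p≢pole : ∀ {s} → Pole C s → s ≢ p
    p≢pole ps refl = no-triangle z₁v z₁p (pole-v C ps)
    p≢w : p ≢ w
    p≢w refl = no-common-parent C ¬p₁ z₁v z₁p
    dp : d p ≡ 2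
    dp = degree-2 C (λ ps → p≢pole ps refl) (v≢p ∘ sym) p≢w
    ¬w↛p : ¬ w ↛ p
    ¬w↛p wp = [ excluded s₁v (p≢pole (inj₁ refl)) , [ excluded s₂v (p≢pole (inj₂ refl)) , excluded z₁v z₁≢p ]′ ]′
      (outlying-of-3 w dv s₁≢s₂ (s≢z₁ (inj₁ refl)) (s≢z₁ (inj₂ refl)) s₁v s₂v z₁v)
      where
      z₁≢p : z₁ ≢ p
      z₁≢p refl = no-loop z₁p
      excluded : ∀ {x} → x ⟶ v → x ≢ p → ¬ w ↛ x
      excluded xv x≢p wx = [ (λ e → no-loop (subst (_⟶ v) e xv)) , x≢p ]′ (Out.one-of wv wp v≢p wx)
    vp : v ↛ p
    vp = [ (λ q → q) , ⊥-elim ∘ ¬w↛p ]′ (missing-s₁ C (missing₂ (≤-reflexive dp) s₁z₁ z₁p))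
    not-w : ∀ {x} → z₁ ↛ x → x ≢ w → Pole C x
    not-w {x} z₁x x≢w = [ is s₁w inj₁ , [ is s₂w inj₂ , ⊥-elim ∘ ¬self-↛ ]′ ]′
      (outlying-of-3 z₁ dv s₁≢s₂ (s≢z₁ (inj₁ refl)) (s≢z₁ (inj₂ refl)) s₁v s₂v z₁v)
      where
      is : ∀ {s} → s ⟶ w → (x ≡ s → Pole C x) → z₁ ↛ s → Pole C x
      is sw f z₁s = f (Out.the-other z₁w z₁s (λ e → no-loop (subst (_⟶ w) (sym e) sw)) z₁x x≢w)
    p-parent : Outlying-parent z₁ p → ⊥
    p-parent (x , z₁x , xp) with x Fin.≟ w
    ... | yes refl = no-diamond z₂w z₂z₁ w≢z₁ xp z₁p
    ... | no x≢w = [ v≢p ∘ sym , p≢w ]′ (pole-children C (not-w z₁x x≢w) xp)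
    contra : ⊥
    contra = p-parent (outlying₂ (≤-reflexive (sym dp)) z₁v vp)

  -- If `z₁` misses both poles, its child `b` misses `v`. As `b` alone misses `v`, `z₂` misses both
  -- poles too, and `b` also misses `w`. So `b` misses no parent of `v`, against `outlying-of-3`.
  no-shared-child-a : ∀ {v w s₁ s₂ z₁ z₂ b} → Config₂ v w s₁ s₂ →
    ¬ (z₁ ≡ s₁ ⊎ z₁ ≡ s₂) → ¬ (z₂ ≡ s₁ ⊎ z₂ ≡ s₂) → z₁ ⟶ v → z₂ ⟶ w → z₁ ⟶ b → z₂ ⟶ b →
    v ≢ b → w ≢ b → z₁ ↛ s₁ → ¬ z₁ ↛ s₂
  no-shared-child-a {v} {w} {s₁} {s₂} {z₁} {z₂} {b} C ¬p₁ ¬p₂ z₁v z₂w z₁b z₂b v≢b w≢b z₁s₁ z₁s₂ = contra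
    where
    open Config₂ C
    s≢z₁ : ∀ {s} → Pole C s → s ≢ z₁
    s≢z₁ ps refl = ¬p₁ ps
    bv : b ↛ v
    bv = missed-by-other z₁v z₁b v≢b (missing₃ dv z₁s₁ z₁s₂ s₁≢s₂ s₁v s₂v)
    z₂s : ∀ {s} → Pole C s → z₂ ↛ s
    z₂s {s} ps = [ (λ q → q) , (λ z₂v → ⊥-elim (no-loop (subst (_⟶ b) (↛v z₂v bv) z₂b))) ]′
      (sibling (λ { refl → ¬p₂ ps }) z₂w (pole-w C ps) (pole-v C ps) (v≢w ∘ sym))
    bw : b ↛ w
    bw = missed-by-other z₂w z₂b w≢b (missing₃ dw (z₂s (inj₁ refl)) (z₂s (inj₂ refl)) s₁≢s₂ s₁w s₂w)
    ¬parent : ∀ {x} → x ⟶ v → ¬ b ↛ x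
    ¬parent xv bx = [ (λ e → no-loop (subst (_⟶ v) e xv)) , (λ e → ¬w⟶v C (subst (_⟶ v) e xv)) ]′ (Out.one-of bv bw v≢w bx)
    contra : ⊥
    contra = [ ¬parent s₁v , [ ¬parent s₂v , ¬parent z₁v ]′ ]′
      (outlying-of-3 b dv s₁≢s₂ (s≢z₁ (inj₁ refl)) (s≢z₁ (inj₂ refl)) s₁v s₂v z₁v)

  -- The outliers of `z₁` are `w` and a pole, those of `z₂` are `v` and a pole. An outlier of `b` of
  -- in-degree 2 would be a child of both `v` and `w`, and `v` and `w` are missed only by `z₂` and
  -- `z₁`; so `b` misses the two poles. Then `v` misses neither pole, hence it misses `z₂`, which
  -- forces an arc from `w` to `z₂`, a 2-cycle.
  no-shared-child-b : ∀ {v w s₁ s₂ z₁ z₂ b} → Config₂ v w s₁ s₂ →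
    ¬ (z₁ ≡ s₁ ⊎ z₁ ≡ s₂) → ¬ (z₂ ≡ s₁ ⊎ z₂ ≡ s₂) → z₁ ⟶ v → z₂ ⟶ w → z₁ ⟶ b → z₂ ⟶ b →
    v ≢ b → w ≢ b → z₁ ↛ w → ¬ z₂ ↛ v
  no-shared-child-b {v} {w} {s₁} {s₂} {z₁} {z₂} {b} C ¬p₁ ¬p₂ z₁v z₂w z₁b z₂b v≢b w≢b z₁w z₂v = contra
    where
    open Config₂ C
    s≢z₁ : ∀ {s} → Pole C s → s ≢ z₁
    s≢z₁ ps refl = ¬p₁ ps
    s≢z₂ : ∀ {s} → Pole C s → s ≢ z₂
    s≢z₂ ps refl = ¬p₂ ps
    z₁-outlier : ∀ {x} → z₁ ↛ x → x ≡ w ⊎ Pole C x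
    z₁-outlier {x} z₁x = [ is s₁w inj₁ , [ is s₂w inj₂ , ⊥-elim ∘ ¬self-↛ ]′ ]′
      (outlying-of-3 z₁ dv s₁≢s₂ (s≢z₁ (inj₁ refl)) (s≢z₁ (inj₂ refl)) s₁v s₂v z₁v)
      where
      is : ∀ {s} → s ⟶ w → (x ≡ s → Pole C x) → z₁ ↛ s → x ≡ w ⊎ Pole C x
      is sw f z₁s = [ inj₁ , inj₂ ∘ f ]′ (Out.one-of z₁w z₁s (λ e → no-loop (subst (_⟶ w) (sym e) sw)) z₁x)
    z₂-outlier : ∀ {x} → z₂ ↛ x → x ≡ v ⊎ Pole C x
    z₂-outlier {x} z₂x = [ is s₁v inj₁ , [ is s₂v inj₂ , ⊥-elim ∘ ¬self-↛ ]′ ]′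
      (outlying-of-3 z₂ dw s₁≢s₂ (s≢z₂ (inj₁ refl)) (s≢z₂ (inj₂ refl)) s₁w s₂w z₂w)
      where
      is : ∀ {s} → s ⟶ v → (x ≡ s → Pole C x) → z₂ ↛ s → x ≡ v ⊎ Pole C x
      is sv f z₂s = [ inj₁ , inj₂ ∘ f ]′ (Out.one-of z₂v z₂s (λ e → no-loop (subst (_⟶ v) (sym e) sv)) z₂x)
    not-2 : ∀ {s x} → Pole C s → d x ≡ 2 → ¬ s ⟶ x
    not-2 ps dx sx = [ is-3 dv , is-3 dw ]′ (pole-children C ps sx)
      where
      is-3 : ∀ {y} → d y ≡ 3 → _ ≢ y
      is-3 dy refl = case trans (sym dx) dy of λ ()
    w⟶ : ∀ {a x} → d x ≡ 2 → z₁ ⟶ a → a ↛ x → w ⟶ x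
    w⟶ {x = x} dx z₁a ax = go (outlying₂ (≤-reflexive (sym dx)) z₁a ax)
      where
      go : Outlying-parent z₁ x → w ⟶ x
      go (y , z₁y , yx) = [ (λ e → subst (_⟶ x) e yx) , (λ ps → ⊥-elim (not-2 ps dx yx)) ]′ (z₁-outlier z₁y)
    v⟶ : ∀ {a x} → d x ≡ 2 → z₂ ⟶ a → a ↛ x → v ⟶ x
    v⟶ {x = x} dx z₂a ax = go (outlying₂ (≤-reflexive (sym dx)) z₂a ax)
      where
      go : Outlying-parent z₂ x → v ⟶ x
      go (y , z₂y , yx) = [ (λ e → subst (_⟶ x) e yx) , (λ ps → ⊥-elim (not-2 ps dx yx)) ]′ (z₂-outlier z₂y)
    b-outlier : ∀ {x} → b ↛ x → Pole C x
    b-outlier {x} bx = go (in-degree x)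
      where
      go : In-degree x → Pole C x
      go (one dx) = ones dx
      go (two dx) = ⊥-elim (no-diamond s₁v s₁w v≢w (v⟶ dx z₂b bx) (w⟶ dx z₁b bx))
      go (three dx) = [ (λ { refl → ⊥-elim (no-loop (subst (_⟶ b) (↛v z₂v bx) z₂b)) })
                      , (λ { refl → ⊥-elim (no-loop (subst (_⟶ b) (↛w z₁w bx) z₁b)) }) ]′ (threes dx)
    b↛pole : ∀ {s} → Pole C s → b ↛ s
    b↛pole {s} ps = go ps (b-outlier (inj₁ refl)) (b-outlier (inj₂ refl))
      where
      go : Pole C s → Pole C (o₁ b) → Pole C (o₂ b) → b ↛ s
      go (inj₁ refl) (inj₁ e) _ = inj₁ (sym e)
      go (inj₁ refl) (inj₂ e) (inj₁ e′) = inj₂ (sym e′)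
      go (inj₁ refl) (inj₂ e) (inj₂ e′) = ⊥-elim (o₁≢o₂ b (trans e (sym e′)))
      go (inj₂ refl) (inj₂ e) _ = inj₁ (sym e)
      go (inj₂ refl) (inj₁ e) (inj₂ e′) = inj₂ (sym e′)
      go (inj₂ refl) (inj₁ e) (inj₁ e′) = ⊥-elim (o₁≢o₂ b (trans e (sym e′)))
    ¬v↛pole : ∀ {s} → Pole C s → ¬ v ↛ s
    ¬v↛pole {s} ps vs = go (outlying₁ (pole-d C ps) z₁v z₁b v≢b vs (b↛pole ps))
      where
      go : Outlying-parent z₁ s → ⊥
      go (x , z₁x , xs) = [ (λ e → ¬w⟶pole C ps (subst (_⟶ s) e xs)) , (λ px → ¬pole-arc C px ps xs) ]′ (z₁-outlier z₁x)
    z₂-degree : d z₂ ≡ 2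
    z₂-degree = degree-2 C ¬p₂ (λ { refl → ¬v⟶w C z₂w }) (λ { refl → no-loop z₂w })
    contra : ⊥
    contra = [ ¬v↛pole (inj₁ refl) , [ ¬v↛pole (inj₂ refl) , (λ vz₂ → no-2-cycle z₂w (w⟶ z₂-degree z₁v vz₂)) ]′ ]′
      (outlying-of-3 v dw s₁≢s₂ (s≢z₂ (inj₁ refl)) (s≢z₂ (inj₂ refl)) s₁w s₂w z₂w)

  -- By `sibling`, each of `z₁` and `z₂` misses either both poles or the child of the poles that is
  -- not its own.
  no-shared-child : ∀ {v w s₁ s₂ z₁ z₂ b} → Config₂ v w s₁ s₂ →
    ¬ (z₁ ≡ s₁ ⊎ z₁ ≡ s₂) → ¬ (z₂ ≡ s₁ ⊎ z₂ ≡ s₂) → z₁ ⟶ v → z₂ ⟶ w → z₁ ⟶ b →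
    v ≢ b → w ≢ b → ¬ z₂ ⟶ b
  no-shared-child {z₁ = z₁} {z₂} C ¬p₁ ¬p₂ z₁v z₂w z₁b v≢b w≢b z₂b = go
    (sibling (¬p₁ ∘ inj₁) z₁v s₁v s₁w v≢w) (sibling (¬p₁ ∘ inj₂) z₁v s₂v s₂w v≢w)
    (sibling (¬p₂ ∘ inj₁) z₂w s₁w s₁v (v≢w ∘ sym)) (sibling (¬p₂ ∘ inj₂) z₂w s₂w s₂v (v≢w ∘ sym))
    where
    open Config₂ C
    go : z₁ ↛ _ ⊎ z₁ ↛ _ → z₁ ↛ _ ⊎ z₁ ↛ _ → z₂ ↛ _ ⊎ z₂ ↛ _ → z₂ ↛ _ ⊎ z₂ ↛ _ → ⊥
    go (inj₁ z₁s₁) (inj₁ z₁s₂) _ _ = no-shared-child-a C ¬p₁ ¬p₂ z₁v z₂w z₁b z₂b v≢b w≢b z₁s₁ z₁s₂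
    go _ _ (inj₁ z₂s₁) (inj₁ z₂s₂) = no-shared-child-a (mirror C) ¬p₂ ¬p₁ z₂w z₁v z₂b z₁b w≢b v≢b z₂s₁ z₂s₂
    go (inj₂ z₁w) _ (inj₂ z₂v) _ = no-shared-child-b C ¬p₁ ¬p₂ z₁v z₂w z₁b z₂b v≢b w≢b z₁w z₂v
    go (inj₂ z₁w) _ _ (inj₂ z₂v) = no-shared-child-b C ¬p₁ ¬p₂ z₁v z₂w z₁b z₂b v≢b w≢b z₁w z₂v
    go _ (inj₂ z₁w) (inj₂ z₂v) _ = no-shared-child-b C ¬p₁ ¬p₂ z₁v z₂w z₁b z₂b v≢b w≢b z₁w z₂v
    go _ (inj₂ z₁w) _ (inj₂ z₂v) = no-shared-child-b C ¬p₁ ¬p₂ z₁v z₂w z₁b z₂b v≢b w≢b z₁w z₂v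

  -- Besides `s₂`, `s₁` has a single outlier. By `sibling` it is `z₁` or `p`, and also `z₂` or `q`;
  -- all four coincidences are excluded above.
  no-third-parents : ∀ {v w s₁ s₂ z₁ z₂ p q} → Config₂ v w s₁ s₂ →
    ¬ (z₁ ≡ s₁ ⊎ z₁ ≡ s₂) → ¬ (z₂ ≡ s₁ ⊎ z₂ ≡ s₂) → z₁ ⟶ v → z₂ ⟶ w → z₁ ⟶ p → v ≢ p → z₂ ⟶ q → w ≢ q → ⊥
  no-third-parents {v} {w} {s₁} {s₂} {z₁} {z₂} {p} {q} C ¬p₁ ¬p₂ z₁v z₂w z₁p v≢p z₂q w≢q = go
    (sibling (¬p₁ ∘ inj₁ ∘ sym) s₁v z₁v z₁p v≢p) (sibling (¬p₂ ∘ inj₁ ∘ sym) s₁w z₂w z₂q w≢q)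
    where
    open Config₂ C
    second : ∀ {x y} → s₁ ↛ x → s₁ ↛ y → x ≢ s₂ → y ≢ s₂ → x ≡ y
    second s₁x s₁y x≢ y≢ = sym (Out.the-other (s₁↛s₂ C) s₁x (x≢ ∘ sym) s₁y y≢)
    p≢s₂ : p ≢ s₂
    p≢s₂ refl = no-triangle z₁v z₁p s₂v
    q≢s₂ : q ≢ s₂
    q≢s₂ refl = no-triangle z₂w z₂q s₂w
    go : s₁ ↛ z₁ ⊎ s₁ ↛ p → s₁ ↛ z₂ ⊎ s₁ ↛ q → ⊥
    go (inj₁ s₁z₁) (inj₁ s₁z₂) = no-common-parent C ¬p₁ z₁v
      (subst (_⟶ w) (sym (second s₁z₁ s₁z₂ (¬p₁ ∘ inj₂) (¬p₂ ∘ inj₂))) z₂w)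
    go (inj₁ s₁z₁) (inj₂ s₁q) = no-nested-parents C ¬p₁ ¬p₂ z₁v z₂w z₁p v≢p s₁z₁
      (subst (z₂ ⟶_) (second s₁q s₁z₁ q≢s₂ (¬p₁ ∘ inj₂)) z₂q)
    go (inj₂ s₁p) (inj₁ s₁z₂) = no-nested-parents (mirror C) ¬p₂ ¬p₁ z₂w z₁v z₂q w≢q s₁z₂
      (subst (z₁ ⟶_) (second s₁p s₁z₂ p≢s₂ (¬p₂ ∘ inj₂)) z₁p)
    go (inj₂ s₁p) (inj₂ s₁q) = no-shared-child C ¬p₁ ¬p₂ z₁v z₂w z₁p v≢p
      (subst (w ≢_) q≡p w≢q) (subst (z₂ ⟶_) q≡p z₂q)
      where
      q≡p : q ≡ p
      q≡p = second s₁q s₁p q≢s₂ p≢s₂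

  no-Config₂ : ∀ {v w s₁ s₂} → ¬ Config₂ v w s₁ s₂
  no-Config₂ {s₁ = s₁} {s₂} C with fresh-parent (s₁ ∷ s₂ ∷ []) (≤-reflexive (sym (Config₂.dv C)))
                    | fresh-parent (s₁ ∷ s₂ ∷ []) (≤-reflexive (sym (Config₂.dw C)))
  ... | z₁ , z₁∉ , z₁v | z₂ , z₂∉ , z₂w with Arc.other z₁v | Arc.other z₂w
  ... | p , v≢p , z₁p | q , w≢q , z₂q = no-third-parents C
    [ z₁∉ ∘ here , z₁∉ ∘ there ∘ here ]′ [ z₂∉ ∘ here , z₂∉ ∘ there ∘ here ]′ z₁v z₂w z₁p v≢p z₂q w≢q

-- Two vertices of in-degree 1

module Large₂ {n i : ℕ} (X : BinaryGeodetic n (suc i)) where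
  open Deficient X
  open Levels X
  open Large X

  -- At most 2 (2m + 1) vertices can be saved, one more than the required 4m + 1. So both elements
  -- of `S` are parents of every vertex of in-degree 3, and at most one vertex misses such a vertex;
  -- this yields `Config₂`.
  not-two : length S ≢ 2
  not-two |S|≡2 = go S refl
    where
    open ≤-Reasoning
    S-parents≤2 : ∀ v → S-parents v ≤ 2
    S-parents≤2 v = ≤-trans (weight≤length (λ x → Arc.⟦⟧≤1 x v) S) (≤-reflexive |S|≡2)
    2≤S-parents : ∀ {v} → d v ≡ 3 → 2 ≤ S-parents v
    2≤S-parents {v} dv with 2 ≤? S-parents v
    ... | yes p = p
    ... | no ¬p = ⊥-elim (<-irrefl refl (≤-trans 1≤m (+-cancelˡ-≤ (3 * m + 1) m 0 (begin
      3 * m + 1 + m                        ≡⟨ l₁ m ⟩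
      4 * m + 1 + 0                        ≤⟨ S-parents-bound {l = []} dv [] [] ⟩
      length S * m + S-parents v * suc m   ≤⟨ +-mono-≤ (≤-reflexive (cong (_* m) |S|≡2)) (*-monoˡ-≤ (suc m) (≤-pred (≰⇒> ¬p))) ⟩
      2 * m + 1 * suc m                    ≡⟨ l₂ m ⟩
      3 * m + 1 + 0                        ∎))))
      where
      l₁ : ∀ m → 3 * m + 1 + m ≡ 4 * m + 1 + 0
      l₁ = solve-∀
      l₂ : ∀ m → 2 * m + 1 * suc m ≡ 3 * m + 1 + 0
      l₂ = solve-∀
    ↛-unique : ∀ {v x y} → d v ≡ 3 → x ↛ v → y ↛ v → x ≡ y
    ↛-unique {v} {x} {y} dv xv yv with x Fin.≟ y
    ... | yes e = e
    ... | no x≢y = case +-cancelˡ-≤ (4 * m + 2) 1 0 (begin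
      4 * m + 2 + 1                        ≡⟨ l₁ m ⟩
      4 * m + 1 + 2                        ≤⟨ S-parents-bound {l = x ∷ y ∷ []} dv ((x≢y ∷ []) ∷ [] ∷ []) (xv ∷ yv ∷ []) ⟩
      length S * m + S-parents v * suc m   ≤⟨ +-mono-≤ (≤-reflexive (cong (_* m) |S|≡2)) (*-monoˡ-≤ (suc m) (S-parents≤2 v)) ⟩
      2 * m + 2 * suc m                    ≡⟨ l₂ m ⟩
      4 * m + 2 + 0                        ∎) of λ ()
      where
      l₁ : ∀ m → 4 * m + 2 + 1 ≡ 4 * m + 1 + 2
      l₁ = solve-∀
      l₂ : ∀ m → 2 * m + 2 * suc m ≡ 4 * m + 2 + 0
      l₂ = solve-∀
    go : ∀ l → S ≡ l → ⊥
    go [] e = case trans (sym |S|≡2) (cong length e) of λ ()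
    go (_ ∷ []) e = case trans (sym |S|≡2) (cong length e) of λ ()
    go (_ ∷ _ ∷ _ ∷ _) e = case trans (sym |S|≡2) (cong length e) of λ ()
    go (s₁ ∷ s₂ ∷ []) e = config (excessive [] (subst (0 <_) (sym |S|≡2) (s≤s z≤n)))
      where
      arcs : ∀ {v} → d v ≡ 3 → s₁ ⟶ v × s₂ ⟶ v
      arcs {v} dv = Arc.⟦⟧≥1 (+-cancelʳ-≤ 1 1 _ (≤-trans 2≤ (+-monoʳ-≤ (A s₁ v) (Arc.⟦⟧≤1 s₂ v))))
                  , Arc.⟦⟧≥1 (+-cancelˡ-≤ 1 1 _ (≤-trans 2≤ (+-monoˡ-≤ (A s₂ v) (Arc.⟦⟧≤1 s₁ v))))
        where
        2≤ : 2 ≤ A s₁ v + A s₂ v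
        2≤ = ≤-trans (2≤S-parents dv) (≤-reflexive (trans (cong (weight (λ x → A x v)) e)
               (cong (A s₁ v +_) (+-identityʳ (A s₂ v)))))
      first : ∀ {s} → s ∈ s₁ ∷ s₂ ∷ [] → d s ≡ 1
      first s∈ = S⇒d≡1 (subst (_ ∈_) (sym e) s∈)
      s₁≢s₂ : s₁ ≢ s₂
      s₁≢s₂ with subst Unique e S-unique
      ... | (p ∷ []) ∷ _ = p
      config : ∃[ v ] v ∉ [] × d v ≡ 3 → ⊥
      config (v , _ , dv) with excessive (v ∷ []) (subst (1 <_) (sym |S|≡2) ≤-refl)
      ... | w , w∉ , dw = no-Config₂ {v} {w} {s₁} {s₂} record
        { s₁≢s₂ = s₁≢s₂ ; v≢w = w∉ ∘ here ∘ sym ; ds₁ = first (here refl) ; ds₂ = first (there (here refl))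
        ; dv = dv ; dw = dw
        ; s₁v = proj₁ (arcs dv) ; s₁w = proj₁ (arcs dw) ; s₂v = proj₂ (arcs dv) ; s₂w = proj₂ (arcs dw)
        ; ↛v = ↛-unique dv ; ↛w = ↛-unique dw
        ; ones = λ dx → two-of (subst (_ ∈_) e (∈S dx))
        ; threes = λ dx → Arc.one-of (proj₁ (arcs dv)) (proj₁ (arcs dw)) (w∉ ∘ here ∘ sym) (proj₁ (arcs dx)) }
        where
        two-of : ∀ {x} → x ∈ s₁ ∷ s₂ ∷ [] → x ≡ s₁ ⊎ x ≡ s₂
        two-of (here p) = inj₁ p
        two-of (there (here p)) = inj₂ p

-- k ≥ 3 with three vertices of in-degree 1

weight-∈ : ∀ {n} (f : Fin n → ℕ) {x} l → x ∈ l → f x ≤ weight f l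
weight-∈ f (x ∷ l) (here refl) = m≤m+n (f x) _
weight-∈ f (y ∷ l) (there x∈)  = ≤-trans (weight-∈ f l x∈) (m≤n+m _ (f y))

weight-∈-∈ : ∀ {n} (f : Fin n → ℕ) {x y} l → x ∈ l → y ∈ l → x ≢ y → f x + f y ≤ weight f l
weight-∈-∈ f (_ ∷ l) (here refl) (here refl) x≢y = ⊥-elim (x≢y refl)
weight-∈-∈ f {x} (_ ∷ l) (here refl) (there y∈) _ = +-monoʳ-≤ (f x) (weight-∈ f l y∈)
weight-∈-∈ f {x} {y} (_ ∷ l) (there x∈) (here refl) _ =
  ≤-trans (≤-reflexive (+-comm (f x) (f y))) (+-monoʳ-≤ (f y) (weight-∈ f l x∈))
weight-∈-∈ f (z ∷ l) (there x∈) (there y∈) x≢y = ≤-trans (weight-∈-∈ f l x∈ y∈ x≢y) (m≤n+m _ (f z))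

weight-positive : ∀ {n} (f : Fin n → ℕ) l → 1 ≤ weight f l → ∃[ x ] x ∈ l × 1 ≤ f x
weight-positive f (x ∷ l) p with f x in eq
... | zero with weight-positive f l p
...   | y , y∈ , q = y , there y∈ , q
weight-positive f (x ∷ l) p | suc _ = x , here refl , ≤-trans (s≤s z≤n) (≤-reflexive (sym eq))

weight-full : ∀ {n} (f : Fin n → ℕ) → (∀ x → f x ≤ 1) → ∀ {x} l → length l ≤ weight f l → x ∈ l → 1 ≤ f x
weight-full f f≤1 {x} (_ ∷ l) le (here refl) = +-cancelʳ-≤ (weight f l) 1 (f x)
  (≤-trans (s≤s (weight≤length f≤1 l)) le)
weight-full f f≤1 (y ∷ l) le (there x∈) =
  weight-full f f≤1 l (≤-pred (≤-trans le (+-monoˡ-≤ (weight f l) (f≤1 y)))) x∈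

module Large₃ {n i : ℕ} (X : BinaryGeodetic n (suc i)) (|S|≡3 : length (Deficient.S X) ≡ 3) where
  open Deficient X
  open Levels X

  -- With one parent in `S`, the savings (2m + 1) + m + m just reach 4m + 1, so the other two
  -- elements of `S` must sit on level 2, where each saves the full `m`.
  grandparents : ∀ {v} → d v ≡ 3 → S-parents v ≡ 1 → 2 ≤ p v 2
  grandparents {v} dv p₁ = bound₃ h (a v 2) (a v 3) L P₃ (p v 2)
    (subst (λ q → a v 3 * (2 * q) + P₃ ≤ L + a v 3 + P₃ * q) 2^i≡
      (growth (λ t → a v (3 + t)) (λ t → p v (3 + t)) (λ t → doubling v (3 + t)) i))
    (+-cancelʳ-≤ 1 5 _ (subst₂ (λ x y → 2 * x ≤ a v 2 + y) dv p₁ (doubling v 1)))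
    (doubling v 2)
    (≤-pred (≤-trans (s≤s (+-monoʳ-≤ (p v 2) (≤-trans (m≤m+n P₃ _)
      (≤-reflexive (sym (Σ<-snoc (λ t → p v (3 + t)) i))))))
      (≤-trans (≤-reflexive (cong (_+ (p v 2 + Σ< (λ t → p v (3 + t)) (suc i))) (sym p₁)))
      (≤-trans (m≤n+m _ (p v 0)) (≤-trans (Σp≤ v) (≤-reflexive |S|≡3))))))
    (≤-trans (≤-reflexive (trans (sym (cong₂ _+_ (a₀ v) (cong (_+ (a v 2 + L)) dv))) (sym (+-identityʳ _))))
      (≤-trans (Σa≤ v {[]} [] []) (≤-reflexive (trans order
        (cong suc (trans (lemma (2 ^ i)) (cong (16 *_) 2^i≡)))))))
    where
    L P₃ h : ℕ
    L = Σ< (λ t → a v (3 + t)) (suc i)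
    P₃ = Σ< (λ t → p v (3 + t)) i
    h = pred (2 ^ i)
    2^i≡ : 2 ^ i ≡ suc h
    2^i≡ = sym (suc-pred (2 ^ i) {{m^n≢0 2 i}})
    lemma : ∀ x → 2 * (2 * (2 * (2 * x))) ≡ 16 * x
    lemma = solve-∀

  -- `u` and another child of a parent of `u` together miss all three elements of `S`, and the other
  -- child misses only two vertices.
  outlier-in-S : ∀ u → ∃[ t ] t ∈ S × u ↛ t
  outlier-in-S u = go S refl (parent u)
    where
    go : ∀ l → S ≡ l → ∃[ w ] w ⟶ u → ∃[ t ] t ∈ l × u ↛ t
    go [] e = case trans (sym |S|≡3) (cong length e) of λ ()
    go (_ ∷ []) e = case trans (sym |S|≡3) (cong length e) of λ ()
    go (_ ∷ _ ∷ []) e = case trans (sym |S|≡3) (cong length e) of λ ()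
    go (_ ∷ _ ∷ _ ∷ _ ∷ _) e = case trans (sym |S|≡3) (cong length e) of λ ()
    go (s₁ ∷ s₂ ∷ s₃ ∷ []) e (w , wu) = pick (misses (here refl)) (misses (there (here refl))) (misses (there (there (here refl))))
      where
      u′ : Fin n
      u′ = proj₁ (Arc.other wu)
      misses : ∀ {s} → s ∈ s₁ ∷ s₂ ∷ s₃ ∷ [] → u ↛ s ⊎ u′ ↛ s
      misses s∈ = missed-by wu (proj₂ (proj₂ (Arc.other wu))) (proj₁ (proj₂ (Arc.other wu)))
        (missing₁ w (S⇒d≡1 (subst (_ ∈_) (sym e) s∈)))
      pick : u ↛ s₁ ⊎ u′ ↛ s₁ → u ↛ s₂ ⊎ u′ ↛ s₂ → u ↛ s₃ ⊎ u′ ↛ s₃ → ∃[ t ] t ∈ s₁ ∷ s₂ ∷ s₃ ∷ [] × u ↛ t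
      pick (inj₁ p) _ _ = s₁ , here refl , p
      pick _ (inj₁ p) _ = s₂ , there (here refl) , p
      pick _ _ (inj₁ p) = s₃ , there (there (here refl)) , p
      pick (inj₂ p) (inj₂ q) (inj₂ r) with subst Unique e S-unique
      ... | (s₁≢s₂ ∷ s₁≢s₃ ∷ []) ∷ (s₂≢s₃ ∷ []) ∷ _ =
        ⊥-elim ([ s₁≢s₃ ∘ sym , s₂≢s₃ ∘ sym ]′ (Out.one-of p q s₁≢s₂ r))

  -- If only one parent s of v is in S, every vertex of S lies at distance 1 or 2 from v.
  -- Let y be a parent of v missed by s, and z the third parent, with other child z′: then
  -- s misses z or z′ besides y, and also a vertex of S, so z′ ∈ S, whence z has a second walk to v.
  not-one-parent : ∀ {v s y z z′} → d v ≡ 3 → S-parents v ≡ 1 → s ∈ S → s ⟶ v → s ↛ y → y ⟶ v →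
                   z ≢ s → z ≢ y → z ⟶ v → z ⟶ z′ → v ≢ z′ → ⊥
  not-one-parent {v} {s} {y} {z} {z′} dv p₁ s∈ sv sy yv z≢s z≢y zv zz′ v≢z′ =
    go (outlier-in-S s) (sibling (z≢s ∘ sym) sv zv zz′ v≢z′)
    where
    f : Fin n → ℕ
    f x = W 1 x v + W 2 x v
    f≤1 : ∀ x → f x ≤ 1
    f≤1 x = ≤-trans (W+W≤R {1} {2} {k} ≤-refl (s≤s (s≤s z≤n)) x v) (geodetic x v)
    near : ∀ {x} → x ∈ S → 1 ≤ W 1 x v ⊎ 1 ≤ W 2 x v
    near x∈ = positive-+ (weight-full f f≤1 S (begin
      length S                                                   ≡⟨ |S|≡3 ⟩
      3                                                          ≤⟨ +-monoʳ-≤ 1 (grandparents dv p₁) ⟩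
      1 + p v 2                                                  ≡⟨ cong (_+ p v 2) p₁ ⟨
      weight (λ x → W 1 x v) S + weight (λ x → W 2 x v) S        ≡⟨ weight-+ (λ x → W 1 x v) (λ x → W 2 x v) S ⟩
      weight f S                                                 ∎) x∈)
      where open ≤-Reasoning
    not-in-S : ∀ {x} → x ≢ s → x ⟶ v → ¬ x ∈ S
    not-in-S x≢s xv x∈ = <-irrefl refl (≤-trans (+-mono-≤ (W-arc xv) (W-arc sv))
      (≤-trans (weight-∈-∈ (λ x → A x v) S x∈ s∈ x≢s) (≤-reflexive p₁)))
    y≢s : y ≢ s
    y≢s refl = ¬self-↛ sy
    ¬z′∈S : ¬ z′ ∈ S
    ¬z′∈S z′∈ = [ (λ q → no-triangle zv zz′ (Arc.⟦⟧≥1 q))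
                , (λ q → clash {1} {3} (s≤s (s≤s z≤n)) (s≤s (s≤s (s≤s z≤n))) (W-arc zv) (W-cons 2 zz′ q)) ]′ (near z′∈)
    go : ∃[ t ] t ∈ S × s ↛ t → s ↛ z ⊎ s ↛ z′ → ⊥
    go (t , t∈ , st) (inj₁ sz) = not-in-S z≢s zv (subst (_∈ S) (sym (Out.the-other sy st y≢t sz z≢y)) t∈)
      where
      y≢t : y ≢ t
      y≢t refl = not-in-S y≢s yv t∈
    go (t , t∈ , st) (inj₂ sz′) = ¬z′∈S (subst (_∈ S) (sym (Out.the-other sy st y≢t sz′ (λ { refl → no-triangle zv zz′ yv }))) t∈)
      where
      y≢t : y ≢ t
      y≢t refl = not-in-S y≢s yv t∈

  2≤S-parents : ∀ {v} → d v ≡ 3 → 2 ≤ S-parents v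
  2≤S-parents {v} dv = go (S-parents v) refl
    where
    open ≤-Reasoning
    l₁ : ∀ m → 3 * m + (m + 1) ≡ 4 * m + 1 + 0
    l₁ = solve-∀
    go : ∀ q → S-parents v ≡ q → 2 ≤ q
    go zero e = case ≤-trans (m≤n+m 1 m) (+-cancelˡ-≤ (3 * m) (m + 1) 0 (begin
      3 * m + (m + 1)                        ≡⟨ l₁ m ⟩
      4 * m + 1 + 0                          ≤⟨ S-parents-bound {l = []} dv [] [] ⟩
      length S * m + S-parents v * suc m     ≡⟨ cong₂ (λ x y → x * m + y * suc m) |S|≡3 e ⟩
      3 * m + 0                              ∎)) of λ ()
    go (suc (suc q)) e = s≤s (s≤s z≤n)
    go (suc zero) e with weight-positive (λ x → A x v) S (≤-reflexive (sym e))
    ... | s , s∈ , As with outlying₃ s dv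
    ... | y , sy , yv with fresh-parent (s ∷ y ∷ []) (≤-reflexive (sym dv))
    ... | z , z∉ , zv with Arc.other zv
    ... | z′ , v≢z′ , zz′ = ⊥-elim (not-one-parent dv e s∈ (Arc.⟦⟧≥1 As) sy yv
          (z∉ ∘ here) (z∉ ∘ there ∘ here) zv zz′ v≢z′)

  -- sᵢ is a parent of vⱼ exactly if i ≢ j.
  record Config₃ (s₁ s₂ s₃ v₁ v₂ v₃ : Fin n) : Set where
    field
      s₁≢s₂ : s₁ ≢ s₂
      s₁≢s₃ : s₁ ≢ s₃
      s₂≢s₃ : s₂ ≢ s₃
      dv₁ : d v₁ ≡ 3
      dv₂ : d v₂ ≡ 3
      dv₃ : d v₃ ≡ 3
      s₁v₂ : s₁ ⟶ v₂
      s₁v₃ : s₁ ⟶ v₃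
      s₂v₁ : s₂ ⟶ v₁
      s₂v₃ : s₂ ⟶ v₃
      s₃v₁ : s₃ ⟶ v₁
      s₃v₂ : s₃ ⟶ v₂
      ¬s₁v₁ : ¬ s₁ ⟶ v₁
      ¬s₂v₂ : ¬ s₂ ⟶ v₂
      ¬s₃v₃ : ¬ s₃ ⟶ v₃

    v₁≢v₂ : v₁ ≢ v₂
    v₁≢v₂ refl = ¬s₁v₁ s₁v₂
    v₁≢v₃ : v₁ ≢ v₃
    v₁≢v₃ refl = ¬s₁v₁ s₁v₃
    v₂≢v₃ : v₂ ≢ v₃
    v₂≢v₃ refl = ¬s₂v₂ s₂v₃

  swap₁₂ : ∀ {s₁ s₂ s₃ v₁ v₂ v₃} → Config₃ s₁ s₂ s₃ v₁ v₂ v₃ → Config₃ s₂ s₁ s₃ v₂ v₁ v₃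
  swap₁₂ C = record
    { s₁≢s₂ = s₁≢s₂ ∘ sym ; s₁≢s₃ = s₂≢s₃ ; s₂≢s₃ = s₁≢s₃ ; dv₁ = dv₂ ; dv₂ = dv₁ ; dv₃ = dv₃
    ; s₁v₂ = s₂v₁ ; s₁v₃ = s₂v₃ ; s₂v₁ = s₁v₂ ; s₂v₃ = s₁v₃ ; s₃v₁ = s₃v₂ ; s₃v₂ = s₃v₁
    ; ¬s₁v₁ = ¬s₂v₂ ; ¬s₂v₂ = ¬s₁v₁ ; ¬s₃v₃ = ¬s₃v₃ }
    where open Config₃ C

  swap₂₃ : ∀ {s₁ s₂ s₃ v₁ v₂ v₃} → Config₃ s₁ s₂ s₃ v₁ v₂ v₃ → Config₃ s₁ s₃ s₂ v₁ v₃ v₂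
  swap₂₃ C = record
    { s₁≢s₂ = s₁≢s₃ ; s₁≢s₃ = s₁≢s₂ ; s₂≢s₃ = s₂≢s₃ ∘ sym ; dv₁ = dv₁ ; dv₂ = dv₃ ; dv₃ = dv₂
    ; s₁v₂ = s₁v₃ ; s₁v₃ = s₁v₂ ; s₂v₁ = s₃v₁ ; s₂v₃ = s₃v₂ ; s₃v₁ = s₂v₁ ; s₃v₂ = s₂v₃
    ; ¬s₁v₁ = ¬s₁v₁ ; ¬s₂v₂ = ¬s₃v₃ ; ¬s₃v₃ = ¬s₂v₂ }
    where open Config₃ C

  -- Otherwise the second outlier of s₁ is a parent of v₁, v₂ and v₃.
  reaches-v₁ : ∀ {s₁ s₂ s₃ v₁ v₂ v₃ z₁ z₂ z₃} → Config₃ s₁ s₂ s₃ v₁ v₂ v₃ →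
    z₁ ≢ s₂ → z₁ ≢ s₃ → z₁ ⟶ v₁ → z₂ ≢ s₁ → z₂ ≢ s₃ → z₂ ⟶ v₂ → z₃ ≢ s₁ → z₃ ≢ s₂ → z₃ ⟶ v₃ → ¬ s₁ ↛ v₁
  reaches-v₁ {s₁} {s₂} {s₃} {v₁} {v₂} {v₃} {z₁} {z₂} {z₃} C z₁≢s₂ z₁≢s₃ z₁v₁ z₂≢s₁ z₂≢s₃ z₂v₂ z₃≢s₁ z₃≢s₂ z₃v₃ s₁v₁ =
    go hit₁ hit₂ hit₃
    where
    open Config₃ C
    g : Fin n
    g = proj₁ (Out.other s₁v₁)
    second : ∀ {x} → s₁ ↛ x → x ≢ v₁ → x ≡ g
    second = Out.the-other s₁v₁ (proj₂ (proj₂ (Out.other s₁v₁))) (proj₁ (proj₂ (Out.other s₁v₁)))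
    hit₁ : g ≡ s₂ ⊎ g ≡ s₃ ⊎ g ≡ z₁
    hit₁ = [ (λ q → inj₁ (sym (second q λ { refl → no-loop s₂v₁ })))
           , [ (λ q → inj₂ (inj₁ (sym (second q λ { refl → no-loop s₃v₁ }))))
             , (λ q → inj₂ (inj₂ (sym (second q λ { refl → no-loop z₁v₁ })))) ]′ ]′
           (outlying-of-3 s₁ dv₁ s₂≢s₃ (z₁≢s₂ ∘ sym) (z₁≢s₃ ∘ sym) s₂v₁ s₃v₁ z₁v₁)
    hit₂ : g ≡ s₃ ⊎ g ≡ z₂
    hit₂ = [ ⊥-elim ∘ ¬self-↛
           , [ (λ q → inj₁ (sym (second q λ { refl → no-loop s₃v₁ })))
             , (λ q → inj₂ (sym (second q λ { refl → no-triangle s₃v₂ s₃v₁ z₂v₂ }))) ]′ ]′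
           (outlying-of-3 s₁ dv₂ s₁≢s₃ (z₂≢s₁ ∘ sym) (z₂≢s₃ ∘ sym) s₁v₂ s₃v₂ z₂v₂)
    hit₃ : g ≡ s₂ ⊎ g ≡ z₃
    hit₃ = [ ⊥-elim ∘ ¬self-↛
           , [ (λ q → inj₁ (sym (second q λ { refl → no-loop s₂v₁ })))
             , (λ q → inj₂ (sym (second q λ { refl → no-triangle s₂v₃ s₂v₁ z₃v₃ }))) ]′ ]′
           (outlying-of-3 s₁ dv₃ s₁≢s₂ (z₃≢s₁ ∘ sym) (z₃≢s₂ ∘ sym) s₁v₃ s₂v₃ z₃v₃)
    no-three : g ⟶ v₁ → g ⟶ v₂ → g ⟶ v₃ → ⊥
    no-three p q r = [ v₁≢v₃ ∘ sym , v₂≢v₃ ∘ sym ]′ (Arc.one-of p q v₁≢v₂ r)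
    go : g ≡ s₂ ⊎ g ≡ s₃ ⊎ g ≡ z₁ → g ≡ s₃ ⊎ g ≡ z₂ → g ≡ s₂ ⊎ g ≡ z₃ → ⊥
    go _ (inj₁ e) (inj₁ e′) = s₂≢s₃ (trans (sym e′) e)
    go _ (inj₁ e) (inj₂ e′) = ¬s₃v₃ (subst (_⟶ v₃) (trans (sym e′) e) z₃v₃)
    go _ (inj₂ e) (inj₁ e′) = ¬s₂v₂ (subst (_⟶ v₂) (trans (sym e) e′) z₂v₂)
    go (inj₁ e″) (inj₂ e) (inj₂ e′) = ¬s₂v₂ (subst (_⟶ v₂) (trans (sym e) e″) z₂v₂)
    go (inj₂ (inj₁ e″)) (inj₂ e) (inj₂ e′) = ¬s₃v₃ (subst (_⟶ v₃) (trans (sym e′) e″) z₃v₃)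
    go (inj₂ (inj₂ e″)) (inj₂ e) (inj₂ e′) = no-three (subst (_⟶ v₁) (sym e″) z₁v₁)
      (subst (_⟶ v₂) (sym e) z₂v₂) (subst (_⟶ v₃) (sym e′) z₃v₃)

  module Third {s₁ s₂ s₃ v₁ v₂ v₃ z₁ z₂ z₃} (C : Config₃ s₁ s₂ s₃ v₁ v₂ v₃)
    (z₁≢s₂ : z₁ ≢ s₂) (z₁≢s₃ : z₁ ≢ s₃) (z₁v₁ : z₁ ⟶ v₁) (z₂≢s₁ : z₂ ≢ s₁) (z₂≢s₃ : z₂ ≢ s₃) (z₂v₂ : z₂ ⟶ v₂)
    (z₃≢s₁ : z₃ ≢ s₁) (z₃≢s₂ : z₃ ≢ s₂) (z₃v₃ : z₃ ⟶ v₃) where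
    open Config₃ C

    s₁↛s₂ : s₁ ↛ s₂
    s₁↛s₂ = [ (λ q → q) , ⊥-elim ∘ reaches-v₁ C z₁≢s₂ z₁≢s₃ z₁v₁ z₂≢s₁ z₂≢s₃ z₂v₂ z₃≢s₁ z₃≢s₂ z₃v₃ ]′
      (sibling s₁≢s₂ s₁v₃ s₂v₃ s₂v₁ (v₁≢v₃ ∘ sym))

    s₁↛s₃ : s₁ ↛ s₃
    s₁↛s₃ = [ (λ q → q) , ⊥-elim ∘ reaches-v₁ C z₁≢s₂ z₁≢s₃ z₁v₁ z₂≢s₁ z₂≢s₃ z₂v₂ z₃≢s₁ z₃≢s₂ z₃v₃ ]′
      (sibling s₁≢s₃ s₁v₂ s₃v₂ s₃v₁ (v₁≢v₂ ∘ sym))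

    -- As `s₁` misses just `s₂` and `s₃`, `sibling` makes the second child of `z₂` one of these, and
    -- `s₃` would close a triangle.
    z₂⟶s₂ : z₂ ⟶ s₂
    z₂⟶s₂ = go (Arc.other z₂v₂)
      where
      go : ∃[ x ] v₂ ≢ x × z₂ ⟶ x → z₂ ⟶ s₂
      go (x , v₂≢x , z₂x) = [ (λ q → [ (λ { refl → ⊥-elim (¬s₂v₂ z₂v₂) }) , ⊥-elim ∘ z₂≢s₃ ]′ (s₂-or-s₃ q))
                            , (λ q → [ (λ { refl → z₂x }) , (λ { refl → ⊥-elim (no-triangle z₂v₂ z₂x s₃v₂) }) ]′ (s₂-or-s₃ q)) ]′
                            (sibling (z₂≢s₁ ∘ sym) s₁v₂ z₂v₂ z₂x v₂≢x)
        where
        s₂-or-s₃ : ∀ {y} → s₁ ↛ y → y ≡ s₂ ⊎ y ≡ s₃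
        s₂-or-s₃ = Out.one-of s₁↛s₂ s₁↛s₃ s₂≢s₃

  module _ {s₁ s₂ s₃ v₁ v₂ v₃ z₁ z₂ z₃} (C : Config₃ s₁ s₂ s₃ v₁ v₂ v₃)
    (z₁≢s₂ : z₁ ≢ s₂) (z₁≢s₃ : z₁ ≢ s₃) (z₁v₁ : z₁ ⟶ v₁) (z₂≢s₁ : z₂ ≢ s₁) (z₂≢s₃ : z₂ ≢ s₃) (z₂v₂ : z₂ ⟶ v₂)
    (z₃≢s₁ : z₃ ≢ s₁) (z₃≢s₂ : z₃ ≢ s₂) (z₃v₃ : z₃ ⟶ v₃) where
    open Config₃ C

    z₁⟶s₁ : z₁ ⟶ s₁
    z₁⟶s₁ = Third.z₂⟶s₂ (swap₁₂ C) z₂≢s₁ z₂≢s₃ z₂v₂ z₁≢s₂ z₁≢s₃ z₁v₁ z₃≢s₂ z₃≢s₁ z₃v₃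

    -- `z₁` has to miss a parent of `v₂`; but neither `s₂` nor `v₂` is one.
    not-s₂-v₂ : z₁ ↛ s₂ → ¬ z₁ ↛ v₂
    not-s₂-v₂ z₁s₂ z₁v₂ = [ (λ q → ¬⟶-↛ z₁⟶s₁ q) , [ excluded (s₂≢s₃ ∘ sym) s₃v₂ , excluded (λ { refl → ¬s₂v₂ z₂v₂ }) z₂v₂ ]′ ]′
      (outlying-of-3 z₁ dv₂ s₁≢s₃ (z₂≢s₁ ∘ sym) (z₂≢s₃ ∘ sym) s₁v₂ s₃v₂ z₂v₂)
      where
      excluded : ∀ {x} → x ≢ s₂ → x ⟶ v₂ → ¬ z₁ ↛ x
      excluded x≢s₂ xv₂ z₁x = [ x≢s₂ , (λ { refl → no-loop xv₂ }) ]′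
        (Out.one-of z₁s₂ z₁v₂ (λ { refl → no-triangle s₃v₁ s₃v₂ s₂v₁ }) z₁x)

    -- Missing two parents of `v₁` forces the other child of `z₁`, which is `s₁`, to miss `v₁`.
    not-s₂-s₃ : z₁ ↛ s₂ → ¬ z₁ ↛ s₃
    not-s₂-s₃ z₁s₂ z₁s₃ =
      reaches-v₁ C z₁≢s₂ z₁≢s₃ z₁v₁ z₂≢s₁ z₂≢s₃ z₂v₂ z₃≢s₁ z₃≢s₂ z₃v₃
        (missed-by-other z₁v₁ z₁⟶s₁ (λ { refl → no-triangle s₂v₃ s₂v₁ s₁v₃ })
          (missing₃ dv₁ z₁s₂ z₁s₃ s₂≢s₃ s₂v₁ s₃v₁))

    not-v₂-v₃ : z₁ ↛ v₂ → ¬ z₁ ↛ v₃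
    not-v₂-v₃ z₁v₂ z₁v₃ = [ excluded (λ { refl → no-triangle s₃v₁ s₃v₂ s₂v₁ }) (λ { refl → no-loop s₂v₃ })
                          , [ excluded (λ { refl → no-loop s₃v₂ }) (λ { refl → no-triangle s₂v₁ s₂v₃ s₃v₁ })
                            , ¬self-↛ ]′ ]′
      (outlying-of-3 z₁ dv₁ s₂≢s₃ (z₁≢s₂ ∘ sym) (z₁≢s₃ ∘ sym) s₂v₁ s₃v₁ z₁v₁)
      where
      excluded : ∀ {x} → x ≢ v₂ → x ≢ v₃ → ¬ z₁ ↛ x
      excluded p q z₁x = [ p , q ]′ (Out.one-of z₁v₂ z₁v₃ v₂≢v₃ z₁x)

  -- By `sibling`, `z₁` misses `s₂` or `v₃`, and also `s₃` or `v₂`. Of the four cases two are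
  -- exchanged by `swap₂₃`.
  no-Config₃ : ∀ {s₁ s₂ s₃ v₁ v₂ v₃} → ¬ Config₃ s₁ s₂ s₃ v₁ v₂ v₃
  no-Config₃ {s₁} {s₂} {s₃} {v₁} {v₂} {v₃} C
    with fresh-parent (s₂ ∷ s₃ ∷ []) (≤-reflexive (sym (Config₃.dv₁ C)))
       | fresh-parent (s₁ ∷ s₃ ∷ []) (≤-reflexive (sym (Config₃.dv₂ C)))
       | fresh-parent (s₁ ∷ s₂ ∷ []) (≤-reflexive (sym (Config₃.dv₃ C)))
  ... | z₁ , z₁∉ , z₁v₁ | z₂ , z₂∉ , z₂v₂ | z₃ , z₃∉ , z₃v₃ = go
      (sibling z₁≢s₂ z₁v₁ s₂v₁ s₂v₃ v₁≢v₃) (sibling z₁≢s₃ z₁v₁ s₃v₁ s₃v₂ v₁≢v₂)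
    where
    open Config₃ C
    z₁≢s₂ : z₁ ≢ s₂
    z₁≢s₂ = z₁∉ ∘ here
    z₁≢s₃ : z₁ ≢ s₃
    z₁≢s₃ = z₁∉ ∘ there ∘ here
    z₂≢s₁ : z₂ ≢ s₁
    z₂≢s₁ = z₂∉ ∘ here
    z₂≢s₃ : z₂ ≢ s₃
    z₂≢s₃ = z₂∉ ∘ there ∘ here
    z₃≢s₁ : z₃ ≢ s₁
    z₃≢s₁ = z₃∉ ∘ here
    z₃≢s₂ : z₃ ≢ s₂
    z₃≢s₂ = z₃∉ ∘ there ∘ here
    go : z₁ ↛ s₂ ⊎ z₁ ↛ v₃ → z₁ ↛ s₃ ⊎ z₁ ↛ v₂ → ⊥
    go (inj₁ p) (inj₁ q) = not-s₂-s₃ C z₁≢s₂ z₁≢s₃ z₁v₁ z₂≢s₁ z₂≢s₃ z₂v₂ z₃≢s₁ z₃≢s₂ z₃v₃ p q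
    go (inj₁ p) (inj₂ q) = not-s₂-v₂ C z₁≢s₂ z₁≢s₃ z₁v₁ z₂≢s₁ z₂≢s₃ z₂v₂ z₃≢s₁ z₃≢s₂ z₃v₃ p q
    go (inj₂ p) (inj₁ q) = not-s₂-v₂ (swap₂₃ C) z₁≢s₃ z₁≢s₂ z₁v₁ z₃≢s₁ z₃≢s₂ z₃v₃ z₂≢s₁ z₂≢s₃ z₂v₂ q p
    go (inj₂ p) (inj₂ q) = not-v₂-v₃ C z₁≢s₂ z₁≢s₃ z₁v₁ z₂≢s₁ z₂≢s₃ z₂v₂ z₃≢s₁ z₃≢s₂ z₃v₃ q p

  -- Each s ∈ S has only two children, hence is no parent of some v with d v ≡ 3;
  -- all other members of S are then parents of v.
  avoided : ∀ s → ∃[ v ] d v ≡ 3 × ¬ s ⟶ v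
  avoided s with excessive (c₁ s ∷ c₂ s ∷ []) (≤-reflexive (sym |S|≡3))
  ... | v , v∉ , dv = v , dv , [ v∉ ∘ here , v∉ ∘ there ∘ here ]′

  two-of-three : ∀ {a b c} → a ≡ 0 → b ≤ 1 → c ≤ 1 → 2 ≤ a + (b + (c + 0)) → 1 ≤ b × 1 ≤ c
  two-of-three {b = b} {c} refl b≤1 c≤1 le rewrite +-identityʳ c =
    +-cancelʳ-≤ 1 1 b (≤-trans le (+-monoʳ-≤ b c≤1)) , +-cancelˡ-≤ 1 1 c (≤-trans le (+-monoˡ-≤ c b≤1))

  impossible : ⊥
  impossible = go S refl
    where
    go : ∀ l → S ≡ l → ⊥
    go [] e = case trans (sym |S|≡3) (cong length e) of λ ()
    go (_ ∷ []) e = case trans (sym |S|≡3) (cong length e) of λ ()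
    go (_ ∷ _ ∷ []) e = case trans (sym |S|≡3) (cong length e) of λ ()
    go (_ ∷ _ ∷ _ ∷ _ ∷ _) e = case trans (sym |S|≡3) (cong length e) of λ ()
    go (s₁ ∷ s₂ ∷ s₃ ∷ []) e with subst Unique e S-unique | avoided s₁ | avoided s₂ | avoided s₃
    ... | (s₁≢s₂ ∷ s₁≢s₃ ∷ []) ∷ (s₂≢s₃ ∷ []) ∷ _ | v₁ , dv₁ , ¬s₁v₁ | v₂ , dv₂ , ¬s₂v₂ | v₃ , dv₃ , ¬s₃v₃ =
      no-Config₃ {s₁} {s₂} {s₃} {v₁} {v₂} {v₃} record
        { s₁≢s₂ = s₁≢s₂ ; s₁≢s₃ = s₁≢s₃ ; s₂≢s₃ = s₂≢s₃ ; dv₁ = dv₁ ; dv₂ = dv₂ ; dv₃ = dv₃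
        ; s₁v₂ = Arc.⟦⟧≥1 (proj₁ p₂) ; s₁v₃ = Arc.⟦⟧≥1 (proj₁ p₃)
        ; s₂v₁ = Arc.⟦⟧≥1 (proj₁ p₁) ; s₂v₃ = Arc.⟦⟧≥1 (proj₂ p₃)
        ; s₃v₁ = Arc.⟦⟧≥1 (proj₂ p₁) ; s₃v₂ = Arc.⟦⟧≥1 (proj₂ p₂)
        ; ¬s₁v₁ = ¬s₁v₁ ; ¬s₂v₂ = ¬s₂v₂ ; ¬s₃v₃ = ¬s₃v₃ }
      where
      total : ∀ {v} → d v ≡ 3 → 2 ≤ A s₁ v + (A s₂ v + (A s₃ v + 0))
      total {v} dv = ≤-trans (2≤S-parents dv) (≤-reflexive (cong (weight (λ x → A x v)) e))
      swap : ∀ a b c → a + (b + (c + 0)) ≡ b + (a + (c + 0))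
      swap = solve-∀
      rotate : ∀ a b c → a + (b + (c + 0)) ≡ c + (a + (b + 0))
      rotate = solve-∀
      p₁ : 1 ≤ A s₂ v₁ × 1 ≤ A s₃ v₁
      p₁ = two-of-three (Arc.⟦⟧-no ¬s₁v₁) (Arc.⟦⟧≤1 s₂ v₁) (Arc.⟦⟧≤1 s₃ v₁) (total dv₁)
      p₂ : 1 ≤ A s₁ v₂ × 1 ≤ A s₃ v₂
      p₂ = two-of-three (Arc.⟦⟧-no ¬s₂v₂) (Arc.⟦⟧≤1 s₁ v₂) (Arc.⟦⟧≤1 s₃ v₂)
        (≤-trans (total dv₂) (≤-reflexive (swap (A s₁ v₂) (A s₂ v₂) (A s₃ v₂))))
      p₃ : 1 ≤ A s₁ v₃ × 1 ≤ A s₂ v₃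
      p₃ = two-of-three (Arc.⟦⟧-no ¬s₃v₃) (Arc.⟦⟧≤1 s₁ v₃) (Arc.⟦⟧≤1 s₂ v₃)
        (≤-trans (total dv₃) (≤-reflexive (rotate (A s₁ v₃) (A s₂ v₃) (A s₃ v₃))))

-- k = 2

-- The row (x , a , b) says that the children of vertex x are a and b.
Row : Set
Row = ℕ × ℕ × ℕ

children : List Row → ℕ → List ℕ
children []                x = []
children ((y , a , b) ∷ t) x = if does (y ≟ x) then a ∷ b ∷ [] else children t x

ball : List Row → ℕ → List ℕ
ball t x = x ∷ children t x ++ concatMap (children t) (children t x)

Has-0 : Row → Set
Has-0 (_ , a , b) = a ≡ 0 ⊎ b ≡ 0

has-0? : ∀ r → Dec (Has-0 r)
has-0? (_ , a , b) = (a ≟ 0) ⊎-dec (b ≟ 0)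

-- Necessary conditions on a partial table: no repetition in a ball of radius 2, absent rows
-- counting as empty, and at most one parent for 0, which stands for a vertex of in-degree 1. Both
-- survive deleting rows, so an inconsistent table can be abandoned.
Consistent : List Row → Set
Consistent t = All (λ r → Unique (ball t (proj₁ r))) t × AllPairs (λ r r′ → ¬ (Has-0 r × Has-0 r′)) t

consistent? : ∀ t → Dec (Consistent t)
consistent? t = All.all? (λ r → unique? (ball t (proj₁ r))) t
  ×-dec AllPairs.allPairs? (λ r r′ → ¬? (has-0? r ×-dec has-0? r′)) t

pairs : List (ℕ × ℕ)
pairs = filter (λ (a , b) → a <? b) (cartesianProduct (upTo 9) (upTo 9))

-- The ball of radius 2 around 0 in breadth-first order; 7 and 8 are the outliers of 0. The rows 3
-- to 8 remain to be searched.
root-rows : List Row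
root-rows = (2 , 5 , 6) ∷ (1 , 3 , 4) ∷ (0 , 1 , 2) ∷ []

all-lookup : ∀ {A : Set} (f : A → Bool) {x} l → all f l ≡ true → x ∈ l → f x ≡ true
all-lookup f (x ∷ l) e x∈ with f x in fx
all-lookup f (x ∷ l) e (here refl) | true = fx
all-lookup f (x ∷ l) e (there x∈)  | true = all-lookup f l e x∈

abstract
  -- The table t has no consistent extension by rows for x , … , x + f - 1.
  -- This is a Boolean function rather than a Dec, as its evaluation takes far less memory.
  refuted : ℕ → ℕ → List Row → Bool
  refuted zero    x t = false
  refuted (suc f) x t = all (λ ab → not (does (consistent? ((x , ab) ∷ t))) ∨ refuted f (suc x) ((x , ab) ∷ t)) pairs

  refuted-zero : ∀ {x t} → refuted 0 x t ≢ true
  refuted-zero ()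

  refuted-suc : ∀ {f x t ab} → refuted (suc f) x t ≡ true → ab ∈ pairs → Consistent ((x , ab) ∷ t) →
                refuted f (suc x) ((x , ab) ∷ t) ≡ true
  refuted-suc {f} {x} {t} {ab} e ab∈ c = trans
    (cong (λ b → not b ∨ refuted f (suc x) ((x , ab) ∷ t)) (sym (dec-true (consistent? ((x , ab) ∷ t)) c)))
    (all-lookup (λ ab → not (does (consistent? ((x , ab) ∷ t))) ∨ refuted f (suc x) ((x , ab) ∷ t)) pairs e ab∈)

  no-table : refuted 6 3 root-rows ≡ true
  no-table = refl

count-++ : ∀ {n} (l l′ : List (Fin n)) v → count (l ++ l′) v ≡ count l v + count l′ v
count-++ []      l′ v = refl
count-++ (x ∷ l) l′ v = trans (cong (δ x v +_) (count-++ l l′ v)) (sym (+-assoc (δ x v) _ _))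

count≤1⇒unique : ∀ {n} (l : List (Fin n)) → (∀ v → count l v ≤ 1) → Unique l
count≤1⇒unique [] _ = []
count≤1⇒unique (x ∷ l) le = All.tabulate x∉ ∷ count≤1⇒unique l (λ v → ≤-trans (m≤n+m _ (δ x v)) (le v))
  where
  x∉ : ∀ {y} → y ∈ l → x ≢ y
  x∉ y∈ refl = <-irrefl refl (≤-trans (+-mono-≤ (≤-reflexive (sym (δ-refl x))) (count-∈ l y∈)) (le x))

position : ∀ {n} → List (Fin n) → Fin n → ℕ
position []      v = 0
position (x ∷ l) v = if does (x Fin.≟ v) then 0 else suc (position l v)

nth : ∀ {n} → Fin n → List (Fin n) → ℕ → Fin n
nth z []      m       = z
nth z (x ∷ l) zero    = x
nth z (x ∷ l) (suc m) = nth z l m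

module _ {n : ℕ} where

  position-injective : ∀ {v w : Fin n} l → v ∈ l → position l v ≡ position l w → v ≡ w
  position-injective {v} {w} (x ∷ l) v∈ e with x Fin.≟ v | x Fin.≟ w
  ... | yes p | yes q = trans (sym p) q
  position-injective (x ∷ l) (here refl) e | no ¬p | no _ = ⊥-elim (¬p refl)
  position-injective (x ∷ l) (there v∈) e | no _ | no _ = position-injective l v∈ (suc-injective e)

  position-< : ∀ {v : Fin n} l → v ∈ l → position l v < length l
  position-< {v} (x ∷ l) v∈ with x Fin.≟ v
  ... | yes _ = s≤s z≤n
  position-< (x ∷ l) (here refl) | no ¬p = ⊥-elim (¬p refl)
  position-< (x ∷ l) (there v∈)  | no _  = s≤s (position-< l v∈)

  nth-∈ : ∀ (z : Fin n) l {m} → m < length l → nth z l m ∈ l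
  nth-∈ z (x ∷ l) {zero}  _       = here refl
  nth-∈ z (x ∷ l) {suc m} (s≤s p) = there (nth-∈ z l p)

  position-nth : ∀ (z : Fin n) l {m} → Unique l → m < length l → position l (nth z l m) ≡ m
  position-nth z (x ∷ l) {zero}  _ _ rewrite dec-true (x Fin.≟ x) refl = refl
  position-nth z (x ∷ l) {suc m} (x∉ ∷ u) (s≤s p)
    rewrite dec-false (x Fin.≟ nth z l m) (All.lookup x∉ (nth-∈ z l p)) = cong suc (position-nth z l u p)

-- The vertices carry the numbers 0 , … , 8, starting in breadth-first order from s.
module Numbered {n : ℕ} (X : BinaryGeodetic n 0) (s : Fin n) (ds : Balance.d X s ≡ 1)
  (pos : Fin n → ℕ) (pos-injective : ∀ {v w} → pos v ≡ pos w → v ≡ w) (pos-< : ∀ v → pos v < 9)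
  (at : ℕ → Fin n) (pos-at : ∀ {m} → m < 9 → pos (at m) ≡ m)
  (e₀ : pos s ≡ 0) (e₁ : pos (Balance.c₁ X s) ≡ 1) (e₂ : pos (Balance.c₂ X s) ≡ 2)
  (e₃ : pos (Balance.c₁ X (Balance.c₁ X s)) ≡ 3) (e₄ : pos (Balance.c₂ X (Balance.c₁ X s)) ≡ 4)
  (e₅ : pos (Balance.c₁ X (Balance.c₂ X s)) ≡ 5) (e₆ : pos (Balance.c₂ X (Balance.c₂ X s)) ≡ 6) where
  open Balance X

  sorted : Fin n → Fin n × Fin n
  sorted v = if pos (c₁ v) <ᵇ pos (c₂ v) then (c₁ v , c₂ v) else (c₂ v , c₁ v)

  lo hi : Fin n → Fin n
  lo v = proj₁ (sorted v)
  hi v = proj₂ (sorted v)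

  lo<hi : ∀ v → pos (lo v) < pos (hi v)
  lo<hi v with pos (c₁ v) <ᵇ pos (c₂ v) in eq
  ... | true  = <ᵇ⇒< _ _ (subst T (sym eq) _)
  ... | false = ≤∧≢⇒< (≮⇒≥ λ lt → subst T eq (<⇒<ᵇ lt)) (λ e → c₁≢c₂ v (pos-injective (sym e)))

  ⟶lo : ∀ v → v ⟶ lo v
  ⟶lo v with pos (c₁ v) <ᵇ pos (c₂ v)
  ... | true  = inj₁ refl
  ... | false = inj₂ refl

  ⟶hi : ∀ v → v ⟶ hi v
  ⟶hi v with pos (c₁ v) <ᵇ pos (c₂ v)
  ... | true  = inj₂ refl
  ... | false = inj₁ refl

  lo≢hi : ∀ v → lo v ≢ hi v
  lo≢hi v e = <-irrefl (cong pos e) (lo<hi v)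

  entry : Fin n → ℕ × ℕ
  entry v = pos (lo v) , pos (hi v)

  row : Fin n → Row
  row v = pos v , entry v

  entry∈pairs : ∀ v → entry v ∈ pairs
  entry∈pairs v = ∈-filter⁺ (λ (a , b) → a <? b)
    (∈-cartesianProduct⁺ (∈-upTo⁺ (pos-< (lo v))) (∈-upTo⁺ (pos-< (hi v)))) (lo<hi v)

  known-children : List (Fin n) → Fin n → List (Fin n)
  known-children []       v = []
  known-children (w ∷ vs) v = if does (w Fin.≟ v) then lo w ∷ hi w ∷ [] else known-children vs v

  children-rows : ∀ vs v → children (map row vs) (pos v) ≡ map pos (known-children vs v)
  children-rows [] v = refl
  children-rows (w ∷ vs) v with w Fin.≟ v
  ... | yes refl rewrite dec-true (pos w ≟ pos w) refl = refl
  ... | no w≢v rewrite dec-false (pos w ≟ pos v) (w≢v ∘ pos-injective) = children-rows vs v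

  known-ball : List (Fin n) → Fin n → List (Fin n)
  known-ball vs v = v ∷ known-children vs v ++ concatMap (known-children vs) (known-children vs v)

  ball-rows : ∀ vs v → ball (map row vs) (pos v) ≡ map pos (known-ball vs v)
  ball-rows vs v = cong (pos v ∷_) (trans
    (cong₂ _++_ (children-rows vs v)
      (trans (cong (concatMap (children (map row vs))) (children-rows vs v)) (below (known-children vs v))))
    (sym (map-++ pos (known-children vs v) _)))
    where
    below : ∀ l → concatMap (children (map row vs)) (map pos l) ≡ map pos (concatMap (known-children vs) l)
    below [] = refl
    below (w ∷ l) = trans (cong₂ _++_ (children-rows vs w) (below l)) (sym (map-++ pos (known-children vs w) _))

  data Known (v : Fin n) : List (Fin n) → Set where
    none : Known v []
    both : Known v (lo v ∷ hi v ∷ [])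

  known : ∀ vs v → Known v (known-children vs v)
  known [] v = none
  known (w ∷ vs) v with w Fin.≟ v
  ... | yes refl = both
  ... | no _ = known vs v

  count-known : ∀ {v l} → Known v l → ∀ x → count l x ≤ A v x
  count-known none x = z≤n
  count-known {v} both x = ≤-reflexive (trans (cong (δ (lo v) x +_) (+-identityʳ _))
    (Arc.∑-values (λ w → δ w x) (⟶lo v) (⟶hi v) (lo≢hi v)))

  -- A partial table sees only some of the arcs, so its ball is part of the true one, with
  -- multiplicities; `geodetic` then rules out repetitions.
  count-ball : ∀ vs v x → count (known-ball vs v) x ≤ R 2 v x
  count-ball vs v x with known-children vs v | known vs v
  ... | .[] | none = +-monoʳ-≤ (δ v x) z≤n
  ... | .(lo v ∷ hi v ∷ []) | both = begin
    δ v x + (δ (lo v) x + (δ (hi v) x + count (K (lo v) ++ K (hi v) ++ []) x))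
      ≡⟨ cong (λ z → δ v x + (δ (lo v) x + (δ (hi v) x + z))) (trans (count-++ (K (lo v)) _ x)
           (cong (count (K (lo v)) x +_) (trans (count-++ (K (hi v)) [] x) (+-identityʳ _)))) ⟩
    δ v x + (δ (lo v) x + (δ (hi v) x + (count (K (lo v)) x + count (K (hi v)) x)))
      ≡⟨ lemma (δ v x) (δ (lo v) x) (δ (hi v) x) (count (K (lo v)) x) _ ⟩
    δ v x + (δ (lo v) x + count (K (lo v)) x + (δ (hi v) x + count (K (hi v)) x))
      ≤⟨ +-monoʳ-≤ (δ v x) (+-mono-≤ (+-monoʳ-≤ (δ (lo v) x) (count-known (known vs (lo v)) x))
                                     (+-monoʳ-≤ (δ (hi v) x) (count-known (known vs (hi v)) x))) ⟩
    δ v x + (R 1 (lo v) x + R 1 (hi v) x)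
      ≡⟨ R-step 1 x (⟶lo v) (⟶hi v) (lo≢hi v) ⟨
    R 2 v x ∎
    where
    open ≤-Reasoning
    K : Fin n → List (Fin n)
    K = known-children vs
    lemma : ∀ a b c d e → a + (b + (c + (d + e))) ≡ a + (b + d + (c + e))
    lemma = solve-∀

  consistent : ∀ {vs} → Unique vs → Consistent (map row vs)
  consistent {vs} u = All.map⁺ (All.tabulate λ {v} _ → ball-unique v) , AllPairs.map⁺ (AllPairs.map not-both u)
    where
    ball-unique : ∀ v → Unique (ball (map row vs) (pos v))
    ball-unique v = subst Unique (sym (ball-rows vs v)) (Unique.map⁺ pos-injective
      (count≤1⇒unique (known-ball vs v) (λ x → ≤-trans (count-ball vs v x) (geodetic v x))))
    parent-of-s : ∀ {v} → Has-0 (row v) → v ⟶ s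
    parent-of-s {v} (inj₁ e) = subst (v ⟶_) (pos-injective (trans e (sym e₀))) (⟶lo v)
    parent-of-s {v} (inj₂ e) = subst (v ⟶_) (pos-injective (trans e (sym e₀))) (⟶hi v)
    not-both : ∀ {v w} → v ≢ w → ¬ (Has-0 (row v) × Has-0 (row w))
    not-both v≢w (p , q) = <-irrefl refl (subst (2 ≤_) ds
      (parents-≤ ((v≢w ∷ []) ∷ [] ∷ []) (parent-of-s p ∷ parent-of-s q ∷ [])))

  -- The rows of the actual digraph form a branch that the search never prunes, and at its end
  -- `refuted 0` is false.
  not-refuted : ∀ f x vs → f + x ≡ 9 → Unique vs → All (λ v → pos v < x) vs → refuted f x (map row vs) ≢ true
  not-refuted zero    x vs e u below r = refuted-zero r
  not-refuted (suc f) x vs e u below r = not-refuted f (suc x) (at x ∷ vs) (trans (+-suc f x) e) u′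
    (≤-reflexive (cong suc (pos-at x<9)) ∷ All.map m≤n⇒m≤1+n below)
    (trans (cong (refuted f (suc x)) eq)
           (refuted-suc r (entry∈pairs (at x)) (subst Consistent eq (consistent u′))))
    where
    x<9 : x < 9
    x<9 = subst (suc x ≤_) e (s≤s (m≤n+m x f))
    t′ : List Row
    t′ = (x , entry (at x)) ∷ map row vs
    u′ : Unique (at x ∷ vs)
    u′ = All.map (λ lt e → <-irrefl (trans (cong pos (sym e)) (pos-at x<9)) lt) below ∷ u
    eq : map row (at x ∷ vs) ≡ t′
    eq = cong (λ y → (y , entry (at x)) ∷ map row vs) (pos-at x<9)

  row-≡ : ∀ {v x a b} → pos v ≡ x → pos (c₁ v) ≡ a → pos (c₂ v) ≡ b → a < b → row v ≡ (x , a , b)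
  row-≡ {v} refl refl refl a<b with pos (c₁ v) <ᵇ pos (c₂ v) | <⇒<ᵇ a<b
  ... | true | _ = refl

  impossible : ⊥
  impossible = not-refuted 6 3 (c₂ s ∷ c₁ s ∷ s ∷ []) refl
    ((differ e₂ e₁ (λ ()) ∷ differ e₂ e₀ (λ ()) ∷ []) ∷ (differ e₁ e₀ (λ ()) ∷ []) ∷ [] ∷ [])
    (below e₂ (s≤s (s≤s (s≤s z≤n))) ∷ below e₁ (s≤s (s≤s z≤n)) ∷ below e₀ (s≤s z≤n) ∷ [])
    (trans (cong (refuted 6 3) (cong₂ _∷_ (row-≡ e₂ e₅ e₆ ≤-refl)
      (cong₂ _∷_ (row-≡ e₁ e₃ e₄ ≤-refl) (cong (_∷ []) (row-≡ e₀ e₁ e₂ ≤-refl))))) no-table)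
    where
    differ : ∀ {v w a b} → pos v ≡ a → pos w ≡ b → a ≢ b → v ≢ w
    differ ev ew a≢b refl = a≢b (trans (sym ev) ew)
    below : ∀ {v a} → pos v ≡ a → a < 3 → pos v < 3
    below ev a<3 = subst (_< 3) (sym ev) a<3

module Small {n : ℕ} (X : BinaryGeodetic n 0) (s : Fin n) (ds : Balance.d X s ≡ 1) where
  open Balance X

  numbering : List (Fin n)
  numbering = s ∷ c₁ s ∷ c₂ s ∷ c₁ (c₁ s) ∷ c₂ (c₁ s) ∷ c₁ (c₂ s) ∷ c₂ (c₂ s) ∷ o₁ s ∷ o₂ s ∷ []

  -- This is `R+P` at `s`, written out for k = 2.
  count-numbering : ∀ v → count numbering v ≡ 1
  count-numbering v = trans (lemma (δ s v) (δ (c₁ s) v) (δ (c₂ s) v) (δ (c₁ (c₁ s)) v) (δ (c₂ (c₁ s)) v)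
    (δ (c₁ (c₂ s)) v) (δ (c₂ (c₂ s)) v) (δ (o₁ s) v) (δ (o₂ s) v)) (R+P s v)
    where
    lemma : ∀ a b c d e f g h i → a + (b + (c + (d + (e + (f + (g + (h + (i + 0)))))))) ≡
                                  a + (b + (d + e) + (c + (f + g))) + (h + i)
    lemma = solve-∀

  complete : ∀ v → v ∈ numbering
  complete v = count≥1⇒∈ numbering (≤-reflexive (sym (count-numbering v)))

  position-at : ∀ {m} → m < 9 → position numbering (nth s numbering m) ≡ m
  position-at = position-nth s numbering (count≤1⇒unique numbering (λ v → ≤-reflexive (count-numbering v)))

  impossible : ⊥
  impossible = Numbered.impossible X s ds (position numbering) (λ {v} → position-injective numbering (complete v))
    (λ v → position-< numbering (complete v)) (nth s numbering) position-at
    (position-at {0} (toWitness {a? = 0 <? 9} _)) (position-at {1} (toWitness {a? = 1 <? 9} _))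
    (position-at {2} (toWitness {a? = 2 <? 9} _)) (position-at {3} (toWitness {a? = 3 <? 9} _))
    (position-at {4} (toWitness {a? = 4 <? 9} _)) (position-at {5} (toWitness {a? = 5 <? 9} _))
    (position-at {6} (toWitness {a? = 6 <? 9} _))

-- Arbitrary digraphs

in-degree-2 : ∀ {n i} (X : BinaryGeodetic n i) v → Balance.d X v ≡ 2
in-degree-2 {i = i} X v = go i X (length (Deficient.S X)) refl (Deficient.|S|≤4 X v)
  where
  go : ∀ i (X : BinaryGeodetic _ i) r → length (Deficient.S X) ≡ r → r ≤ 4 → Balance.d X v ≡ 2
  go i       X 0 e _ = Deficient.regular X e v
  go i       X 4 e _ = ⊥-elim (Deficient.Four.impossible X e)
  go zero    X (suc _) e _ = ⊥-elim (small (Deficient.S X) refl)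
    where
    small : ∀ l → Deficient.S X ≡ l → ⊥
    small []      e′ = case trans (sym e) (cong length e′) of λ ()
    small (s ∷ l) e′ = Small.impossible X s (Deficient.S⇒d≡1 X (subst (s ∈_) (sym e′) (here refl)))
  go (suc i) X 1 e _ = ⊥-elim (Large.not-one X e)
  go (suc i) X 2 e _ = ⊥-elim (Large₂.not-two X e)
  go (suc i) X 3 e _ = ⊥-elim (Large₃.impossible X e)
  go (suc i) X (suc (suc (suc (suc (suc _))))) e (s≤s (s≤s (s≤s (s≤s ()))))

1+M : ∀ k → suc (M 2 k) ≡ 2 ^ suc k
1+M zero    = refl
1+M (suc k) = trans (cong (_+ 2 ^ suc k) (1+M k)) (cong (2 ^ suc k +_) (sym (+-identityʳ (2 ^ suc k))))

+-≤1 : ∀ {a b} → a ≤ 1 → b ≤ 1 → (1 ≤ a → 1 ≤ b → ⊥) → a + b ≤ 1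
+-≤1 {zero}  _ b≤1 _ = b≤1
+-≤1 {suc a} {zero}  a≤1 _ _ = ≤-trans (≤-reflexive (+-identityʳ _)) a≤1
+-≤1 {suc a} {suc b} _ _ ex = ⊥-elim (ex (s≤s z≤n) (s≤s z≤n))

sum-allFin : ∀ n (f : Fin n → ℕ) → ListAction.sum (map f (allFin n)) ≡ sum f
sum-allFin n f = trans (cong ListAction.sum (map-tabulate (λ i → i) f)) (sum-tabulate n f)
  where
  sum-tabulate : ∀ n (f : Fin n → ℕ) → ListAction.sum (tabulate f) ≡ sum f
  sum-tabulate zero    f = refl
  sum-tabulate (suc n) f = cong (f zero +_) (sum-tabulate n (f ∘ suc))

module FromDigraph {n i : ℕ} (G : Digraph n) (geo : Geodetic G (2 + i))
  (2≤outdeg : ∀ u → 2 ≤ outdeg G u) (n≡M+2 : n ≡ M 2 (2 + i) + 2) where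

  arc : Fin n → Fin n → ℕ
  arc u v = if G u v then 1 else 0

  arc≤1 : ∀ u v → arc u v ≤ 1
  arc≤1 u v with G u v
  ... | true  = ≤-refl
  ... | false = z≤n

  arc≥1 : ∀ {u v} → 1 ≤ arc u v → G u v ≡ true
  arc≥1 {u} {v} p with G u v
  ... | true = refl

  2≤sum : ∀ u → 2 ≤ sum (arc u)
  2≤sum u = ≤-trans (2≤outdeg u) (≤-reflexive (sum-allFin n (arc u)))

  abstract
    child₁ : ∀ u → ∃[ a ] a ∉ [] × 1 ≤ arc u a
    child₁ u = fresh-positive (arc u) [] (arc≤1 u) (≤-trans (s≤s z≤n) (2≤sum u))

    child₂ : ∀ u → ∃[ b ] b ∉ proj₁ (child₁ u) ∷ [] × 1 ≤ arc u b
    child₂ u = fresh-positive (arc u) (proj₁ (child₁ u) ∷ []) (arc≤1 u) (2≤sum u)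

  c₁ c₂ : Fin n → Fin n
  c₁ u = proj₁ (child₁ u)
  c₂ u = proj₁ (child₂ u)

  c₁≢c₂ : ∀ u → c₁ u ≢ c₂ u
  c₁≢c₂ u e = proj₁ (proj₂ (child₂ u)) (here (sym e))

  G-c₁ : ∀ u → G u (c₁ u) ≡ true
  G-c₁ u = arc≥1 (proj₂ (proj₂ (child₁ u)))

  G-c₂ : ∀ u → G u (c₂ u) ≡ true
  G-c₂ u = arc≥1 (proj₂ (proj₂ (child₂ u)))

  open Walks c₁ c₂

  walk : ∀ j {u v} → 1 ≤ R j u v → ∃[ l ] l ≤ j × Walk G l u v
  walk zero {u} {v} p with refl ← δ-positive {u = u} {v} p = 0 , z≤n , nil
  walk (suc j) {u} {v} p with u Fin.≟ v
  ... | yes refl = 0 , z≤n , nil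
  ... | no _ with R j (c₁ u) v in eq
  ...   | suc _ with walk j {c₁ u} {v} (≤-trans (s≤s z≤n) (≤-reflexive (sym eq)))
  ...     | l , l≤j , w = suc l , s≤s l≤j , cons (G-c₁ u) w
  walk (suc j) {u} {v} p | no _ | zero with walk j {c₂ u} {v} p
  ...     | l , l≤j , w = suc l , s≤s l≤j , cons (G-c₂ u) w

  starts-with : ∀ {l u v} (w : Walk G l u v) → ∃[ t ] vertices G w ≡ u ∷ t
  starts-with nil        = [] , refl
  starts-with (cons _ w) = vertices G w , refl

  no-closed-walk : ∀ {j u v a} → suc j ≤ 2 + i → G u a ≡ true → 1 ≤ δ u v → 1 ≤ R j a v → ⊥
  no-closed-walk {j} {u} {v} j<k ua u≡v p with refl ← δ-positive {u = u} {v} u≡v with walk j p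
  ... | l , l≤j , w with geo z≤n (≤-trans (s≤s l≤j) j<k) nil (cons ua w) | starts-with w
  ...   | e | t , e′ with () ← trans (∷-injectiveʳ e) e′

  no-two-walks : ∀ {j u v a b} → suc j ≤ 2 + i → G u a ≡ true → G u b ≡ true → a ≢ b →
                 1 ≤ R j a v → 1 ≤ R j b v → ⊥
  no-two-walks {j} j<k ua ub a≢b p q with walk j p | walk j q
  ... | l , l≤j , w | l′ , l′≤j , w′
    with geo (≤-trans (s≤s l≤j) j<k) (≤-trans (s≤s l′≤j) j<k) (cons ua w) (cons ub w′) | starts-with w | starts-with w′
  ...   | e | _ , e₁ | _ , e₂ = a≢b (∷-injectiveˡ (trans (sym e₁) (trans (∷-injectiveʳ e) e₂)))

  -- A sum of counts exceeds 1 only if a summand does or two are positive. Two positive ones yield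
  -- an empty and a nonempty walk, or two walks that differ in their second vertex.
  R≤1 : ∀ j → j ≤ 2 + i → ∀ u v → R j u v ≤ 1
  R≤1 zero _ u v with u Fin.≟ v
  ... | yes _ = ≤-refl
  ... | no _  = z≤n
  R≤1 (suc j) j<k u v = +-≤1 (R≤1 zero z≤n u v)
    (+-≤1 (R≤1 j (≤-trans (n≤1+n j) j<k) _ v) (R≤1 j (≤-trans (n≤1+n j) j<k) _ v)
      (no-two-walks j<k (G-c₁ u) (G-c₂ u) (c₁≢c₂ u)))
    (λ u≡v p → [ no-closed-walk j<k (G-c₁ u) u≡v , no-closed-walk j<k (G-c₂ u) u≡v ]′ (positive-+ p))

  order : n ≡ suc (2 ^ (3 + i))
  order = trans n≡M+2 (trans (+-comm (M 2 (2 + i)) 2) (cong suc (1+M (2 + i))))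

  X : BinaryGeodetic n i
  X = record { c₁ = c₁ ; c₂ = c₂ ; c₁≢c₂ = c₁≢c₂ ; geodetic = R≤1 (2 + i) ≤-refl ; order = order }

  -- The balls around u and a third child c would be disjoint and have too many vertices together.
  only-children : ∀ {u c} → G u c ≡ true → c ≢ c₁ u → c ≢ c₂ u → ⊥
  only-children {u} {c} uc c≢c₁ c≢c₂ = <-irrefl refl (begin-strict
    suc (2 ^ (3 + i)) + 3                            <⟨ +-monoʳ-< (suc (2 ^ (3 + i))) (*-monoʳ-≤ 2 (*-monoʳ-≤ 2 (m^n>0 2 i))) ⟩
    suc (2 ^ (3 + i)) + 2 ^ (2 + i)                  ≡⟨ cong₂ (λ x y → suc x + y) (sum-R (2 + i) u) (sum-R (1 + i) c) ⟨
    suc (suc (sum (R (2 + i) u))) + suc (sum (R (1 + i) c))  ≡⟨ lemma (sum (R (2 + i) u)) _ ⟩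
    sum (R (2 + i) u) + sum (R (1 + i) c) + 3        ≡⟨ cong (_+ 3) (∑-distrib-+ (R (2 + i) u) (R (1 + i) c)) ⟨
    sum (λ v → R (2 + i) u v + R (1 + i) c v) + 3    ≤⟨ +-monoˡ-≤ 3 (sum-mono disjoint) ⟩
    sum {n} (λ _ → 1) + 3                            ≡⟨ cong (_+ 3) (trans (sum-const n 1) (trans (*-identityʳ n) order)) ⟩
    suc (2 ^ (3 + i)) + 3                            ∎)
    where
    open ≤-Reasoning
    lemma : ∀ x y → suc (suc x) + suc y ≡ x + y + 3
    lemma = solve-∀
    disjoint : ∀ v → R (2 + i) u v + R (1 + i) c v ≤ 1
    disjoint v = +-≤1 (R≤1 (2 + i) ≤-refl u v) (R≤1 (1 + i) (n≤1+n _) c v) λ p q →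
      [ (λ u≡v → no-closed-walk ≤-refl uc u≡v q)
      , (λ r → [ (λ p₁ → no-two-walks ≤-refl uc (G-c₁ u) c≢c₁ q p₁)
               , (λ p₂ → no-two-walks ≤-refl uc (G-c₂ u) c≢c₂ q p₂) ]′ (positive-+ r)) ]′ (positive-+ p)

  arc≡A : ∀ u v → arc u v ≡ A u v
  arc≡A u v with G u v in eq
  ... | true with v Fin.≟ c₁ u | v Fin.≟ c₂ u
  ...   | yes e  | _      = sym (Balance.Arc.⟦⟧-yes X (inj₁ e))
  ...   | no _   | yes e  = sym (Balance.Arc.⟦⟧-yes X (inj₂ e))
  ...   | no ≢c₁ | no ≢c₂ = ⊥-elim (only-children eq ≢c₁ ≢c₂)
  arc≡A u v | false = sym (Balance.Arc.⟦⟧-no X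
    [ (λ e → case trans (sym eq) (trans (cong (G u) e) (G-c₁ u)) of λ ())
    , (λ e → case trans (sym eq) (trans (cong (G u) e) (G-c₂ u)) of λ ()) ]′)

  diregular : Diregular G
  diregular = 2 , λ u →
    trans (sum-allFin n (λ w → arc w u)) (trans (sum-cong-≗ λ w → arc≡A w u) (in-degree-2 X u)) ,
    trans (sum-allFin n (arc u)) (trans (sum-cong-≗ (arc≡A u))
      (trans (∑-distrib-+ (δ (c₁ u)) (δ (c₂ u))) (cong₂ _+_ (sum-δ₁ (c₁ u)) (sum-δ₁ (c₂ u)))))

mainTheorem1 : (k : ℕ) → 2 ≤ k →
    ¬ (Σ ℕ λ n → Σ (Digraph n) λ G →
    Geodetic G k × (∀ u → 2 ≤ outdeg G u) × n ≡ M 2 k + 2 × ¬ Diregular G)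
mainTheorem1 (suc zero) (s≤s ())
mainTheorem1 (suc (suc i)) _ (n , G , geo , 2≤outdeg , n≡M+2 , ¬diregular) =
  ¬diregular (FromDigraph.diregular G geo 2≤outdeg n≡M+2)
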